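{- Let $x$ be a complex number with $|x|<1$, let $E(x)=\prod_{n=1}^{\infty}(1-x^{n})$, and let $I_0,I_1,I_2$ be the components of type $0,1,2$ mod $3$ of the power series $E(x)E(x^{2})$. Then $$I_{2}I_{0}=-2I_{1}^{2}\qquad\text{and}\qquad I_{1}=-x\,E(x^{9})E(x^{18}).$$
   Context: A power series of the form $\sum_{n\ge 0}b(n)x^{3n+r}$ with $0\le r<3$ is said to be of type $r$ mod $3$. Write $E(x)E(x^2)=\prod_{n=1}^{\infty}(1-x^{n})(1-x^{2n})=\sum_{j\ge 0}c_j x^{j}$ for $|x|<1$. For $k\in\{0,1,2\}$, $I_k=I_k(x)=\sum_{j\equiv k\,(\mathrm{mod}\,3)}c_jx^{j}$, so that $E(x)E(x^2)=I_0+I_1+I_2$ with $I_k$ of type $k$ mod $3$. -}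

module Defs where

open import Data.Bool using (if_then_else_)
open import Data.Integer as ℤ using (ℤ; 0ℤ; 1ℤ; -1ℤ)
open import Data.Nat as ℕ using (ℕ; zero; suc; _∸_; _%_; _≡ᵇ_)
import Data.Nat.Properties as ℕ
open import Data.Product using (_×_; _,_; ∃-syntax)
open import Data.Rational as ℚ using (ℚ; 0ℚ; 1ℚ; ½; ∣_∣; 1/_; Positive; NonZero; positive; nonNegative)
import Data.Rational.Properties as ℚ
open import Data.Rational.Solver using (module +-*-Solver)
open import Relation.Binary.PropositionalEquality using (_≡_; refl; sym; trans; cong; subst)

-- Reals are Cauchy sequences of rationals, with _≃ᴿ_ as equality.

IsCauchy : (ℕ → ℚ) → Set
IsCauchy s = ∀ ε → 0ℚ ℚ.< ε → ∃[ N ] (∀ m n → N ℕ.≤ m → N ℕ.≤ n → ∣ s m ℚ.- s n ∣ ℚ.< ε)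

record ℝ : Set where
  constructor mkℝ
  field
    seq    : ℕ → ℚ
    cauchy : IsCauchy seq

open ℝ public

infix 4 _≃ᴿ_ _<ᴿ_

_≃ᴿ_ : ℝ → ℝ → Set
a ≃ᴿ b = ∀ ε → 0ℚ ℚ.< ε → ∃[ N ] (∀ n → N ℕ.≤ n → ∣ seq a n ℚ.- seq b n ∣ ℚ.< ε)

_<ᴿ_ : ℝ → ℝ → Set
a <ᴿ b = ∃[ ε ] (0ℚ ℚ.< ε × ∃[ N ] (∀ n → N ℕ.≤ n → seq a n ℚ.+ ε ℚ.≤ seq b n))

open +-*-Solver

private abstract

  neg-diff : ∀ a b → ℚ.- (a ℚ.- b) ≡ (ℚ.- a) ℚ.- (ℚ.- b)
  neg-diff = solve 2 (λ a b → :- (a :- b) := (:- a) :- (:- b)) refl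

  shift : ∀ a b → a ≡ b ℚ.+ (a ℚ.- b)
  shift = solve 2 (λ a b → a := b :+ (a :- b)) refl

  +-diff : ∀ a b c d → (a ℚ.+ b) ℚ.- (c ℚ.+ d) ≡ (a ℚ.- c) ℚ.+ (b ℚ.- d)
  +-diff = solve 4 (λ a b c d → (a :+ b) :- (c :+ d) := (a :- c) :+ (b :- d)) refl

  *-diff : ∀ a b c d → a ℚ.* b ℚ.- c ℚ.* d ≡ a ℚ.* (b ℚ.- d) ℚ.+ d ℚ.* (a ℚ.- c)
  *-diff = solve 4 (λ a b c d → a :* b :- c :* d := a :* (b :- d) :+ d :* (a :- c)) refl

  ½-pos : ∀ {ε} → 0ℚ ℚ.< ε → 0ℚ ℚ.< ½ ℚ.* ε
  ½-pos {ε} 0<ε = ℚ.positive⁻¹ (½ ℚ.* ε) {{ℚ.pos*pos⇒pos ½ ε {{positive 0<ε}}}}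

  ½+½ : ∀ ε → ½ ℚ.* ε ℚ.+ ½ ℚ.* ε ≡ ε
  ½+½ ε = trans (sym (ℚ.*-distribʳ-+ ε ½ ½)) (ℚ.*-identityˡ ε)

  const-cauchy : ∀ q → IsCauchy (λ _ → q)
  const-cauchy q ε 0<ε = 0 , λ _ _ _ _ →
    subst (ℚ._< ε) (sym (cong ∣_∣ (ℚ.+-inverseʳ q))) 0<ε

  neg-cauchy : ∀ {s} → IsCauchy s → IsCauchy (λ n → ℚ.- s n)
  neg-cauchy {s} cs ε 0<ε with cs ε 0<ε
  ... | N , h = N , λ m n N≤m N≤n →
    subst (ℚ._< ε)
      (trans (sym (ℚ.∣-p∣≡∣p∣ (s m ℚ.- s n)))
             (cong ∣_∣ (neg-diff (s m) (s n))))
      (h m n N≤m N≤n)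

  +-cauchy : ∀ {s t} → IsCauchy s → IsCauchy t → IsCauchy (λ n → s n ℚ.+ t n)
  +-cauchy {s} {t} cs ct ε 0<ε with cs (½ ℚ.* ε) (½-pos 0<ε) | ct (½ ℚ.* ε) (½-pos 0<ε)
  ... | M , h | N , k = M ℕ.⊔ N , λ m n p q → begin-strict
      ∣ (s m ℚ.+ t m) ℚ.- (s n ℚ.+ t n) ∣
        ≡⟨ cong ∣_∣ (+-diff (s m) (t m) (s n) (t n)) ⟩
      ∣ (s m ℚ.- s n) ℚ.+ (t m ℚ.- t n) ∣
        ≤⟨ ℚ.∣p+q∣≤∣p∣+∣q∣ (s m ℚ.- s n) (t m ℚ.- t n) ⟩
      ∣ s m ℚ.- s n ∣ ℚ.+ ∣ t m ℚ.- t n ∣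
        <⟨ ℚ.+-mono-< (h m n (ℕ.m⊔n≤o⇒m≤o M N p) (ℕ.m⊔n≤o⇒m≤o M N q))
                      (k m n (ℕ.m⊔n≤o⇒n≤o M N p) (ℕ.m⊔n≤o⇒n≤o M N q)) ⟩
      ½ ℚ.* ε ℚ.+ ½ ℚ.* ε
        ≡⟨ ½+½ ε ⟩
      ε ∎
    where open ℚ.≤-Reasoning

  eventually-bounded : ∀ {s} → IsCauchy s →
    ∃[ B ] (Positive B × ∃[ N ] (∀ n → N ℕ.≤ n → ∣ s n ∣ ℚ.≤ B))
  eventually-bounded {s} cs with cs 1ℚ (ℚ.positive⁻¹ 1ℚ)
  ... | N , h = ∣ s N ∣ ℚ.+ 1ℚ
              , ℚ.nonNeg+pos⇒pos ∣ s N ∣ {{nonNegative (ℚ.0≤∣p∣ (s N))}} 1ℚ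
              , N , λ n N≤n → begin
      ∣ s n ∣
        ≡⟨ cong ∣_∣ (shift (s n) (s N)) ⟩
      ∣ s N ℚ.+ (s n ℚ.- s N) ∣
        ≤⟨ ℚ.∣p+q∣≤∣p∣+∣q∣ (s N) (s n ℚ.- s N) ⟩
      ∣ s N ∣ ℚ.+ ∣ s n ℚ.- s N ∣
        ≤⟨ ℚ.+-monoʳ-≤ ∣ s N ∣ (ℚ.<⇒≤ (h n N N≤n ℕ.≤-refl)) ⟩
      ∣ s N ∣ ℚ.+ 1ℚ ∎
    where open ℚ.≤-Reasoning

  *-bound : ∀ {p q B δ} → Positive B → ∣ p ∣ ℚ.≤ B → ∣ q ∣ ℚ.< δ → ∣ p ℚ.* q ∣ ℚ.< B ℚ.* δ
  *-bound {p} {q} {B} {δ} B>0 p≤B q<δ = begin-strict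
      ∣ p ℚ.* q ∣      ≡⟨ ℚ.∣p*q∣≡∣p∣*∣q∣ p q ⟩
      ∣ p ∣ ℚ.* ∣ q ∣  ≤⟨ ℚ.*-monoʳ-≤-nonNeg ∣ q ∣ {{nonNegative (ℚ.0≤∣p∣ q)}} p≤B ⟩
      B ℚ.* ∣ q ∣      <⟨ ℚ.*-monoʳ-<-pos B {{B>0}} q<δ ⟩
      B ℚ.* δ          ∎
    where open ℚ.≤-Reasoning

  divide : ∀ C {ε} → Positive C → 0ℚ ℚ.< ε → ∃[ δ ] (0ℚ ℚ.< δ × C ℚ.* δ ≡ ε)
  divide C {ε} C>0 0<ε = D ℚ.* ε
      , ℚ.positive⁻¹ (D ℚ.* ε) {{ℚ.pos*pos⇒pos D {{ℚ.1/pos⇒pos C {{C>0}}}} ε {{positive 0<ε}}}}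
      , trans (sym (ℚ.*-assoc C D ε))
              (trans (cong (ℚ._* ε) (ℚ.*-inverseʳ C {{C≢0}})) (ℚ.*-identityˡ ε))
    where
    C≢0 : NonZero C
    C≢0 = ℚ.pos⇒nonZero C {{C>0}}
    D : ℚ
    D = (1/ C) {{C≢0}}

  *-close : ∀ a b a′ b′ A B δ → Positive A → Positive B → ∣ a ∣ ℚ.≤ A → ∣ b′ ∣ ℚ.≤ B →
    ∣ a ℚ.- a′ ∣ ℚ.< δ → ∣ b ℚ.- b′ ∣ ℚ.< δ →
    ∣ a ℚ.* b ℚ.- a′ ℚ.* b′ ∣ ℚ.< (A ℚ.+ B) ℚ.* δ
  *-close a b a′ b′ A B δ A>0 B>0 a≤A b′≤B p q = begin-strict
      ∣ a ℚ.* b ℚ.- a′ ℚ.* b′ ∣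
        ≡⟨ cong ∣_∣ (*-diff a b a′ b′) ⟩
      ∣ a ℚ.* (b ℚ.- b′) ℚ.+ b′ ℚ.* (a ℚ.- a′) ∣
        ≤⟨ ℚ.∣p+q∣≤∣p∣+∣q∣ (a ℚ.* (b ℚ.- b′)) (b′ ℚ.* (a ℚ.- a′)) ⟩
      ∣ a ℚ.* (b ℚ.- b′) ∣ ℚ.+ ∣ b′ ℚ.* (a ℚ.- a′) ∣
        <⟨ ℚ.+-mono-< (*-bound {a} {b ℚ.- b′} {A} {δ} A>0 a≤A q)
                      (*-bound {b′} {a ℚ.- a′} {B} {δ} B>0 b′≤B p) ⟩
      A ℚ.* δ ℚ.+ B ℚ.* δ
        ≡⟨ ℚ.*-distribʳ-+ δ A B ⟨
      (A ℚ.+ B) ℚ.* δ ∎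
    where open ℚ.≤-Reasoning

  *-cauchy : ∀ {s t} → IsCauchy s → IsCauchy t → IsCauchy (λ n → s n ℚ.* t n)
  *-cauchy {s} {t} cs ct ε 0<ε =
    let A , A>0 , M₁ , s≤A = eventually-bounded cs
        B , B>0 , N₁ , t≤B = eventually-bounded ct
        δ , 0<δ , Cδ≡ε     = divide (A ℚ.+ B) (ℚ.pos+pos⇒pos A {{A>0}} B {{B>0}}) 0<ε
        M₂ , h             = cs δ 0<δ
        N₂ , k             = ct δ 0<δ
        M                  = M₁ ℕ.⊔ M₂
        N                  = N₁ ℕ.⊔ N₂
    in M ℕ.⊔ N , λ m n p q →
      let pM = ℕ.m⊔n≤o⇒m≤o M N p
          pN = ℕ.m⊔n≤o⇒n≤o M N p
          qM = ℕ.m⊔n≤o⇒m≤o M N q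
          qN = ℕ.m⊔n≤o⇒n≤o M N q
      in subst (∣ s m ℚ.* t m ℚ.- s n ℚ.* t n ∣ ℚ.<_) Cδ≡ε
           (*-close (s m) (t m) (s n) (t n) A B δ A>0 B>0
             (s≤A m (ℕ.m⊔n≤o⇒m≤o M₁ M₂ pM)) (t≤B n (ℕ.m⊔n≤o⇒m≤o N₁ N₂ qN))
             (h m n (ℕ.m⊔n≤o⇒n≤o M₁ M₂ pM) (ℕ.m⊔n≤o⇒n≤o M₁ M₂ qM))
             (k m n (ℕ.m⊔n≤o⇒n≤o N₁ N₂ pN) (ℕ.m⊔n≤o⇒n≤o N₁ N₂ qN)))

infixl 6 _+ᴿ_ _-ᴿ_
infixl 7 _*ᴿ_
infix  8 -ᴿ_

fromℚ : ℚ → ℝ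
fromℚ q = mkℝ (λ _ → q) (const-cauchy q)

_+ᴿ_ : ℝ → ℝ → ℝ
mkℝ s cs +ᴿ mkℝ t ct = mkℝ (λ n → s n ℚ.+ t n) (+-cauchy {s} {t} cs ct)

-ᴿ_ : ℝ → ℝ
-ᴿ mkℝ s cs = mkℝ (λ n → ℚ.- s n) (neg-cauchy {s} cs)

_-ᴿ_ : ℝ → ℝ → ℝ
a -ᴿ b = a +ᴿ (-ᴿ b)

_*ᴿ_ : ℝ → ℝ → ℝ
mkℝ s cs *ᴿ mkℝ t ct = mkℝ (λ n → s n ℚ.* t n) (*-cauchy {s} {t} cs ct)

infix 5 _+i_

record ℂ : Set where
  constructor _+i_
  field
    re : ℝ
    im : ℝ

open ℂ public

infix  4 _≃_
infixl 6 _+ᶜ_ _-ᶜ_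
infixl 7 _*ᶜ_
infix  8 -ᶜ_
infixr 9 _^ᶜ_

_≃_ : ℂ → ℂ → Set
z ≃ w = re z ≃ᴿ re w × im z ≃ᴿ im w

fromℤ : ℤ → ℂ
fromℤ k = fromℚ (k ℚ./ 1) +i fromℚ 0ℚ

0ᶜ 1ᶜ 2ᶜ : ℂ
0ᶜ = fromℤ 0ℤ
1ᶜ = fromℤ 1ℤ
2ᶜ = fromℤ (ℤ.+ 2)

_+ᶜ_ : ℂ → ℂ → ℂ
(a +i b) +ᶜ (c +i d) = (a +ᴿ c) +i (b +ᴿ d)

-ᶜ_ : ℂ → ℂ
-ᶜ (a +i b) = (-ᴿ a) +i (-ᴿ b)

_-ᶜ_ : ℂ → ℂ → ℂ
z -ᶜ w = z +ᶜ (-ᶜ w)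

_*ᶜ_ : ℂ → ℂ → ℂ
(a +i b) *ᶜ (c +i d) = (a *ᴿ c -ᴿ b *ᴿ d) +i (a *ᴿ d +ᴿ b *ᴿ c)

_^ᶜ_ : ℂ → ℕ → ℂ
z ^ᶜ zero  = 1ᶜ
z ^ᶜ suc n = z *ᶜ z ^ᶜ n

∣_∣² : ℂ → ℝ
∣ a +i b ∣² = a *ᴿ a +ᴿ b *ᴿ b

-- |z| < r, squared to avoid the square root; meaningful only for r ≥ 0.
∣_∣<_ : ℂ → ℚ → Set
∣ z ∣< r = ∣ z ∣² <ᴿ fromℚ (r ℚ.* r)

infix 4 ∣_∣<_ _⟶_

_⟶_ : (ℕ → ℂ) → ℂ → Set
z ⟶ l = ∀ ε → 0ℚ ℚ.< ε → ∃[ N ] (∀ n → N ℕ.≤ n → ∣ z n -ᶜ l ∣< ε)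

PowerSeries : Set
PowerSeries = ℕ → ℤ

sumℤ : (ℕ → ℤ) → ℕ → ℤ
sumℤ f zero    = 0ℤ
sumℤ f (suc n) = sumℤ f n ℤ.+ f n

infixl 7 _·_

_·_ : PowerSeries → PowerSeries → PowerSeries
(f · g) j = sumℤ (λ i → f i ℤ.* g (j ∸ i)) (suc j)

one : PowerSeries
one zero    = 1ℤ
one (suc _) = 0ℤ

-- Equals 1 - x^m only for m ≥ 1.
1-X^_ : ℕ → PowerSeries
(1-X^ m) zero    = 1ℤ
(1-X^ m) (suc j) = if suc j ≡ᵇ m then -1ℤ else 0ℤ

finiteProduct : ℕ → PowerSeries
finiteProduct zero    = one
finiteProduct (suc N) = finiteProduct N · ((1-X^ suc N) · (1-X^ (2 ℕ.* suc N)))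

-- The coefficients of E(x)E(x²): the factors with n > j are 1 + O(x^{j+1}), so
-- they do not affect the coefficient of x^j in the infinite product.
c : PowerSeries
c j = finiteProduct j j

component : ℕ → PowerSeries → PowerSeries
component k f j = if j % 3 ≡ᵇ k then f j else 0ℤ

partialSum : PowerSeries → ℂ → ℕ → ℂ
partialSum f x zero    = 0ᶜ
partialSum f x (suc N) = partialSum f x N +ᶜ fromℤ (f N) *ᶜ x ^ᶜ N

HasSum : PowerSeries → ℂ → ℂ → Set
HasSum f x s = partialSum f x ⟶ s

-- I k x s states that I_k(x) = s.
I : ℕ → ℂ → ℂ → Set
I k = HasSum (component k c)

partialE : ℂ → ℕ → ℂ
partialE x zero    = 1ᶜ
partialE x (suc N) = partialE x N *ᶜ (1ᶜ -ᶜ x ^ᶜ suc N)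

-- E x p states that ∏_{n≥1} (1 - x^n) converges to p.
E : ℂ → ℂ → Set
E x p = partialE x ⟶ p

{-# OPTIONS --safe #-}
module Submission where

-- With φ(-q) = Σ (-1)ⁿ q^{n²} and ψ(q) = Σ_{n≥0} q^{n(n+1)/2}, the Jacobi triple product gives
-- E(x)E(x²) = φ(-x)ψ(x).  Splitting the summation index mod 3,
--   φ(-x) = φ(-x⁹) - 2xΩ(-x³)  and  ψ(x) = A(x³) + xψ(x⁹),
-- and the triple product also gives Ω(-x³)A(x³) = φ(-x⁹)ψ(x⁹) = E(x⁹)E(x¹⁸) =: G.  Hence
--   I₀ = φ(-x⁹)A(x³),  I₁ = xG - 2xG = -xG,  I₂ = -2x²Ω(-x³)ψ(x⁹),  I₂I₀ = -2x²G² = -2I₁².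
-- These identities are proved in ℤ[x]/(x^N) for every N, where the infinite products are finite
-- and the triple product is the limit of its finite form with q-binomial coefficients.
--
-- For |x| < 1 the coefficients of all partial products of E(x)E(x²) are O(s^{-j}) uniformly, with
-- |x| < s < 1, so truncation errors decay geometrically.  They do so uniformly over the rational
-- approximations of x, hence limits are represented by diagonal sequences, and the two identities
-- reduce to estimates at Gaussian rational points.

open import Defs
open import Algebra.Bundles using (CommutativeMonoid; CommutativeRing; CommutativeSemiring)
open import Data.Bool as Bool using (true; false; if_then_else_)
open import Data.Empty using (⊥-elim)
open import Data.Integer as ℤ using (ℤ; 0ℤ; 1ℤ; -1ℤ)
import Data.Integer.Properties as ℤ
import Data.Integer.Solver as ℤ-Solver
open import Data.Nat as ℕ using (ℕ; zero; suc; s≤s; z≤n; _∸_; _%_; _≡ᵇ_)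
import Data.Nat.DivMod as ℕ
import Data.Nat.Properties as ℕ
import Data.Nat.Solver as ℕ-Solver
open import Data.Product using (_×_; _,_; ∃-syntax; proj₁; proj₂)
open import Data.Rational as ℚ using (ℚ; 0ℚ; 1ℚ; ½; ∣_∣; nonNegative; positive; toℚᵘ)
import Data.Rational.Properties as ℚ
open import Data.Rational.Solver using (module +-*-Solver)
import Data.Rational.Unnormalised as ℚᵘ
import Data.Rational.Unnormalised.Properties as ℚᵘ
open import Data.Sum using (inj₁; inj₂)
open import Data.Unit using (tt)
open import Level using (Level; 0ℓ)
open import Relation.Binary.PropositionalEquality as ≡ using (_≡_; _≢_; module ≡-Reasoning)
open import Relation.Nullary using (Dec; yes; no)

-- Square roots and division are the two obstacles. The modulus of x is available only squared and
-- only along rational approximations, so square roots are replaced by arithmetic means with 1,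
-- taken three times: once to pass from |x|² to |x|, once to write the bound as s², where one power
-- s^j pays for the growth of the coefficients and the other gives decay, and once to absorb a
-- factor n that truncating a product of two series costs. The algebra is stated over a commutative
-- semiring with an element m such that 1 + m ≈ 0. A sign is then a parameter s with s s ≈ 1, and
-- one theta series covers φ and Ω (s = m) as well as ψ and A (s = 1).

-- Finite sums and products

module BigOperator {c ℓ : Level} (M : CommutativeMonoid c ℓ) where
  open CommutativeMonoid M
  open import Relation.Binary.Reasoning.Setoid setoid

  big : ℕ → (ℕ → Carrier) → Carrier
  big zero    f = ε
  big (suc n) f = big n f ∙ f n

  interchange : ∀ a b c d → (a ∙ b) ∙ (c ∙ d) ≈ (a ∙ c) ∙ (b ∙ d)
  interchange a b c d = begin
    (a ∙ b) ∙ (c ∙ d)  ≈⟨ assoc a b (c ∙ d) ⟩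
    a ∙ (b ∙ (c ∙ d))  ≈⟨ ∙-congˡ (assoc b c d) ⟨
    a ∙ ((b ∙ c) ∙ d)  ≈⟨ ∙-congˡ (∙-congʳ (comm b c)) ⟩
    a ∙ ((c ∙ b) ∙ d)  ≈⟨ ∙-congˡ (assoc c b d) ⟩
    a ∙ (c ∙ (b ∙ d))  ≈⟨ assoc a c (b ∙ d) ⟨
    (a ∙ c) ∙ (b ∙ d)  ∎

  big-cong< : ∀ n {f g} → (∀ k → k ℕ.< n → f k ≈ g k) → big n f ≈ big n g
  big-cong< zero    f≈g = refl
  big-cong< (suc n) f≈g =
    ∙-cong (big-cong< n λ k k<n → f≈g k (ℕ.m<n⇒m<1+n k<n)) (f≈g n ℕ.≤-refl)

  big-cong : ∀ n {f g} → (∀ k → f k ≈ g k) → big n f ≈ big n g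
  big-cong n f≈g = big-cong< n λ k _ → f≈g k

  big-ε : ∀ n {f} → (∀ k → f k ≈ ε) → big n f ≈ ε
  big-ε zero    f≈ε = refl
  big-ε (suc n) f≈ε = trans (∙-cong (big-ε n f≈ε) (f≈ε n)) (identityˡ ε)

  big-∙ : ∀ n f g → big n (λ k → f k ∙ g k) ≈ big n f ∙ big n g
  big-∙ zero    f g = sym (identityˡ ε)
  big-∙ (suc n) f g = begin
    big n (λ k → f k ∙ g k) ∙ (f n ∙ g n)  ≈⟨ ∙-congʳ (big-∙ n f g) ⟩
    (big n f ∙ big n g) ∙ (f n ∙ g n)      ≈⟨ interchange (big n f) (big n g) (f n) (g n) ⟩
    (big n f ∙ f n) ∙ (big n g ∙ g n)      ∎

  big-swap : ∀ m n (f : ℕ → ℕ → Carrier) → big m (λ i → big n (f i)) ≈ big n (λ j → big m (λ i → f i j))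
  big-swap zero    n f = sym (big-ε n λ _ → refl)
  big-swap (suc m) n f = trans (∙-congʳ (big-swap m n f)) (sym (big-∙ n (λ j → big m (λ i → f i j)) (f m)))

  big-front : ∀ n f → big (suc n) f ≈ f 0 ∙ big n (λ k → f (suc k))
  big-front zero    f = comm ε (f 0)
  big-front (suc n) f = begin
    big (suc n) f ∙ f (suc n)                          ≈⟨ ∙-congʳ (big-front n f) ⟩
    (f 0 ∙ big n (λ k → f (suc k))) ∙ f (suc n)        ≈⟨ assoc _ _ _ ⟩
    f 0 ∙ (big n (λ k → f (suc k)) ∙ f (suc n))        ∎

  big-++ : ∀ m n f → big (m ℕ.+ n) f ≈ big m f ∙ big n (λ k → f (m ℕ.+ k))
  big-++ zero    n f = sym (identityˡ _)
  big-++ (suc m) n f = begin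
    big (suc (m ℕ.+ n)) f
      ≈⟨ big-front (m ℕ.+ n) f ⟩
    f 0 ∙ big (m ℕ.+ n) (λ k → f (suc k))
      ≈⟨ ∙-congˡ (big-++ m n (λ k → f (suc k))) ⟩
    f 0 ∙ (big m (λ k → f (suc k)) ∙ big n (λ k → f (suc m ℕ.+ k)))
      ≈⟨ assoc _ _ _ ⟨
    (f 0 ∙ big m (λ k → f (suc k))) ∙ big n (λ k → f (suc m ℕ.+ k))
      ≈⟨ ∙-congʳ (big-front m f) ⟨
    big (suc m) f ∙ big n (λ k → f (suc m ℕ.+ k))
      ∎

  big-stable : ∀ {n m} f → n ℕ.≤ m → (∀ k → n ℕ.≤ k → f k ≈ ε) → big m f ≈ big n f
  big-stable {n} {m} f n≤m f≈ε = begin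
    big m f                                        ≡⟨ ≡.cong (λ l → big l f) (ℕ.m+[n∸m]≡n n≤m) ⟨
    big (n ℕ.+ (m ℕ.∸ n)) f                        ≈⟨ big-++ n (m ℕ.∸ n) f ⟩
    big n f ∙ big (m ℕ.∸ n) (λ k → f (n ℕ.+ k))    ≈⟨ ∙-congˡ (big-ε (m ℕ.∸ n) λ k → f≈ε (n ℕ.+ k) (ℕ.m≤m+n n k)) ⟩
    big n f ∙ ε                                    ≈⟨ identityʳ _ ⟩
    big n f                                        ∎

  -- Cutting a range into blocks of length d is the device behind the dissections mod 3 of the theta
  -- series and behind the splitting of a product by residue classes.
  big-blocks : ∀ d n f → big (n ℕ.* d) f ≈ big n (λ k → big d (λ i → f (k ℕ.* d ℕ.+ i)))
  big-blocks d zero    f = refl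
  big-blocks d (suc n) f = begin
    big (d ℕ.+ n ℕ.* d) f
      ≡⟨ ≡.cong (λ l → big l f) (ℕ.+-comm d (n ℕ.* d)) ⟩
    big (n ℕ.* d ℕ.+ d) f
      ≈⟨ big-++ (n ℕ.* d) d f ⟩
    big (n ℕ.* d) f ∙ big d (λ i → f (n ℕ.* d ℕ.+ i))
      ≈⟨ ∙-congʳ (big-blocks d n f) ⟩
    big n (λ k → big d (λ i → f (k ℕ.* d ℕ.+ i))) ∙ big d (λ i → f (n ℕ.* d ℕ.+ i))
      ∎

module FiniteSums {c ℓ : Level} (S : CommutativeSemiring c ℓ) where
  open CommutativeSemiring S
  open import Relation.Binary.Reasoning.Setoid setoid
  private
    module Add = BigOperator +-commutativeMonoid
    module Mul = BigOperator *-commutativeMonoid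
  open Add public
    renaming ( big to ∑; big-cong< to ∑-cong<; big-cong to ∑-cong; big-ε to ∑-zero; big-∙ to ∑-+
             ; big-swap to ∑-swap; big-front to ∑-front; big-++ to ∑-++; big-stable to ∑-stable; big-blocks to ∑-blocks
             ; interchange to +-interchange )
  open Mul public
    renaming ( big to ∏; big-cong< to ∏-cong<; big-cong to ∏-cong; big-ε to ∏-one; big-∙ to ∏-*
             ; big-swap to ∏-swap; big-front to ∏-front; big-++ to ∏-++; big-stable to ∏-stable; big-blocks to ∏-blocks
             ; interchange to *-interchange )

  *-∑ : ∀ a n f → a * ∑ n f ≈ ∑ n (λ k → a * f k)
  *-∑ a zero    f = zeroʳ a
  *-∑ a (suc n) f = trans (distribˡ a (∑ n f) (f n)) (+-congʳ (*-∑ a n f))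

  -- Both sides sum u i * v k over i + k < M.
  ∑-triangle : ∀ M (u v : ℕ → Carrier) →
    ∑ M (λ j → ∑ (suc j) (λ i → u i * v (j ℕ.∸ i))) ≈ ∑ M (λ i → u i * ∑ (M ℕ.∸ i) v)
  ∑-triangle zero    u v = refl
  ∑-triangle (suc M) u v = begin
    ∑ M (λ j → ∑ (suc j) (λ i → u i * v (j ℕ.∸ i))) + (∑ M (λ i → u i * v (M ℕ.∸ i)) + u M * v (M ℕ.∸ M))
      ≈⟨ +-congʳ (∑-triangle M u v) ⟩
    ∑ M (λ i → u i * ∑ (M ℕ.∸ i) v) + (∑ M (λ i → u i * v (M ℕ.∸ i)) + u M * v (M ℕ.∸ M))
      ≈⟨ +-assoc _ _ _ ⟨
    ∑ M (λ i → u i * ∑ (M ℕ.∸ i) v) + ∑ M (λ i → u i * v (M ℕ.∸ i)) + u M * v (M ℕ.∸ M)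
      -- The new antidiagonal lengthens each row i < M by the term `v (M ∸ i)` and opens row M,
      -- whose only term is `v 0`.
      ≈⟨ +-cong (∑-+ M _ _) (*-congˡ (trans (+-identityˡ _) (reflexive (≡.cong v (≡.sym (ℕ.n∸n≡0 M)))))) ⟨
    ∑ M (λ i → u i * ∑ (M ℕ.∸ i) v + u i * v (M ℕ.∸ i)) + u M * ∑ 1 v
      ≈⟨ +-cong (∑-cong< M λ i i<M → trans (sym (distribˡ _ _ _))
                   (*-congˡ (reflexive (≡.cong (λ l → ∑ l v) (≡.sym (ℕ.+-∸-assoc 1 (ℕ.<⇒≤ i<M)))))))
                (*-congˡ (reflexive (≡.cong (λ l → ∑ l v) (≡.trans (≡.cong suc (≡.sym (ℕ.n∸n≡0 M))) (≡.sym (ℕ.+-∸-assoc 1 (ℕ.≤-refl {M}))))))) ⟩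
    ∑ M (λ i → u i * ∑ (suc M ℕ.∸ i) v) + u M * ∑ (suc M ℕ.∸ M) v
      ∎

-- q-binomial coefficients and the triple product

module JacobiTripleProduct {c ℓ : Level} (S : CommutativeSemiring c ℓ) where
  open CommutativeSemiring S
  open FiniteSums S
  open import Algebra.Properties.CommutativeSemiring.Exp S
  open import Relation.Binary.Reasoning.Setoid setoid
  open import Algebra.Solver.Ring.NaturalCoefficients.Default S

  module _ (q : Carrier) where

    -- gaussian L i is the q-binomial coefficient [L choose i].
    gaussian : ℕ → ℕ → Carrier
    gaussian _       zero    = 1#
    gaussian zero    (suc i) = 0#
    gaussian (suc L) (suc i) = q ^ suc i * gaussian L (suc i) + gaussian L i

    gaussian-zero : ∀ {L i} → L ℕ.< i → gaussian L i ≈ 0#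
    gaussian-zero {zero}  {suc i} _         = refl
    gaussian-zero {suc L} {suc i} (s≤s L<i) = begin
      q ^ suc i * gaussian L (suc i) + gaussian L i
        ≈⟨ +-cong (*-congˡ (gaussian-zero (ℕ.m<n⇒m<1+n L<i))) (gaussian-zero L<i) ⟩
      q ^ suc i * 0# + 0#
        ≈⟨ trans (+-identityʳ _) (zeroʳ _) ⟩
      0# ∎

    -- geometric z n = zⁿ q^{n(n-1)/2}
    geometric : Carrier → ℕ → Carrier
    geometric z n = ∏ n (λ k → z * q ^ k)

    -- The q-Pochhammer symbol (-z; q)_n.
    rising : Carrier → ℕ → Carrier
    rising z n = ∏ n (λ k → 1# + z * q ^ k)

    geometric-shift : ∀ z n → geometric (z * q) n ≈ q ^ n * geometric z n
    geometric-shift z zero    = sym (*-identityˡ 1#)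
    geometric-shift z (suc n) = begin
      geometric (z * q) n * (z * q * q ^ n)
        ≈⟨ *-congʳ (geometric-shift z n) ⟩
      q ^ n * geometric z n * (z * q * q ^ n)
        ≈⟨ solve 4 (λ a g z q → a :* g :* (z :* q :* a) := q :* a :* (g :* (z :* a))) refl
             (q ^ n) (geometric z n) z q ⟩
      q * q ^ n * (geometric z n * (z * q ^ n))
        ∎

    -- This is the q-Pascal rule summed against an arbitrary weight; the freedom in `w` lets it
    -- serve both the q-binomial theorem and the induction step of the finite triple product.
    ∑-gaussian-Pascal : ∀ L (w : ℕ → Carrier) →
      ∑ (suc (suc L)) (λ i → gaussian (suc L) i * w i) ≈
      ∑ (suc L) (λ i → q ^ i * gaussian L i * w i) + ∑ (suc L) (λ i → gaussian L i * w (suc i))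
    ∑-gaussian-Pascal L w = begin
      ∑ (suc (suc L)) (λ i → gaussian (suc L) i * w i)
        ≈⟨ ∑-front (suc L) _ ⟩
      1# * w 0 + ∑ (suc L) (λ i → gaussian (suc L) (suc i) * w (suc i))
        ≈⟨ +-cong (*-congʳ (sym (*-identityˡ 1#))) (∑-cong (suc L) λ i → distribʳ _ _ _) ⟩
      1# * 1# * w 0 + ∑ (suc L) (λ i → q ^ suc i * gaussian L (suc i) * w (suc i) + gaussian L i * w (suc i))
        ≈⟨ +-congˡ (∑-+ (suc L) _ _) ⟩
      1# * 1# * w 0 + (∑ (suc L) (λ i → q ^ suc i * gaussian L (suc i) * w (suc i)) + ∑ (suc L) (λ i → gaussian L i * w (suc i)))
        ≈⟨ +-assoc _ _ _ ⟨
      1# * 1# * w 0 + ∑ (suc L) (λ i → q ^ suc i * gaussian L (suc i) * w (suc i)) + ∑ (suc L) (λ i → gaussian L i * w (suc i))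
        ≈⟨ +-congʳ (∑-front (suc L) (λ i → q ^ i * gaussian L i * w i)) ⟨
      ∑ (suc L) (λ i → q ^ i * gaussian L i * w i) + q ^ suc L * gaussian L (suc L) * w (suc L) + ∑ (suc L) (λ i → gaussian L i * w (suc i))
        ≈⟨ +-congʳ (+-congˡ (*-congʳ (*-congˡ (gaussian-zero (ℕ.n<1+n L))))) ⟩
      ∑ (suc L) (λ i → q ^ i * gaussian L i * w i) + q ^ suc L * 0# * w (suc L) + ∑ (suc L) (λ i → gaussian L i * w (suc i))
        ≈⟨ +-congʳ (trans (+-congˡ (trans (*-congʳ (zeroʳ _)) (zeroˡ _))) (+-identityʳ _)) ⟩
      ∑ (suc L) (λ i → q ^ i * gaussian L i * w i) + ∑ (suc L) (λ i → gaussian L i * w (suc i))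
        ∎

    -- Splitting off the factor k = 0 leaves the same product with z q in place of z, so the
    -- induction hypothesis is needed for every z. The two resulting sums recombine by the q-Pascal
    -- rule.
    q-binomial-theorem : ∀ n z → rising z n ≈ ∑ (suc n) (λ i → gaussian n i * geometric z i)
    q-binomial-theorem zero z = solve 0 (con 1 := con 0 :+ con 1 :* con 1) refl
    q-binomial-theorem (suc n) z = begin
      rising z (suc n)
        ≈⟨ ∏-front n _ ⟩
      (1# + z * 1#) * ∏ n (λ k → 1# + z * q ^ suc k)
        ≈⟨ *-congˡ (∏-cong n λ k → +-congˡ (sym (*-assoc z q (q ^ k)))) ⟩
      (1# + z * 1#) * rising (z * q) n
        ≈⟨ *-congˡ (q-binomial-theorem n (z * q)) ⟩
      (1# + z * 1#) * T
        ≈⟨ solve 2 (λ z t → (con 1 :+ z :* con 1) :* t := t :+ z :* t) refl z T ⟩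
      T + z * T
        ≈⟨ +-congˡ (*-∑ z (suc n) _) ⟩
      T + ∑ (suc n) (λ i → z * (gaussian n i * geometric (z * q) i))
        ≈⟨ +-cong (∑-cong (suc n) λ i → trans (*-congˡ (geometric-shift z i))
                     (solve 3 (λ a b c → a :* (b :* c) := b :* a :* c) refl (gaussian n i) (q ^ i) (geometric z i)))
                  (∑-cong (suc n) λ i → trans (*-congˡ (*-congˡ (geometric-shift z i)))
                     (solve 4 (λ z a b c → z :* (a :* (b :* c)) := a :* (c :* (z :* b))) refl z (gaussian n i) (q ^ i) (geometric z i))) ⟩
      ∑ (suc n) (λ i → q ^ i * gaussian n i * geometric z i) + ∑ (suc n) (λ i → gaussian n i * geometric z (suc i))
        ≈⟨ ∑-gaussian-Pascal n (geometric z) ⟨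
      ∑ (suc (suc n)) (λ i → gaussian (suc n) i * geometric z i)
        ∎
      where
      T : Carrier
      T = ∑ (suc n) (λ i → gaussian n i * geometric (z * q) i)

  module _ (a b : Carrier) where

    private
      q : Carrier
      q = a * b

    -- weight i m is the term of index i - m of the bilateral theta series,
    -- a^{n(n+1)/2} b^{n(n-1)/2} for n = i - m.
    weight : ℕ → ℕ → Carrier
    weight i       zero    = geometric q a i
    weight zero    (suc m) = geometric q b (suc m)
    weight (suc i) (suc m) = weight i m

    -- Consecutive terms of the theta series, of index n and n + 1 with n = i - m, have ratio a q^n.
    -- Multiplication by b q^m turns this ratio into q^(i+1), a form free of negative exponents.
    weight-step : ∀ i m → b * q ^ m * weight (suc i) m ≈ q ^ suc i * weight i m
    weight-step i zero =
      solve 4 (λ a b p g → b :* con 1 :* (g :* (a :* p)) := a :* b :* p :* g) refl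
        a b (q ^ i) (geometric q a i)
    weight-step zero (suc zero) =
      solve 2 (λ a b → b :* (a :* b :* con 1) :* con 1 := a :* b :* con 1 :* (con 1 :* (b :* con 1))) refl a b
    weight-step zero (suc (suc m)) =
      solve 4 (λ a b g p → b :* (a :* b :* p) :* g := a :* b :* con 1 :* (g :* (b :* p))) refl
        a b (geometric q b (suc m)) (q ^ suc m)
    weight-step (suc i) (suc m) = begin
      b * (q * q ^ m) * weight (suc i) m
        ≈⟨ solve 4 (λ b q p w → b :* (q :* p) :* w := q :* (b :* p :* w)) refl b q (q ^ m) (weight (suc i) m) ⟩
      q * (b * q ^ m * weight (suc i) m)
        ≈⟨ *-congˡ (weight-step i m) ⟩
      q * (q ^ suc i * weight i m)
        ≈⟨ *-assoc _ _ _ ⟨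
      q * q ^ suc i * weight i m
        ∎

    weight-zero : ∀ m → weight 0 m ≈ geometric q b m
    weight-zero zero    = refl
    weight-zero (suc m) = refl

    -- Induction on M from the q-binomial theorem. In the new factor 1 + b q^M, the summand 1
    -- amounts to the shift of i by one that accompanies the move of the centre to M + 1, and b q^M
    -- becomes q^i by `weight-step`; these are the two sides of the q-Pascal rule.
    finite-triple-product : ∀ N M →
      rising q a N * rising q b M ≈ ∑ (suc (M ℕ.+ N)) (λ i → gaussian q (M ℕ.+ N) i * weight i M)
    finite-triple-product N zero = trans (*-identityʳ _) (q-binomial-theorem q N a)
    finite-triple-product N (suc M) = begin
      rising q a N * (rising q b M * (1# + b * q ^ M))
        ≈⟨ solve 3 (λ x y u → x :* (y :* (con 1 :+ u)) := u :* (x :* y) :+ x :* y) refl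
             (rising q a N) (rising q b M) (b * q ^ M) ⟩
      b * q ^ M * (rising q a N * rising q b M) + rising q a N * rising q b M
        ≈⟨ +-cong (*-congˡ (finite-triple-product N M)) (finite-triple-product N M) ⟩
      b * q ^ M * ∑ (suc L) (λ i → gaussian q L i * weight i M) + ∑ (suc L) (λ i → gaussian q L i * weight i M)
        ≈⟨ +-congʳ (*-∑ (b * q ^ M) (suc L) _) ⟩
      ∑ (suc L) (λ i → b * q ^ M * (gaussian q L i * weight i M)) + ∑ (suc L) (λ i → gaussian q L i * weight i M)
        ≈⟨ +-congʳ (∑-cong (suc L) step) ⟩
      ∑ (suc L) (λ i → q ^ i * gaussian q L i * weight i (suc M)) + ∑ (suc L) (λ i → gaussian q L i * weight (suc i) (suc M))
        ≈⟨ ∑-gaussian-Pascal q L (λ i → weight i (suc M)) ⟨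
      ∑ (suc (suc L)) (λ i → gaussian q (suc L) i * weight i (suc M))
        ∎
      where
      L : ℕ
      L = M ℕ.+ N
      step : ∀ i → b * q ^ M * (gaussian q L i * weight i M) ≈ q ^ i * gaussian q L i * weight i (suc M)
      step zero = trans (*-congˡ (*-congˡ (weight-zero M)))
        (solve 3 (λ b p g → b :* p :* (con 1 :* g) := con 1 :* con 1 :* (g :* (b :* p))) refl
          b (q ^ M) (geometric q b M))
      step (suc i) = begin
        b * q ^ M * (gaussian q L (suc i) * weight (suc i) M)
          ≈⟨ solve 3 (λ u g w → u :* (g :* w) := g :* (u :* w)) refl (b * q ^ M) (gaussian q L (suc i)) (weight (suc i) M) ⟩
        gaussian q L (suc i) * (b * q ^ M * weight (suc i) M)
          ≈⟨ *-congˡ (weight-step i M) ⟩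
        gaussian q L (suc i) * (q ^ suc i * weight i M)
          ≈⟨ solve 3 (λ g p w → g :* (p :* w) := p :* g :* w) refl (gaussian q L (suc i)) (q ^ suc i) (weight i M) ⟩
        q ^ suc i * gaussian q L (suc i) * weight i M
          ∎

    -- The indices run from -K to K - 1, so n and -(n + 1) pair up exactly. All theta series below
    -- are written in such pairs.
    ∑-weight : ∀ K → ∑ (K ℕ.+ K) (λ i → weight i K) ≈ ∑ K (λ n → geometric q a n + geometric q b (suc n))
    ∑-weight K = begin
      ∑ (K ℕ.+ K) (λ i → weight i K)
        ≈⟨ ∑-++ K K _ ⟩
      ∑ K (λ i → weight i K) + ∑ K (λ i → weight (K ℕ.+ i) K)
        ≈⟨ +-cong (left K) (∑-cong K (right K)) ⟩
      ∑ K (λ n → geometric q b (suc n)) + ∑ K (geometric q a)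
        ≈⟨ +-comm _ _ ⟩
      ∑ K (geometric q a) + ∑ K (λ n → geometric q b (suc n))
        ≈⟨ ∑-+ K _ _ ⟨
      ∑ K (λ n → geometric q a n + geometric q b (suc n))
        ∎
      where
      right : ∀ K i → weight (K ℕ.+ i) K ≈ geometric q a i
      right zero    i = refl
      right (suc K) i = right K i
      left : ∀ K → ∑ K (λ i → weight i K) ≈ ∑ K (λ n → geometric q b (suc n))
      left zero    = refl
      left (suc K) = begin
        ∑ (suc K) (λ i → weight i (suc K))                          ≈⟨ ∑-front K _ ⟩
        geometric q b (suc K) + ∑ K (λ i → weight i K)              ≈⟨ +-congˡ (left K) ⟩
        geometric q b (suc K) + ∑ K (λ n → geometric q b (suc n))   ≈⟨ +-comm _ _ ⟩
        ∑ (suc K) (λ n → geometric q b (suc n))                     ∎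

  -- m plays the role of -1.
  module _ (m : Carrier) (1+m≈0 : 1# + m ≈ 0#) where

    -- There is no subtraction in a semiring, so cancellations of opposite terms are brought to this
    -- shape.
    cancel-m : ∀ u v → u + (v + m * v) ≈ u
    cancel-m u v = begin
      u + (v + m * v)    ≈⟨ solve 3 (λ u v m → u :+ (v :+ m :* v) := u :+ (con 1 :+ m) :* v) refl u v m ⟩
      u + (1# + m) * v   ≈⟨ +-congˡ (*-congʳ 1+m≈0) ⟩
      u + 0# * v         ≈⟨ trans (+-congˡ (zeroˡ v)) (+-identityʳ u) ⟩
      u                  ∎

    module _ (q : Carrier) where

      -- The q-Pochhammer symbol (q^(j+1); q)_n.
      falling : ℕ → ℕ → Carrier
      falling j n = ∏ n (λ k → 1# + m * q ^ suc (j ℕ.+ k))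

      falling-front : ∀ j n → falling j (suc n) ≈ (1# + m * q ^ suc j) * falling (suc j) n
      falling-front j n = trans (∏-front n _)
        (*-cong (+-congˡ (*-congˡ (^-congʳ q (≡.cong suc (ℕ.+-identityʳ j)))))
                (∏-cong n λ k → +-congˡ (*-congˡ (^-congʳ q (≡.cong suc (ℕ.+-suc j k))))))

      gaussian-diagonal : ∀ i → gaussian q i i ≈ 1#
      gaussian-diagonal zero    = refl
      gaussian-diagonal (suc i) = begin
        q ^ suc i * gaussian q i (suc i) + gaussian q i i
          ≈⟨ +-cong (*-congˡ (gaussian-zero q (ℕ.n<1+n i))) (gaussian-diagonal i) ⟩
        q ^ suc i * 0# + 1#
          ≈⟨ trans (+-congʳ (zeroʳ _)) (+-identityˡ _) ⟩
        1# ∎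

      -- The product formula for q-binomial coefficients, with the denominator (q;q)_i kept on the
      -- left to avoid division. The q-Pascal rule reduces it to u(1 - v) + (1 - u) = 1 - uv for u =
      -- q^(i+1) and v = q^(j+1).
      gaussian-product : ∀ i j → falling 0 i * gaussian q (j ℕ.+ i) i ≈ falling j i
      gaussian-product i       zero    = trans (*-congˡ (gaussian-diagonal i)) (*-identityʳ _)
      gaussian-product zero    (suc j) = *-identityˡ 1#
      gaussian-product (suc i) (suc j) = begin
        falling 0 i * (1# + m * u) * (u * G₁ + gaussian q (j ℕ.+ suc i) i)
          ≡⟨ ≡.cong (λ l → falling 0 i * (1# + m * u) * (u * G₁ + gaussian q l i)) (ℕ.+-suc j i) ⟩
        falling 0 i * (1# + m * u) * (u * G₁ + G₂)
          ≈⟨ solve 5 (λ f m u g h → f :* (con 1 :+ m :* u) :* (u :* g :+ h) :=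
                                    u :* (f :* (con 1 :+ m :* u) :* g) :+ (con 1 :+ m :* u) :* (f :* h)) refl
               (falling 0 i) m u G₁ G₂ ⟩
        u * (falling 0 (suc i) * G₁) + (1# + m * u) * (falling 0 i * G₂)
          ≈⟨ +-cong (*-congˡ (trans (gaussian-product (suc i) j) (falling-front j i)))
                    (*-congˡ (gaussian-product i (suc j))) ⟩
        u * ((1# + m * v) * r) + (1# + m * u) * r
          ≈⟨ solve 4 (λ u v m r → u :* ((con 1 :+ m :* v) :* r) :+ (con 1 :+ m :* u) :* r :=
                                  r :* (con 1 :+ m :* (u :* v)) :+ (u :* r :+ m :* (u :* r))) refl u v m r ⟩
        r * (1# + m * (u * v)) + (u * r + m * (u * r))
          ≈⟨ cancel-m _ _ ⟩
        r * (1# + m * (u * v))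
          ≈⟨ *-congˡ (+-congˡ (*-congˡ (trans (sym (^-homo-* q (suc i) (suc j)))
               (^-congʳ q (≡.cong suc (ℕ.+-comm i (suc j))))))) ⟩
        falling (suc j) (suc i)
          ∎
        where
        u v r G₁ G₂ : Carrier
        u = q ^ suc i
        v = q ^ suc j
        r = falling (suc j) i
        G₁ = gaussian q (j ℕ.+ suc i) (suc i)
        G₂ = gaussian q (suc j ℕ.+ i) i

      -- Each factor is 1 minus a multiple of q^(j+1), hence acts as 1 on anything that q^(j+1)
      -- annihilates.
      falling-absorb : ∀ j n w → q ^ suc j * w ≈ 0# → falling j n * w ≈ w
      falling-absorb j zero    w q^w≈0 = *-identityˡ w
      falling-absorb j (suc n) w q^w≈0 = begin
        falling j n * (1# + m * q ^ suc (j ℕ.+ n)) * w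
          ≈⟨ *-congʳ (*-congˡ (+-congˡ (*-congˡ (^-homo-* q (suc j) n)))) ⟩
        falling j n * (1# + m * (q ^ suc j * q ^ n)) * w
          ≈⟨ solve 5 (λ f m a b w → f :* (con 1 :+ m :* (a :* b)) :* w := f :* w :+ f :* m :* b :* (a :* w)) refl
               (falling j n) m (q ^ suc j) (q ^ n) w ⟩
        falling j n * w + falling j n * m * q ^ n * (q ^ suc j * w)
          ≈⟨ +-cong (falling-absorb j n w q^w≈0) (trans (*-congˡ q^w≈0) (zeroʳ _)) ⟩
        w + 0#
          ≈⟨ +-identityʳ w ⟩
        w ∎

      module _ (K : ℕ) (q^K≈0 : q ^ K ≈ 0#) where

        ^-nilpotent : ∀ {e} → K ℕ.≤ e → q ^ e ≈ 0#
        ^-nilpotent {e} K≤e = begin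
          q ^ e                      ≡⟨ ≡.cong (q ^_) (ℕ.m+[n∸m]≡n K≤e) ⟨
          q ^ (K ℕ.+ (e ℕ.∸ K))      ≈⟨ ^-homo-* q K (e ℕ.∸ K) ⟩
          q ^ K * q ^ (e ℕ.∸ K)      ≈⟨ *-congʳ q^K≈0 ⟩
          0# * q ^ (e ℕ.∸ K)         ≈⟨ zeroˡ _ ⟩
          0#                         ∎

        -- The exponent of q is e + 1 + n(n-1)/2, and n(n-1)/2 is at least n - 1, so the total is at
        -- least e + n.
        geometric-annihilated : ∀ z n e → K ℕ.≤ e ℕ.+ n → q ^ suc e * geometric q z n ≈ 0#
        geometric-annihilated z zero e K≤ =
          trans (*-congʳ (^-nilpotent (ℕ.m≤n⇒m≤1+n (≡.subst (K ℕ.≤_) (ℕ.+-identityʳ e) K≤)))) (zeroˡ _)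
        geometric-annihilated z (suc zero) e K≤ =
          trans (*-congʳ (^-nilpotent (≡.subst (K ℕ.≤_) (ℕ.+-comm e 1) K≤))) (zeroˡ _)
        geometric-annihilated z (suc (suc n)) e K≤ = begin
          q ^ suc e * (g * (z * (q * q ^ n)))
            ≈⟨ solve 5 (λ a g z q b → a :* (g :* (z :* (q :* b))) := (q :* a :* g) :* (z :* b)) refl
                 (q ^ suc e) g z q (q ^ n) ⟩
          q ^ suc (suc e) * g * (z * q ^ n)
            ≈⟨ *-congʳ (geometric-annihilated z (suc n) (suc e) (≡.subst (K ℕ.≤_) (ℕ.+-suc e (suc n)) K≤)) ⟩
          0# * (z * q ^ n)
            ≈⟨ zeroˡ _ ⟩
          0# ∎
          where
          g : Carrier
          g = geometric q z (suc n)

    module _ (a b : Carrier) (K : ℕ) (q^K≈0 : (a * b) ^ K ≈ 0#) where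

      private
        q : Carrier
        q = a * b

      weight-right : ∀ k n → weight a b (k ℕ.+ n) k ≡ geometric q a n
      weight-right zero    n = ≡.refl
      weight-right (suc k) n = weight-right k n

      weight-left : ∀ i n → weight a b i (i ℕ.+ n) ≈ geometric q b n
      weight-left zero    n = weight-zero a b n
      weight-left (suc i) n = weight-left i n

      -- Where i or j alone falls short of K, the theta term supplies the missing powers of q: its
      -- exponent grows quadratically with the distance d from the centre. Both conclusions are
      -- needed, one for each of the two tails that remain after clearing the denominator of
      -- [L choose i].
      weight-annihilated : ∀ i j → i ℕ.+ j ≡ suc K ℕ.+ K →
        q ^ suc i * weight a b i (suc K) ≈ 0# × q ^ suc j * weight a b i (suc K) ≈ 0#
      weight-annihilated i j i+j≡ with ℕ.≤-total i (suc K)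
      ... | inj₁ i≤ =
          trans (*-congˡ w≈) (geometric-annihilated q K q^K≈0 b d i (ℕ.≤-trans (ℕ.n≤1+n K) (ℕ.≤-reflexive (≡.sym i+d≡))))
        , trans (*-congʳ (^-nilpotent q K q^K≈0 (ℕ.m≤n⇒m≤1+n K≤j))) (zeroˡ _)
        where
        d : ℕ
        d = suc K ℕ.∸ i
        i+d≡ : i ℕ.+ d ≡ suc K
        i+d≡ = ℕ.m+[n∸m]≡n i≤
        w≈ : weight a b i (suc K) ≈ geometric q b d
        w≈ = trans (reflexive (≡.cong (weight a b i) (≡.sym i+d≡))) (weight-left i d)
        K≤j : K ℕ.≤ j
        K≤j = ℕ.+-cancelˡ-≤ (suc K) K j (≡.subst (ℕ._≤ suc K ℕ.+ j) i+j≡ (ℕ.+-monoˡ-≤ j i≤))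
      ... | inj₂ ≤i =
          trans (*-congʳ (^-nilpotent q K q^K≈0 (ℕ.m≤n⇒m≤1+n (ℕ.≤-trans (ℕ.n≤1+n K) ≤i)))) (zeroˡ _)
        , trans (*-congˡ w≈) (geometric-annihilated q K q^K≈0 a d j (ℕ.≤-reflexive (≡.sym j+d≡)))
        where
        d : ℕ
        d = i ℕ.∸ suc K
        d+≡ : suc K ℕ.+ d ≡ i
        d+≡ = ℕ.m+[n∸m]≡n ≤i
        w≈ : weight a b i (suc K) ≈ geometric q a d
        w≈ = reflexive (≡.trans (≡.cong (λ l → weight a b l (suc K)) (≡.sym d+≡)) (weight-right (suc K) d))
        j+d≡ : j ℕ.+ d ≡ K
        j+d≡ = ℕ.+-cancelˡ-≡ (suc K) _ _ (≡.trans
          (≡.trans (≡.cong (suc K ℕ.+_) (ℕ.+-comm j d)) (≡.trans (≡.sym (ℕ.+-assoc (suc K) d j)) (≡.cong (ℕ._+ j) d+≡)))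
          i+j≡)

      -- Since q^K ≈ 0, multiplying [L choose i] by (q;q)_L turns it into 1
      -- wherever the corresponding theta term does not vanish anyway.
      truncated-triple-product :
        falling q 0 (suc K ℕ.+ K) * (rising q a K * rising q b (suc K)) ≈
        ∑ (suc K) (λ n → geometric q a n + geometric q b (suc n))
      truncated-triple-product = begin
        falling q 0 L * (rising q a K * rising q b (suc K))
          ≈⟨ *-congˡ (finite-triple-product a b K (suc K)) ⟩
        falling q 0 L * ∑ (suc L) (λ i → gaussian q L i * weight a b i (suc K))
          ≈⟨ *-∑ _ (suc L) _ ⟩
        ∑ (suc L) (λ i → falling q 0 L * (gaussian q L i * weight a b i (suc K)))
          ≈⟨ ∑-cong< (suc L) term ⟩
        ∑ (suc L) (λ i → weight a b i (suc K))
          -- L + 1 = 2(K + 1). Taking K factors with a but K + 1 with b makes the number of terms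
          -- even, as the pairing of n with -(n + 1) requires.
          ≡⟨ ≡.cong (λ l → ∑ l (λ i → weight a b i (suc K))) (≡.cong suc (≡.sym (ℕ.+-suc K K))) ⟩
        ∑ (suc K ℕ.+ suc K) (λ i → weight a b i (suc K))
          ≈⟨ ∑-weight a b (suc K) ⟩
        ∑ (suc K) (λ n → geometric q a n + geometric q b (suc n))
          ∎
        where
        L : ℕ
        L = suc K ℕ.+ K
        term : ∀ i → i ℕ.< suc L → falling q 0 L * (gaussian q L i * weight a b i (suc K)) ≈ weight a b i (suc K)
        term i (s≤s i≤L) = begin
          falling q 0 L * (gaussian q L i * w)
            ≡⟨ ≡.cong (λ l → falling q 0 l * (gaussian q L i * w)) i+j≡ ⟨
          falling q 0 (i ℕ.+ j) * (gaussian q L i * w)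
            -- (q;q)_L = (q;q)_i (q^(i+1);q)_j. The first part clears the denominator of
            -- [L choose i], leaving (q^(j+1);q)_i besides the second part, and the theta term
            -- absorbs both.
            ≈⟨ *-congʳ (∏-++ i j _) ⟩
          falling q 0 i * falling q i j * (gaussian q L i * w)
            ≡⟨ ≡.cong (λ l → falling q 0 i * falling q i j * (gaussian q l i * w)) (≡.trans (ℕ.+-comm j i) i+j≡) ⟨
          falling q 0 i * falling q i j * (gaussian q (j ℕ.+ i) i * w)
            ≈⟨ solve 4 (λ f g h w → f :* g :* (h :* w) := g :* (f :* h :* w)) refl
                 (falling q 0 i) (falling q i j) (gaussian q (j ℕ.+ i) i) w ⟩
          falling q i j * (falling q 0 i * gaussian q (j ℕ.+ i) i * w)
            ≈⟨ *-congˡ (*-congʳ (gaussian-product q i j)) ⟩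
          falling q i j * (falling q j i * w)
            ≈⟨ *-congˡ (falling-absorb q j i w (proj₂ (weight-annihilated i j i+j≡))) ⟩
          falling q i j * w
            ≈⟨ falling-absorb q i j w (proj₁ (weight-annihilated i j i+j≡)) ⟩
          w ∎
          where
          j : ℕ
          j = L ℕ.∸ i
          i+j≡ : i ℕ.+ j ≡ L
          i+j≡ = ℕ.m+[n∸m]≡n i≤L
          w : Carrier
          w = weight a b i (suc K)

-- Theta series: dissections mod 3 and product forms

-- tri n = n(n-1)/2
tri : ℕ → ℕ
tri zero    = 0
tri (suc n) = tri n ℕ.+ n

tri-*2 : ∀ k → tri (k ℕ.* 2) ≡ k ℕ.+ 4 ℕ.* tri k
tri-*2 zero    = ≡.refl
tri-*2 (suc k) = ≡.trans (≡.cong (λ t → t ℕ.+ k ℕ.* 2 ℕ.+ suc (k ℕ.* 2)) (tri-*2 k))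
  (solve 2 (λ k t → k :+ con 4 :* t :+ k :* con 2 :+ (con 1 :+ k :* con 2) := con 1 :+ k :+ con 4 :* (t :+ k)) ≡.refl k (tri k))
  where open ℕ-Solver.+-*-Solver

tri-*3 : ∀ k → tri (k ℕ.* 3) ≡ 3 ℕ.* k ℕ.+ 9 ℕ.* tri k
tri-*3 zero    = ≡.refl
tri-*3 (suc k) = ≡.trans (≡.cong (λ t → t ℕ.+ k ℕ.* 3 ℕ.+ suc (k ℕ.* 3) ℕ.+ suc (suc (k ℕ.* 3))) (tri-*3 k))
  (solve 2 (λ k t → con 3 :* k :+ con 9 :* t :+ k :* con 3 :+ (con 1 :+ k :* con 3) :+ (con 2 :+ k :* con 3)
                 := con 3 :* (con 1 :+ k) :+ con 9 :* (t :+ k)) ≡.refl k (tri k))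
  where open ℕ-Solver.+-*-Solver

module ThetaProducts {c ℓ : Level} (S : CommutativeSemiring c ℓ)
  (m : CommutativeSemiring.Carrier S)
  (1+m≈0 : CommutativeSemiring._≈_ S (CommutativeSemiring._+_ S (CommutativeSemiring.1# S) m) (CommutativeSemiring.0# S))
  where
  open CommutativeSemiring S
  open FiniteSums S
  open JacobiTripleProduct S
  open import Algebra.Properties.CommutativeSemiring.Exp S
  open import Relation.Binary.Reasoning.Setoid setoid
  open import Algebra.Solver.Ring.NaturalCoefficients.Default S

  m*m≈1 : m * m ≈ 1#
  m*m≈1 = begin
    m * m                    ≈⟨ cancel-m m 1+m≈0 (m * m) 1# ⟨
    m * m + (1# + m * 1#)    ≈⟨ solve 1 (λ m → m :* m :+ (con 1 :+ m :* con 1) := con 1 :+ (m :+ m :* m)) refl m ⟩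
    1# + (m + m * m)         ≈⟨ cancel-m m 1+m≈0 1# m ⟩
    1#                       ∎

  one^ : ∀ n → 1# ^ n ≈ 1#
  one^ zero    = refl
  one^ (suc n) = trans (*-identityˡ _) (one^ n)

  module _ (x : Carrier) where

    -- The terms of index n and -(n+1), for n < L, of Σ sⁿ x^{αn(n+1)/2+βn(n-1)/2}.
    θ : Carrier → ℕ → ℕ → ℕ → Carrier
    θ s α β L = ∑ L (λ n → s ^ n * x ^ (α ℕ.* n ℕ.+ (α ℕ.+ β) ℕ.* tri n)
                         + s ^ suc n * x ^ (β ℕ.* suc n ℕ.+ (α ℕ.+ β) ℕ.* tri (suc n)))

    geometric-monomial : ∀ q d s α n → q ≈ x ^ d →
      geometric q (s * x ^ α) n ≈ s ^ n * x ^ (α ℕ.* n ℕ.+ d ℕ.* tri n)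
    geometric-monomial q d s α zero q≈ = begin
      1#                                 ≈⟨ *-identityˡ 1# ⟨
      1# * x ^ 0                         ≡⟨ ≡.cong (λ e → 1# * x ^ e) (≡.cong₂ ℕ._+_ (ℕ.*-zeroʳ α) (ℕ.*-zeroʳ d)) ⟨
      1# * x ^ (α ℕ.* 0 ℕ.+ d ℕ.* 0)     ∎
    geometric-monomial q d s α (suc n) q≈ = begin
      geometric q (s * x ^ α) n * (s * x ^ α * q ^ n)
        ≈⟨ *-cong (geometric-monomial q d s α n q≈) (*-congˡ (trans (^-congˡ n q≈) (^-assocʳ x d n))) ⟩
      s ^ n * x ^ e * (s * x ^ α * x ^ (d ℕ.* n))
        ≈⟨ solve 5 (λ a b s c d → a :* b :* (s :* c :* d) := s :* a :* (b :* (c :* d))) refl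
             (s ^ n) (x ^ e) s (x ^ α) (x ^ (d ℕ.* n)) ⟩
      s * s ^ n * (x ^ e * (x ^ α * x ^ (d ℕ.* n)))
        ≈⟨ *-congˡ (trans (*-congˡ (sym (^-homo-* x α (d ℕ.* n)))) (sym (^-homo-* x e (α ℕ.+ d ℕ.* n)))) ⟩
      s * s ^ n * x ^ (e ℕ.+ (α ℕ.+ d ℕ.* n))
        ≡⟨ ≡.cong (λ e → s * s ^ n * x ^ e) (exponent α d n (tri n)) ⟩
      s * s ^ n * x ^ (α ℕ.* suc n ℕ.+ d ℕ.* tri (suc n))
        ∎
      where
      e : ℕ
      e = α ℕ.* n ℕ.+ d ℕ.* tri n
      exponent : ∀ α d n t → α ℕ.* n ℕ.+ d ℕ.* t ℕ.+ (α ℕ.+ d ℕ.* n) ≡ α ℕ.* suc n ℕ.+ d ℕ.* (t ℕ.+ n)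
      exponent = ℕ-Solver.+-*-Solver.solve 4 (λ α d n t → α P.:* n P.:+ d P.:* t P.:+ (α P.:+ d P.:* n)
                   P.:= α P.:* (P.con 1 P.:+ n) P.:+ d P.:* (t P.:+ n)) ≡.refl
        where module P = ℕ-Solver.+-*-Solver

    m^[3k] : ∀ k → m ^ (k ℕ.* 3) ≈ m ^ k
    m^[3k] zero    = refl
    m^[3k] (suc k) = begin
      m * (m * (m * m ^ (k ℕ.* 3)))   ≈⟨ solve 2 (λ m p → m :* (m :* (m :* p)) := m :* m :* (m :* p)) refl m _ ⟩
      m * m * (m * m ^ (k ℕ.* 3))     ≈⟨ *-cong m*m≈1 (*-congˡ (m^[3k] k)) ⟩
      1# * (m * m ^ k)                ≈⟨ *-identityˡ _ ⟩
      m ^ suc k                       ∎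

    -- For α = β = 1 the term of index -(n + 1) equals that of index n + 1. A block of three pairs
    -- therefore reads g(3k) + 2g(3k+1) + 2g(3k+2) + g(3k+3), where the outer terms are the k-th
    -- pair of φ(-x⁹) and the inner ones are 2mx times the k-th pair of Ω(-x³).
    φ-dissection : ∀ H → θ m 1 1 (H ℕ.* 3) ≈ θ m 9 9 H + (m + m) * x * θ m 15 3 H
    φ-dissection H = begin
      ∑ (H ℕ.* 3) (λ n → g n + g (suc n))
        ≈⟨ ∑-blocks 3 H _ ⟩
      ∑ H (λ k → ∑ 3 (λ i → g (k ℕ.* 3 ℕ.+ i) + g (suc (k ℕ.* 3 ℕ.+ i))))
        ≈⟨ ∑-cong H block ⟩
      ∑ H (λ k → (m ^ k * x ^ (9 ℕ.* k ℕ.+ 18 ℕ.* tri k) + m ^ suc k * x ^ (9 ℕ.* suc k ℕ.+ 18 ℕ.* tri (suc k)))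
               + (m + m) * x * (m ^ k * x ^ (15 ℕ.* k ℕ.+ 18 ℕ.* tri k) + m ^ suc k * x ^ (3 ℕ.* suc k ℕ.+ 18 ℕ.* tri (suc k))))
        ≈⟨ trans (∑-+ H _ _) (+-congˡ (sym (*-∑ _ H _))) ⟩
      θ m 9 9 H + (m + m) * x * θ m 15 3 H
        ∎
      where
      g : ℕ → Carrier
      g n = m ^ n * x ^ (1 ℕ.* n ℕ.+ 2 ℕ.* tri n)
      module P = ℕ-Solver.+-*-Solver
      g₀ : ∀ k → g (k ℕ.* 3) ≈ m ^ k * x ^ (9 ℕ.* k ℕ.+ 18 ℕ.* tri k)
      g₀ k = *-cong (m^[3k] k) (^-congʳ x (≡.trans (≡.cong (λ t → 1 ℕ.* (k ℕ.* 3) ℕ.+ 2 ℕ.* t) (tri-*3 k))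
        (P.solve 2 (λ k t → P.con 1 P.:* (k P.:* P.con 3) P.:+ P.con 2 P.:* (P.con 3 P.:* k P.:+ P.con 9 P.:* t)
                      P.:= P.con 9 P.:* k P.:+ P.con 18 P.:* t) ≡.refl k (tri k))))
      g₁ : ∀ k → g (suc (k ℕ.* 3)) ≈ m * x * (m ^ k * x ^ (15 ℕ.* k ℕ.+ 18 ℕ.* tri k))
      g₁ k = trans (*-cong (*-congˡ (m^[3k] k)) (^-congʳ x {y = suc (15 ℕ.* k ℕ.+ 18 ℕ.* tri k)}
          (≡.trans (≡.cong (λ t → 1 ℕ.* suc (k ℕ.* 3) ℕ.+ 2 ℕ.* (t ℕ.+ k ℕ.* 3)) (tri-*3 k))
            (P.solve 2 (λ k t → P.con 1 P.:* (P.con 1 P.:+ k P.:* P.con 3) P.:+ P.con 2 P.:* (P.con 3 P.:* k P.:+ P.con 9 P.:* t P.:+ k P.:* P.con 3)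
                          P.:= P.con 1 P.:+ (P.con 15 P.:* k P.:+ P.con 18 P.:* t)) ≡.refl k (tri k)))))
        (*-interchange _ _ _ _)
      g₂ : ∀ k → g (suc (suc (k ℕ.* 3))) ≈ m * x * (m ^ suc k * x ^ (3 ℕ.* suc k ℕ.+ 18 ℕ.* tri (suc k)))
      g₂ k = trans (*-cong (*-congˡ (*-congˡ (m^[3k] k))) (^-congʳ x {y = suc (3 ℕ.* suc k ℕ.+ 18 ℕ.* tri (suc k))}
          (≡.trans (≡.cong (λ t → 1 ℕ.* suc (suc (k ℕ.* 3)) ℕ.+ 2 ℕ.* (t ℕ.+ k ℕ.* 3 ℕ.+ suc (k ℕ.* 3))) (tri-*3 k))
            (P.solve 2 (λ k t → P.con 1 P.:* (P.con 2 P.:+ k P.:* P.con 3)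
                                  P.:+ P.con 2 P.:* (P.con 3 P.:* k P.:+ P.con 9 P.:* t P.:+ k P.:* P.con 3 P.:+ (P.con 1 P.:+ k P.:* P.con 3))
                          P.:= P.con 1 P.:+ (P.con 3 P.:* (P.con 1 P.:+ k) P.:+ P.con 18 P.:* (t P.:+ k))) ≡.refl k (tri k)))))
        (*-interchange _ _ _ _)
      at : ∀ k i → g (k ℕ.* 3 ℕ.+ i) ≈ g (i ℕ.+ k ℕ.* 3)
      at k i = reflexive (≡.cong g (ℕ.+-comm (k ℕ.* 3) i))
      at′ : ∀ k i → g (suc (k ℕ.* 3 ℕ.+ i)) ≈ g (suc (i ℕ.+ k ℕ.* 3))
      at′ k i = reflexive (≡.cong (λ l → g (suc l)) (ℕ.+-comm (k ℕ.* 3) i))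
      block : ∀ k → _
      block k = begin
        0# + (g (k ℕ.* 3 ℕ.+ 0) + g (suc (k ℕ.* 3 ℕ.+ 0)))
           + (g (k ℕ.* 3 ℕ.+ 1) + g (suc (k ℕ.* 3 ℕ.+ 1)))
           + (g (k ℕ.* 3 ℕ.+ 2) + g (suc (k ℕ.* 3 ℕ.+ 2)))
          ≈⟨ +-cong (+-cong (+-congˡ (+-cong (trans (at k 0) (g₀ k)) (trans (at′ k 0) (g₁ k))))
               (+-cong (trans (at k 1) (g₁ k)) (trans (at′ k 1) (g₂ k))))
               (+-cong (trans (at k 2) (g₂ k)) (trans (at′ k 2) (g₀ (suc k)))) ⟩
        0# + (A + m * x * B) + (m * x * B + m * x * C) + (m * x * C + D)
          ≈⟨ solve 6 (λ a b c d m x → con 0 :+ (a :+ m :* x :* b) :+ (m :* x :* b :+ m :* x :* c) :+ (m :* x :* c :+ d)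
                := (a :+ d) :+ (m :+ m) :* x :* (b :+ c)) refl A B C D m x ⟩
        (A + D) + (m + m) * x * (B + C) ∎
        where
        A B C D : Carrier
        A = m ^ k * x ^ (9 ℕ.* k ℕ.+ 18 ℕ.* tri k)
        B = m ^ k * x ^ (15 ℕ.* k ℕ.+ 18 ℕ.* tri k)
        C = m ^ suc k * x ^ (3 ℕ.* suc k ℕ.+ 18 ℕ.* tri (suc k))
        D = m ^ suc k * x ^ (9 ℕ.* suc k ℕ.+ 18 ℕ.* tri (suc k))

    triangularSum : ℕ → ℕ → Carrier
    triangularSum e M = ∑ M (λ n → x ^ (e ℕ.* tri (suc n)))

    θ-unsigned : ∀ α β L → θ 1# α β L ≈
      ∑ L (λ n → x ^ (α ℕ.* n ℕ.+ (α ℕ.+ β) ℕ.* tri n) + x ^ (β ℕ.* suc n ℕ.+ (α ℕ.+ β) ℕ.* tri (suc n)))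
    θ-unsigned α β L = ∑-cong L λ n →
      +-cong (trans (*-congʳ (one^ n)) (*-identityˡ _)) (trans (*-congʳ (one^ (suc n))) (*-identityˡ _))

    -- The indices n and -(n + 1) of the two-sided series give the triangular numbers T(2n) and
    -- T(2n+1), where T(k) = `tri (suc k)`.
    ψ-triangular : ∀ e L → θ 1# (3 ℕ.* e) e L ≈ triangularSum e (L ℕ.* 2)
    ψ-triangular e L = begin
      θ 1# (3 ℕ.* e) e L
        ≈⟨ θ-unsigned (3 ℕ.* e) e L ⟩
      ∑ L (λ n → x ^ (3 ℕ.* e ℕ.* n ℕ.+ (3 ℕ.* e ℕ.+ e) ℕ.* tri n) + x ^ (e ℕ.* suc n ℕ.+ (3 ℕ.* e ℕ.+ e) ℕ.* tri (suc n)))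
        ≈⟨ ∑-cong L (λ n → trans (+-congˡ (^-congʳ x (odd n))) (trans (+-congʳ (^-congʳ x (even n))) (sym (+-congʳ (+-identityˡ _))))) ⟩
      ∑ L (λ n → ∑ 2 (λ i → x ^ (e ℕ.* tri (suc (n ℕ.* 2 ℕ.+ i)))))
        ≈⟨ ∑-blocks 2 L _ ⟨
      triangularSum e (L ℕ.* 2)
        ∎
      where
      module P = ℕ-Solver.+-*-Solver
      even : ∀ n → 3 ℕ.* e ℕ.* n ℕ.+ (3 ℕ.* e ℕ.+ e) ℕ.* tri n ≡ e ℕ.* tri (suc (n ℕ.* 2 ℕ.+ 0))
      even n = ≡.sym (≡.trans (≡.cong (λ l → e ℕ.* tri (suc l)) (ℕ.+-identityʳ (n ℕ.* 2)))
        (≡.trans (≡.cong (λ t → e ℕ.* (t ℕ.+ n ℕ.* 2)) (tri-*2 n))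
          (P.solve 3 (λ e n t → e P.:* (n P.:+ P.con 4 P.:* t P.:+ n P.:* P.con 2)
             P.:= P.con 3 P.:* e P.:* n P.:+ (P.con 3 P.:* e P.:+ e) P.:* t) ≡.refl e n (tri n))))
      odd : ∀ n → e ℕ.* suc n ℕ.+ (3 ℕ.* e ℕ.+ e) ℕ.* tri (suc n) ≡ e ℕ.* tri (suc (n ℕ.* 2 ℕ.+ 1))
      odd n = ≡.sym (≡.trans (≡.cong (λ l → e ℕ.* tri (suc l)) (ℕ.+-comm (n ℕ.* 2) 1))
        (≡.trans (≡.cong (e ℕ.*_) (tri-*2 (suc n)))
          (P.solve 3 (λ e n t → e P.:* (n P.:+ P.con 4 P.:* t)
             P.:= e P.:* n P.:+ (P.con 3 P.:* e P.:+ e) P.:* t) ≡.refl e (suc n) (tri (suc n)))))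

    -- Among T(3k), T(3k+1), T(3k+2) the middle one is 1 + 9T(k), and the outer two are the
    -- exponents of the k-th pair of A(x³).
    triangular-dissection : ∀ M → triangularSum 1 (M ℕ.* 3) ≈ θ 1# 6 3 M + x * triangularSum 9 M
    triangular-dissection M = begin
      triangularSum 1 (M ℕ.* 3)
        ≈⟨ ∑-blocks 3 M _ ⟩
      ∑ M (λ k → ∑ 3 (λ i → x ^ (1 ℕ.* tri (suc (k ℕ.* 3 ℕ.+ i)))))
        ≈⟨ ∑-cong M (λ k → +-cong (+-cong (+-congˡ (^-congʳ x (e₀ k))) (^-congʳ x (e₁ k))) (^-congʳ x (e₂ k))) ⟩
      ∑ M (λ k → 0# + x ^ (6 ℕ.* k ℕ.+ 9 ℕ.* tri k) + x * x ^ (9 ℕ.* tri (suc k)) + x ^ (3 ℕ.* suc k ℕ.+ 9 ℕ.* tri (suc k)))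
        ≈⟨ ∑-cong M (λ k → solve 3 (λ a b c → con 0 :+ a :+ b :+ c := (a :+ c) :+ b) refl _ _ _) ⟩
      ∑ M (λ k → (x ^ (6 ℕ.* k ℕ.+ 9 ℕ.* tri k) + x ^ (3 ℕ.* suc k ℕ.+ 9 ℕ.* tri (suc k))) + x * x ^ (9 ℕ.* tri (suc k)))
        ≈⟨ ∑-+ M _ _ ⟩
      ∑ M (λ k → x ^ (6 ℕ.* k ℕ.+ 9 ℕ.* tri k) + x ^ (3 ℕ.* suc k ℕ.+ 9 ℕ.* tri (suc k))) + ∑ M (λ k → x * x ^ (9 ℕ.* tri (suc k)))
        ≈⟨ +-cong (θ-unsigned 6 3 M) (*-∑ x M _) ⟨
      θ 1# 6 3 M + x * triangularSum 9 M
        ∎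
      where
      module P = ℕ-Solver.+-*-Solver
      at : ∀ k i → 1 ℕ.* tri (suc (k ℕ.* 3 ℕ.+ i)) ≡ tri (suc i ℕ.+ k ℕ.* 3)
      at k i = ≡.trans (ℕ.*-identityˡ _) (≡.cong (λ l → tri (suc l)) (ℕ.+-comm (k ℕ.* 3) i))
      e₀ : ∀ k → 1 ℕ.* tri (suc (k ℕ.* 3 ℕ.+ 0)) ≡ 6 ℕ.* k ℕ.+ 9 ℕ.* tri k
      e₀ k = ≡.trans (at k 0) (≡.trans (≡.cong (ℕ._+ k ℕ.* 3) (tri-*3 k))
        (P.solve 2 (λ k t → P.con 3 P.:* k P.:+ P.con 9 P.:* t P.:+ k P.:* P.con 3 P.:= P.con 6 P.:* k P.:+ P.con 9 P.:* t) ≡.refl k (tri k)))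
      e₁ : ∀ k → 1 ℕ.* tri (suc (k ℕ.* 3 ℕ.+ 1)) ≡ suc (9 ℕ.* tri (suc k))
      e₁ k = ≡.trans (at k 1) (≡.trans (≡.cong (λ t → t ℕ.+ k ℕ.* 3 ℕ.+ suc (k ℕ.* 3)) (tri-*3 k))
        (P.solve 2 (λ k t → P.con 3 P.:* k P.:+ P.con 9 P.:* t P.:+ k P.:* P.con 3 P.:+ (P.con 1 P.:+ k P.:* P.con 3)
           P.:= P.con 1 P.:+ P.con 9 P.:* (t P.:+ k)) ≡.refl k (tri k)))
      e₂ : ∀ k → 1 ℕ.* tri (suc (k ℕ.* 3 ℕ.+ 2)) ≡ 3 ℕ.* suc k ℕ.+ 9 ℕ.* tri (suc k)
      e₂ k = ≡.trans (at k 2) (tri-*3 (suc k))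

    -- The one-sided form mediates between groupings by 2 and by 3: 3H pairs are 6H terms, hence 2H
    -- blocks of three, and the 2H middle terms regroup into H pairs of ψ(x⁹). This is why A(x³) has
    -- length 2H.
    ψ-dissection : ∀ H → θ 1# 3 1 (H ℕ.* 3) ≈ θ 1# 6 3 (H ℕ.* 2) + x * θ 1# 27 9 H
    ψ-dissection H = begin
      θ 1# 3 1 (H ℕ.* 3)                                      ≈⟨ ψ-triangular 1 (H ℕ.* 3) ⟩
      triangularSum 1 (H ℕ.* 3 ℕ.* 2)                         ≡⟨ ≡.cong (triangularSum 1) swap ⟩
      triangularSum 1 (H ℕ.* 2 ℕ.* 3)                         ≈⟨ triangular-dissection (H ℕ.* 2) ⟩
      θ 1# 6 3 (H ℕ.* 2) + x * triangularSum 9 (H ℕ.* 2)      ≈⟨ +-congˡ (*-congˡ (ψ-triangular 9 H)) ⟨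
      θ 1# 6 3 (H ℕ.* 2) + x * θ 1# 27 9 H                    ∎
      where
      swap : H ℕ.* 3 ℕ.* 2 ≡ H ℕ.* 2 ℕ.* 3
      swap = ≡.trans (ℕ.*-assoc H 3 2) (≡.sym (ℕ.*-assoc H 2 3))

    module _ (N : ℕ) (x^N≈0 : x ^ N ≈ 0#) where

      x^-nilpotent : ∀ {e} → N ℕ.≤ e → x ^ e ≈ 0#
      x^-nilpotent = ^-nilpotent m 1+m≈0 x N x^N≈0

      -- The infinite product (-s x^α; x^d)_∞, which is finite because x^N ≈ 0.
      P : Carrier → ℕ → ℕ → Carrier
      P s α d = ∏ N (λ k → 1# + s * x ^ (α ℕ.+ k ℕ.* d))

      factor-one : ∀ s {e} → N ℕ.≤ e → 1# + s * x ^ e ≈ 1#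
      factor-one s N≤e = trans (+-congˡ (trans (*-congˡ (x^-nilpotent N≤e)) (zeroʳ s))) (+-identityʳ 1#)

      P-stable : ∀ s α {d K} → 1 ℕ.≤ d → N ℕ.≤ K → ∏ K (λ k → 1# + s * x ^ (α ℕ.+ k ℕ.* d)) ≈ P s α d
      P-stable s α {suc d} _ N≤K = ∏-stable _ N≤K λ k N≤k →
        factor-one s (ℕ.≤-trans N≤k (ℕ.≤-trans (ℕ.m≤m*n k (suc d)) (ℕ.m≤n+m (k ℕ.* suc d) α)))

      P-large : ∀ s {α} d → N ℕ.≤ α → P s α d ≈ 1#
      P-large s d N≤α = ∏-one N λ k → factor-one s (ℕ.≤-trans N≤α (ℕ.m≤m+n _ _))

      -- With a = s x^α and b = s x^β, the condition s s ≈ 1 gives ab = x^(α+β). The lengths 2K + 1,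
      -- K and K + 1 in the truncated identity are all at least N, so each product may be replaced
      -- by the one of length N.
      triple-product : ∀ s α β {K} → s * s ≈ 1# → 1 ℕ.≤ α ℕ.+ β → N ℕ.≤ K →
        θ s α β (suc K) ≈ P m (α ℕ.+ β) (α ℕ.+ β) * (P s α (α ℕ.+ β) * P s β (α ℕ.+ β))
      triple-product s α β {K} s*s≈1 1≤d N≤K = sym (begin
        P m d d * (P s α d * P s β d)
          ≈⟨ *-cong (P-stable m d 1≤d (ℕ.≤-trans N≤K (ℕ.m≤n+m K (suc K))))
               (*-cong (P-stable s α 1≤d N≤K) (P-stable s β 1≤d (ℕ.m≤n⇒m≤1+n N≤K))) ⟨
        ∏ (suc K ℕ.+ K) (λ k → 1# + m * x ^ (d ℕ.+ k ℕ.* d)) *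
          (∏ K (λ k → 1# + s * x ^ (α ℕ.+ k ℕ.* d)) * ∏ (suc K) (λ k → 1# + s * x ^ (β ℕ.+ k ℕ.* d)))
          ≈⟨ *-cong (∏-cong (suc K ℕ.+ K) λ k → +-congˡ (*-congˡ (x^-d (suc k))))
               (*-cong (∏-cong K (factor α)) (∏-cong (suc K) (factor β))) ⟩
        falling m 1+m≈0 q 0 (suc K ℕ.+ K) * (rising q a K * rising q b (suc K))
          ≈⟨ truncated-triple-product m 1+m≈0 a b K q^K≈0 ⟩
        ∑ (suc K) (λ n → geometric q a n + geometric q b (suc n))
          ≈⟨ ∑-cong (suc K) (λ n → +-cong (geometric-monomial q d s α n q≈) (geometric-monomial q d s β (suc n) q≈)) ⟩
        θ s α β (suc K) ∎)
        where
        d : ℕ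
        d = α ℕ.+ β
        a b q : Carrier
        a = s * x ^ α
        b = s * x ^ β
        q = a * b
        q≈ : q ≈ x ^ d
        q≈ = begin
          s * x ^ α * (s * x ^ β)    ≈⟨ *-interchange s (x ^ α) s (x ^ β) ⟩
          s * s * (x ^ α * x ^ β)    ≈⟨ *-cong s*s≈1 (sym (^-homo-* x α β)) ⟩
          1# * x ^ d                 ≈⟨ *-identityˡ _ ⟩
          x ^ d                      ∎
        x^-d : ∀ k → x ^ (k ℕ.* d) ≈ q ^ k
        x^-d k = begin
          x ^ (k ℕ.* d)  ≡⟨ ≡.cong (x ^_) (ℕ.*-comm k d) ⟩
          x ^ (d ℕ.* k)  ≈⟨ ^-assocʳ x d k ⟨
          (x ^ d) ^ k    ≈⟨ ^-congˡ k q≈ ⟨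
          q ^ k          ∎
        factor : ∀ α k → 1# + s * x ^ (α ℕ.+ k ℕ.* d) ≈ 1# + s * x ^ α * q ^ k
        factor α k = +-congˡ (trans (*-congˡ (trans (^-homo-* x α (k ℕ.* d)) (*-congˡ (x^-d k)))) (sym (*-assoc _ _ _)))
        q^K≈0 : q ^ K ≈ 0#
        q^K≈0 = trans (sym (x^-d K)) (x^-nilpotent (ℕ.≤-trans N≤K (ℕ.m≤m*n K d ⦃ ℕ.>-nonZero 1≤d ⦄)))

      P-split : ∀ c s α d → 1 ℕ.≤ c → 1 ℕ.≤ d → P s α d ≈ ∏ c (λ i → P s (α ℕ.+ i ℕ.* d) (c ℕ.* d))
      P-split c s α d 1≤c 1≤d = begin
        P s α d
          ≈⟨ P-stable s α 1≤d (ℕ.m≤m*n N c ⦃ ℕ.>-nonZero 1≤c ⦄) ⟨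
        ∏ (N ℕ.* c) (λ k → 1# + s * x ^ (α ℕ.+ k ℕ.* d))
          ≈⟨ ∏-blocks c N _ ⟩
        ∏ N (λ k → ∏ c (λ i → 1# + s * x ^ (α ℕ.+ (k ℕ.* c ℕ.+ i) ℕ.* d)))
          ≈⟨ ∏-swap N c _ ⟩
        ∏ c (λ i → ∏ N (λ k → 1# + s * x ^ (α ℕ.+ (k ℕ.* c ℕ.+ i) ℕ.* d)))
          ≈⟨ ∏-cong c (λ i → ∏-cong N λ k → +-congˡ (*-congˡ (^-congʳ x (exponent α k c i d)))) ⟩
        ∏ c (λ i → P s (α ℕ.+ i ℕ.* d) (c ℕ.* d))
          ∎
        where
        module Q = ℕ-Solver.+-*-Solver
        exponent : ∀ α k c i d → α ℕ.+ (k ℕ.* c ℕ.+ i) ℕ.* d ≡ α ℕ.+ i ℕ.* d ℕ.+ k ℕ.* (c ℕ.* d)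
        exponent = Q.solve 5 (λ α k c i d → α Q.:+ (k Q.:* c Q.:+ i) Q.:* d Q.:= α Q.:+ i Q.:* d Q.:+ k Q.:* (c Q.:* d)) ≡.refl

      -- All parameters are multiples of a common scale e, so that one computation of φψ serves both
      -- e = 1 and e = 9, and ΩA with e = 3 arrives at the same E(x⁹)E(x¹⁸).
      P-split₂ : ∀ s j e d → 1 ℕ.≤ d ℕ.* e →
        P s (j ℕ.* e) (d ℕ.* e) ≈ P s (j ℕ.* e) (2 ℕ.* d ℕ.* e) * P s ((j ℕ.+ d) ℕ.* e) (2 ℕ.* d ℕ.* e)
      P-split₂ s j e d 1≤d = trans (P-split 2 s (j ℕ.* e) (d ℕ.* e) (s≤s z≤n) 1≤d)
        (*-cong (trans (*-identityˡ _) (reflexive (≡.cong₂ (P s) (ℕ.+-identityʳ (j ℕ.* e)) (≡.sym (ℕ.*-assoc 2 d e)))))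
                (reflexive (≡.cong₂ (P s) (≡.trans (≡.cong (j ℕ.* e ℕ.+_) (ℕ.*-identityˡ (d ℕ.* e))) (≡.sym (ℕ.*-distribʳ-+ e j d)))
                                          (≡.sym (ℕ.*-assoc 2 d e)))))

      P-split₃ : ∀ s j e d → 1 ℕ.≤ d ℕ.* e →
        P s (j ℕ.* e) (d ℕ.* e) ≈
        P s (j ℕ.* e) (3 ℕ.* d ℕ.* e) * P s ((j ℕ.+ d) ℕ.* e) (3 ℕ.* d ℕ.* e) * P s ((j ℕ.+ 2 ℕ.* d) ℕ.* e) (3 ℕ.* d ℕ.* e)
      P-split₃ s j e d 1≤d = trans (P-split 3 s (j ℕ.* e) (d ℕ.* e) (s≤s z≤n) 1≤d)
        (*-cong (*-cong
          (trans (*-identityˡ _) (reflexive (≡.cong₂ (P s) (ℕ.+-identityʳ (j ℕ.* e)) (≡.sym (ℕ.*-assoc 3 d e)))))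
          (reflexive (≡.cong₂ (P s) (≡.trans (≡.cong (j ℕ.* e ℕ.+_) (ℕ.*-identityˡ (d ℕ.* e))) (≡.sym (ℕ.*-distribʳ-+ e j d)))
                                          (≡.sym (ℕ.*-assoc 3 d e)))))
          (reflexive (≡.cong₂ (P s) (≡.trans (≡.cong (j ℕ.* e ℕ.+_) (≡.sym (ℕ.*-assoc 2 d e))) (≡.sym (ℕ.*-distribʳ-+ e j (2 ℕ.* d))))
                                          (≡.sym (ℕ.*-assoc 3 d e)))))

      -- Factor by factor, (1 + y)(1 - y) = 1 - y².
      P-conjugate : ∀ j e d → P 1# (j ℕ.* e) (d ℕ.* e) * P m (j ℕ.* e) (d ℕ.* e) ≈ P m (2 ℕ.* j ℕ.* e) (2 ℕ.* d ℕ.* e)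
      P-conjugate j e d = trans (sym (∏-* N _ _)) (∏-cong N factor)
        where
        module Q = ℕ-Solver.+-*-Solver
        factor : ∀ k → _
        factor k = begin
          (1# + 1# * y) * (1# + m * y)
            ≈⟨ solve 2 (λ m y → (con 1 :+ con 1 :* y) :* (con 1 :+ m :* y) := (con 1 :+ m :* (y :* y)) :+ (y :+ m :* y)) refl m y ⟩
          (1# + m * (y * y)) + (y + m * y)
            ≈⟨ cancel-m m 1+m≈0 _ _ ⟩
          1# + m * (y * y)
            ≈⟨ +-congˡ (*-congˡ (trans (sym (^-homo-* x n n)) (^-congʳ x (exponent j e d k)))) ⟩
          1# + m * x ^ (2 ℕ.* j ℕ.* e ℕ.+ k ℕ.* (2 ℕ.* d ℕ.* e)) ∎
          where
          n : ℕ
          n = j ℕ.* e ℕ.+ k ℕ.* (d ℕ.* e)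
          y : Carrier
          y = x ^ n
          exponent : ∀ j e d k → j ℕ.* e ℕ.+ k ℕ.* (d ℕ.* e) ℕ.+ (j ℕ.* e ℕ.+ k ℕ.* (d ℕ.* e)) ≡ 2 ℕ.* j ℕ.* e ℕ.+ k ℕ.* (2 ℕ.* d ℕ.* e)
          exponent = Q.solve 4 (λ j e d k → j Q.:* e Q.:+ k Q.:* (d Q.:* e) Q.:+ (j Q.:* e Q.:+ k Q.:* (d Q.:* e))
            Q.:= Q.con 2 Q.:* j Q.:* e Q.:+ k Q.:* (Q.con 2 Q.:* d Q.:* e)) ≡.refl

      1≤c*e : ∀ c {e} → 1 ℕ.≤ e → 1 ℕ.≤ suc c ℕ.* e
      1≤c*e c {e} 1≤e = ℕ.≤-trans 1≤e (ℕ.m≤n*m e (suc c))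

      -- Euler's identity (-q;q)_∞ (q;q²)_∞ = 1 for q = x^e. Splitting (-q;q)_∞ by parity and
      -- multiplying (-q;q²)_∞ with (q;q²)_∞ reproduces the left side with q² in place of q; once
      -- the exponent reaches N, both products are 1.
      Euler : ∀ e → 1 ℕ.≤ e → P 1# (1 ℕ.* e) (1 ℕ.* e) * P m (1 ℕ.* e) (2 ℕ.* e) ≈ 1#
      Euler e 1≤e = go N e 1≤e (ℕ.m≤m+n N e)
        where
        go : ∀ fuel e → 1 ℕ.≤ e → N ℕ.≤ fuel ℕ.+ e → P 1# (1 ℕ.* e) (1 ℕ.* e) * P m (1 ℕ.* e) (2 ℕ.* e) ≈ 1#
        go zero e 1≤e N≤e = trans (*-cong (P-large 1# (1 ℕ.* e) N≤) (P-large m (2 ℕ.* e) N≤)) (*-identityˡ 1#)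
          where
          N≤ : N ℕ.≤ 1 ℕ.* e
          N≤ = ℕ.≤-trans N≤e (ℕ.≤-reflexive (≡.sym (ℕ.*-identityˡ e)))
        go (suc fuel) e 1≤e N≤ = begin
          P 1# (1 ℕ.* e) (1 ℕ.* e) * P m (1 ℕ.* e) (2 ℕ.* e)
            ≈⟨ *-congʳ (P-split₂ 1# 1 e 1 (1≤c*e 0 1≤e)) ⟩
          P 1# (1 ℕ.* e) (2 ℕ.* e) * P 1# (2 ℕ.* e) (2 ℕ.* e) * P m (1 ℕ.* e) (2 ℕ.* e)
            ≈⟨ solve 3 (λ a b c → a :* b :* c := b :* (a :* c)) refl _ _ _ ⟩
          P 1# (2 ℕ.* e) (2 ℕ.* e) * (P 1# (1 ℕ.* e) (2 ℕ.* e) * P m (1 ℕ.* e) (2 ℕ.* e))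
            ≈⟨ *-congˡ (P-conjugate 1 e 2) ⟩
          P 1# (2 ℕ.* e) (2 ℕ.* e) * P m (2 ℕ.* e) (4 ℕ.* e)
            ≡⟨ ≡.cong₂ (λ u v → P 1# u u * P m u v) (≡.sym (ℕ.*-identityˡ (2 ℕ.* e))) (ℕ.*-assoc 2 2 e) ⟩
          P 1# (1 ℕ.* (2 ℕ.* e)) (1 ℕ.* (2 ℕ.* e)) * P m (1 ℕ.* (2 ℕ.* e)) (2 ℕ.* (2 ℕ.* e))
            ≈⟨ go fuel (2 ℕ.* e) (1≤c*e 1 1≤e) (ℕ.≤-trans N≤ bound) ⟩
          1# ∎
          where
          -- Doubling raises e by at least 1 because e ≥ 1, which pays for the unit of fuel.
          bound : suc fuel ℕ.+ e ℕ.≤ fuel ℕ.+ 2 ℕ.* e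
          bound = ℕ.≤-trans (ℕ.≤-reflexive (≡.sym (ℕ.+-suc fuel e)))
            (ℕ.+-monoʳ-≤ fuel (ℕ.+-mono-≤ 1≤e (ℕ.≤-reflexive (≡.sym (ℕ.*-identityˡ e)))))

      -- E(x^e)E(x^(2e)) in the presence of x^N ≈ 0.
      E₁E₂ : ℕ → Carrier
      E₁E₂ e = P m (1 ℕ.* e) (1 ℕ.* e) * P m (2 ℕ.* e) (2 ℕ.* e)

      -- With q = x^e, the triple product gives φ(-q) = (q²;q²)(q;q²)² and ψ(q) = (q⁴;q⁴)(-q;q²).
      -- One factor (q;q²) completes (q²;q²) to (q;q); the other combines with (-q;q²) into (q²;q⁴),
      -- which completes (q⁴;q⁴) to (q²;q²).
      φψ : ∀ e {K L} → 1 ℕ.≤ e → N ℕ.≤ K → N ℕ.≤ L →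
        θ m (1 ℕ.* e) (1 ℕ.* e) (suc K) * θ 1# (3 ℕ.* e) (1 ℕ.* e) (suc L) ≈ E₁E₂ e
      φψ e {K} {L} 1≤e N≤K N≤L = begin
        θ m (1 ℕ.* e) (1 ℕ.* e) (suc K) * θ 1# (3 ℕ.* e) (1 ℕ.* e) (suc L)
          ≈⟨ *-cong (triple-product m (1 ℕ.* e) (1 ℕ.* e) m*m≈1 (ℕ.≤-trans 1≤e (ℕ.≤-trans (ℕ.m≤n*m e 1) (ℕ.m≤m+n _ _))) N≤K)
                    (triple-product 1# (3 ℕ.* e) (1 ℕ.* e) (*-identityˡ 1#) (ℕ.≤-trans (1≤c*e 2 1≤e) (ℕ.m≤m+n _ _)) N≤L) ⟩
        _ ≡⟨ ≡.cong₂ (λ u v → P m u u * (P m (1 ℕ.* e) u * P m (1 ℕ.* e) u) * (P m v v * (P 1# (3 ℕ.* e) v * P 1# (1 ℕ.* e) v)))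
               (≡.sym (ℕ.*-distribʳ-+ e 1 1)) (≡.sym (ℕ.*-distribʳ-+ e 3 1)) ⟩
        P m (2 ℕ.* e) (2 ℕ.* e) * (P m (1 ℕ.* e) (2 ℕ.* e) * P m (1 ℕ.* e) (2 ℕ.* e))
          * (P m (4 ℕ.* e) (4 ℕ.* e) * (P 1# (3 ℕ.* e) (4 ℕ.* e) * P 1# (1 ℕ.* e) (4 ℕ.* e)))
          ≈⟨ solve 5 (λ a b c d e → a :* (b :* b) :* (c :* (d :* e)) := b :* a :* ((e :* d) :* b :* c)) refl _ _ _ _ _ ⟩
        P m (1 ℕ.* e) (2 ℕ.* e) * P m (2 ℕ.* e) (2 ℕ.* e)
          * ((P 1# (1 ℕ.* e) (4 ℕ.* e) * P 1# (3 ℕ.* e) (4 ℕ.* e)) * P m (1 ℕ.* e) (2 ℕ.* e) * P m (4 ℕ.* e) (4 ℕ.* e))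
          ≈⟨ *-cong (P-split₂ m 1 e 1 (1≤c*e 0 1≤e)) (*-congʳ (*-congʳ (P-split₂ 1# 1 e 2 (1≤c*e 1 1≤e)))) ⟨
        P m (1 ℕ.* e) (1 ℕ.* e) * (P 1# (1 ℕ.* e) (2 ℕ.* e) * P m (1 ℕ.* e) (2 ℕ.* e) * P m (4 ℕ.* e) (4 ℕ.* e))
          ≈⟨ *-congˡ (*-congʳ (P-conjugate 1 e 2)) ⟩
        P m (1 ℕ.* e) (1 ℕ.* e) * (P m (2 ℕ.* e) (4 ℕ.* e) * P m (4 ℕ.* e) (4 ℕ.* e))
          ≈⟨ *-congˡ (P-split₂ m 2 e 2 (1≤c*e 1 1≤e)) ⟨
        P m (1 ℕ.* e) (1 ℕ.* e) * P m (2 ℕ.* e) (2 ℕ.* e)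
          ∎

      -- The excess `X` over E(q³)E(q⁶), q = x^e, consists of the factors of Euler's product for q
      -- whose exponents are prime to 3. The remaining ones form Euler's product `Y` for q³. As
      -- `X * Y` and `Y` are both 1, so is `X`, without any inverse.
      ΩA : ∀ e {K L} → 1 ℕ.≤ e → N ℕ.≤ K → N ℕ.≤ L →
        θ m (5 ℕ.* e) (1 ℕ.* e) (suc K) * θ 1# (2 ℕ.* e) (1 ℕ.* e) (suc L) ≈ E₁E₂ (3 ℕ.* e)
      ΩA e {K} {L} 1≤e N≤K N≤L = begin
        θ m (5 ℕ.* e) (1 ℕ.* e) (suc K) * θ 1# (2 ℕ.* e) (1 ℕ.* e) (suc L)
          ≈⟨ *-cong (triple-product m (5 ℕ.* e) (1 ℕ.* e) m*m≈1 (ℕ.≤-trans (1≤c*e 4 1≤e) (ℕ.m≤m+n _ _)) N≤K)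
                    (triple-product 1# (2 ℕ.* e) (1 ℕ.* e) (*-identityˡ 1#) (ℕ.≤-trans (1≤c*e 1 1≤e) (ℕ.m≤m+n _ _)) N≤L) ⟩
        _ ≡⟨ ≡.cong₂ (λ u v → P m u u * (P m (5 ℕ.* e) u * P m (1 ℕ.* e) u) * (P m v v * (P 1# (2 ℕ.* e) v * P 1# (1 ℕ.* e) v)))
               (≡.sym (ℕ.*-distribʳ-+ e 5 1)) (≡.sym (ℕ.*-distribʳ-+ e 2 1)) ⟩
        P m (6 ℕ.* e) (6 ℕ.* e) * (P m (5 ℕ.* e) (6 ℕ.* e) * P m (1 ℕ.* e) (6 ℕ.* e))
          * (P m (3 ℕ.* e) (3 ℕ.* e) * (P 1# (2 ℕ.* e) (3 ℕ.* e) * P 1# (1 ℕ.* e) (3 ℕ.* e)))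
          ≈⟨ solve 6 (λ a b c d e f → a :* (b :* c) :* (d :* (e :* f)) := d :* a :* (f :* e :* (c :* b))) refl _ _ _ _ _ _ ⟩
        P m (3 ℕ.* e) (3 ℕ.* e) * P m (6 ℕ.* e) (6 ℕ.* e) * X
          ≈⟨ trans (*-congˡ X≈1) (*-identityʳ _) ⟩
        P m (3 ℕ.* e) (3 ℕ.* e) * P m (6 ℕ.* e) (6 ℕ.* e)
          ≡⟨ ≡.cong₂ (λ u v → P m u u * P m v v) (≡.sym (ℕ.*-identityˡ (3 ℕ.* e))) (ℕ.*-assoc 2 3 e) ⟩
        E₁E₂ (3 ℕ.* e)
          ∎
        where
        X Y : Carrier
        X = P 1# (1 ℕ.* e) (3 ℕ.* e) * P 1# (2 ℕ.* e) (3 ℕ.* e) * (P m (1 ℕ.* e) (6 ℕ.* e) * P m (5 ℕ.* e) (6 ℕ.* e))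
        Y = P 1# (3 ℕ.* e) (3 ℕ.* e) * P m (3 ℕ.* e) (6 ℕ.* e)
        Y≈1 : Y ≈ 1#
        Y≈1 = trans (reflexive (≡.cong₂ (λ u v → P 1# u u * P m u v) (≡.sym (ℕ.*-identityˡ (3 ℕ.* e))) (ℕ.*-assoc 2 3 e)))
          (Euler (3 ℕ.* e) (1≤c*e 2 1≤e))
        X≈1 : X ≈ 1#
        X≈1 = begin
          X
            ≈⟨ trans (*-congˡ Y≈1) (*-identityʳ X) ⟨
          X * Y
            ≈⟨ solve 6 (λ a b c d e f → a :* b :* (c :* d) :* (e :* f) := (a :* b :* e) :* (c :* f :* d)) refl _ _ _ _ _ _ ⟩
          (P 1# (1 ℕ.* e) (3 ℕ.* e) * P 1# (2 ℕ.* e) (3 ℕ.* e) * P 1# (3 ℕ.* e) (3 ℕ.* e))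
            * (P m (1 ℕ.* e) (6 ℕ.* e) * P m (3 ℕ.* e) (6 ℕ.* e) * P m (5 ℕ.* e) (6 ℕ.* e))
            ≈⟨ *-cong (P-split₃ 1# 1 e 1 (1≤c*e 0 1≤e)) (P-split₃ m 1 e 2 (1≤c*e 1 1≤e)) ⟨
          P 1# (1 ℕ.* e) (1 ℕ.* e) * P m (1 ℕ.* e) (2 ℕ.* e)
            ≈⟨ Euler e 1≤e ⟩
          1# ∎

      φ₉ Ω₃ A₃ ψ₉ : Carrier
      φ₉ = θ m 9 9 (suc N)
      Ω₃ = θ m 15 3 (suc N)
      A₃ = θ 1# 6 3 (suc N ℕ.* 2)
      ψ₉ = θ 1# 27 9 (suc N)

      private
        N≤ : ∀ d → N ℕ.≤ d ℕ.+ N ℕ.* suc d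
        N≤ d = ℕ.≤-trans (ℕ.m≤m*n N (suc d)) (ℕ.m≤n+m _ d)

      E₁E₂-dissection : E₁E₂ 1 ≈ φ₉ * A₃ + (x * (m * E₁E₂ 9) + x * (x * ((m + m) * (Ω₃ * ψ₉))))
      E₁E₂-dissection = begin
        E₁E₂ 1
          -- `suc N ℕ.* 3` reduces to `suc (2 ℕ.+ N ℕ.* 3)`, so the length has the required form
          -- `suc K` with K ≥ N.
          ≈⟨ φψ 1 ℕ.≤-refl (N≤ 2) (N≤ 2) ⟨
        θ m 1 1 (suc N ℕ.* 3) * θ 1# 3 1 (suc N ℕ.* 3)
          ≈⟨ *-cong (φ-dissection (suc N)) (ψ-dissection (suc N)) ⟩
        (φ₉ + (m + m) * x * Ω₃) * (A₃ + x * ψ₉)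
          ≈⟨ solve 6 (λ f o a p m x → (f :+ (m :+ m) :* x :* o) :* (a :+ x :* p)
               := f :* a :+ (x :* (f :* p :+ (m :+ m) :* (o :* a)) :+ x :* (x :* ((m :+ m) :* (o :* p))))) refl φ₉ Ω₃ A₃ ψ₉ m x ⟩
        φ₉ * A₃ + (x * (φ₉ * ψ₉ + (m + m) * (Ω₃ * A₃)) + x * (x * ((m + m) * (Ω₃ * ψ₉))))
          ≈⟨ +-congˡ (+-congʳ (*-congˡ (+-cong φψ₉ (*-congˡ ΩA₃)))) ⟩
        φ₉ * A₃ + (x * (G + (m + m) * G) + x * (x * ((m + m) * (Ω₃ * ψ₉))))
          ≈⟨ +-congˡ (+-congʳ (*-congˡ (solve 2 (λ g m → g :+ (m :+ m) :* g := m :* g :+ (g :+ m :* g)) refl G m))) ⟩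
        φ₉ * A₃ + (x * (m * G + (G + m * G)) + x * (x * ((m + m) * (Ω₃ * ψ₉))))
          ≈⟨ +-congˡ (+-congʳ (*-congˡ (cancel-m m 1+m≈0 _ _))) ⟩
        φ₉ * A₃ + (x * (m * G) + x * (x * ((m + m) * (Ω₃ * ψ₉))))
          ∎
        where
        G : Carrier
        G = E₁E₂ 9
        φψ₉ : φ₉ * ψ₉ ≈ G
        φψ₉ = φψ 9 (s≤s z≤n) ℕ.≤-refl ℕ.≤-refl
        ΩA₃ : Ω₃ * A₃ ≈ G
        ΩA₃ = ΩA 3 (s≤s z≤n) ℕ.≤-refl (N≤ 1)

      outer-product : x * (x * ((m + m) * (Ω₃ * ψ₉))) * (φ₉ * A₃) ≈ (m + m) * (x * (m * E₁E₂ 9) * (x * (m * E₁E₂ 9)))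
      outer-product = begin
        x * (x * ((m + m) * (Ω₃ * ψ₉))) * (φ₉ * A₃)
          ≈⟨ solve 6 (λ f o a p m x → x :* (x :* ((m :+ m) :* (o :* p))) :* (f :* a) := x :* (x :* ((m :+ m) :* ((o :* a) :* (f :* p))))) refl
               φ₉ Ω₃ A₃ ψ₉ m x ⟩
        x * (x * ((m + m) * ((Ω₃ * A₃) * (φ₉ * ψ₉))))
          ≈⟨ *-congˡ (*-congˡ (*-congˡ (*-cong (ΩA 3 (s≤s z≤n) ℕ.≤-refl (N≤ 1)) (φψ 9 (s≤s z≤n) ℕ.≤-refl ℕ.≤-refl)))) ⟩
        x * (x * ((m + m) * (G * G)))
          -- G² is written as (mG)² to bring out the square of the middle component x m G.
          ≈⟨ *-congˡ (*-congˡ (*-congˡ (trans (*-congʳ m*m≈1) (*-identityˡ _)))) ⟨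
        x * (x * ((m + m) * (m * m * (G * G))))
          ≈⟨ solve 3 (λ x m g → x :* (x :* ((m :+ m) :* (m :* m :* (g :* g)))) := (m :+ m) :* (x :* (m :* g) :* (x :* (m :* g)))) refl x m G ⟩
        (m + m) * (x * (m * G) * (x * (m * G)))
          ∎
        where
        G : Carrier
        G = E₁E₂ 9

-- Rational estimates: geometric series and convergent products

module Rationals where
  open ≡ using (refl; sym; trans; cong; cong₂; subst)

  ι : ℤ → ℚ
  ι k = k ℚ./ 1

  ι-+ : ∀ a b → ι (a ℤ.+ b) ≡ ι a ℚ.+ ι b
  ι-+ a b = ℚ.toℚᵘ-injective (begin
    toℚᵘ (ι (a ℤ.+ b))                     ≈⟨ ℚ.toℚᵘ-fromℚᵘ (ℚᵘ.mkℚᵘ (a ℤ.+ b) 0) ⟩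
    ℚᵘ.mkℚᵘ (a ℤ.+ b) 0                    ≡⟨ cong₂ (λ u v → ℚᵘ.mkℚᵘ (u ℤ.+ v) 0) (ℤ.*-identityʳ a) (ℤ.*-identityʳ b) ⟨
    ℚᵘ.mkℚᵘ a 0 ℚᵘ.+ ℚᵘ.mkℚᵘ b 0           ≈⟨ ℚᵘ.+-cong (ℚ.toℚᵘ-fromℚᵘ (ℚᵘ.mkℚᵘ a 0)) (ℚ.toℚᵘ-fromℚᵘ (ℚᵘ.mkℚᵘ b 0)) ⟨
    toℚᵘ (ι a) ℚᵘ.+ toℚᵘ (ι b)             ≈⟨ ℚ.toℚᵘ-homo-+ (ι a) (ι b) ⟨
    toℚᵘ (ι a ℚ.+ ι b)                     ∎)
    where open ℚᵘ.≃-Reasoning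

  ι-* : ∀ a b → ι (a ℤ.* b) ≡ ι a ℚ.* ι b
  ι-* a b = ℚ.toℚᵘ-injective (begin
    toℚᵘ (ι (a ℤ.* b))                     ≈⟨ ℚ.toℚᵘ-fromℚᵘ (ℚᵘ.mkℚᵘ (a ℤ.* b) 0) ⟩
    ℚᵘ.mkℚᵘ a 0 ℚᵘ.* ℚᵘ.mkℚᵘ b 0           ≈⟨ ℚᵘ.*-cong (ℚ.toℚᵘ-fromℚᵘ (ℚᵘ.mkℚᵘ a 0)) (ℚ.toℚᵘ-fromℚᵘ (ℚᵘ.mkℚᵘ b 0)) ⟨
    toℚᵘ (ι a) ℚᵘ.* toℚᵘ (ι b)             ≈⟨ ℚ.toℚᵘ-homo-* (ι a) (ι b) ⟨
    toℚᵘ (ι a ℚ.* ι b)                     ∎)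
    where open ℚᵘ.≃-Reasoning

  ℚ-semiring : CommutativeSemiring 0ℓ 0ℓ
  ℚ-semiring = CommutativeRing.commutativeSemiring ℚ.+-*-commutativeRing

  open FiniteSums ℚ-semiring
  open import Algebra.Properties.CommutativeSemiring.Exp ℚ-semiring using (_^_; ^-homo-*)

  open ℚ.≤-Reasoning

  0≤* : ∀ {p q} → 0ℚ ℚ.≤ p → 0ℚ ℚ.≤ q → 0ℚ ℚ.≤ p ℚ.* q
  0≤* {p} {q} 0≤p 0≤q = ℚ.nonNegative⁻¹ (p ℚ.* q)
    ⦃ ℚ.nonNeg*nonNeg⇒nonNeg p ⦃ nonNegative 0≤p ⦄ q ⦃ nonNegative 0≤q ⦄ ⦄

  0≤+ : ∀ {p q} → 0ℚ ℚ.≤ p → 0ℚ ℚ.≤ q → 0ℚ ℚ.≤ p ℚ.+ q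
  0≤+ 0≤p 0≤q = ℚ.+-mono-≤ 0≤p 0≤q

  0<* : ∀ {p q} → 0ℚ ℚ.< p → 0ℚ ℚ.< q → 0ℚ ℚ.< p ℚ.* q
  0<* {p} {q} 0<p 0<q = ℚ.positive⁻¹ (p ℚ.* q) ⦃ ℚ.pos*pos⇒pos p ⦃ positive 0<p ⦄ q ⦃ positive 0<q ⦄ ⦄

  *-mono-≤ : ∀ {a b c d} → 0ℚ ℚ.≤ c → 0ℚ ℚ.≤ b → a ℚ.≤ b → c ℚ.≤ d → a ℚ.* c ℚ.≤ b ℚ.* d
  *-mono-≤ {a} {b} {c} {d} 0≤c 0≤b a≤b c≤d = ℚ.≤-trans
    (ℚ.*-monoʳ-≤-nonNeg c ⦃ nonNegative 0≤c ⦄ a≤b) (ℚ.*-monoˡ-≤-nonNeg b ⦃ nonNegative 0≤b ⦄ c≤d)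

  *-monoˡ-≤ : ∀ {a c d} → 0ℚ ℚ.≤ a → c ℚ.≤ d → a ℚ.* c ℚ.≤ a ℚ.* d
  *-monoˡ-≤ {a} 0≤a = ℚ.*-monoˡ-≤-nonNeg a ⦃ nonNegative 0≤a ⦄

  *-monoʳ-≤ : ∀ {a c d} → 0ℚ ℚ.≤ a → c ℚ.≤ d → c ℚ.* a ℚ.≤ d ℚ.* a
  *-monoʳ-≤ {a} 0≤a = ℚ.*-monoʳ-≤-nonNeg a ⦃ nonNegative 0≤a ⦄

  p≤p+q : ∀ {p q} → 0ℚ ℚ.≤ q → p ℚ.≤ p ℚ.+ q
  p≤p+q {p} {q} 0≤q = subst (ℚ._≤ p ℚ.+ q) (ℚ.+-identityʳ p) (ℚ.+-monoʳ-≤ p 0≤q)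

  p≤q+p : ∀ {p q} → 0ℚ ℚ.≤ q → p ℚ.≤ q ℚ.+ p
  p≤q+p {p} {q} 0≤q = subst (ℚ._≤ q ℚ.+ p) (ℚ.+-identityˡ p) (ℚ.+-monoˡ-≤ p 0≤q)

  ∣p∣²≡p² : ∀ p → ∣ p ∣ ℚ.* ∣ p ∣ ≡ p ℚ.* p
  ∣p∣²≡p² p with ℚ.∣p∣≡p∨∣p∣≡-p p
  ... | inj₁ eq = cong₂ ℚ._*_ eq eq
  ... | inj₂ eq = trans (cong₂ ℚ._*_ eq eq) (solve 1 (λ p → (:- p) :* (:- p) := p :* p) refl p)
    where open +-*-Solver

  0≤p² : ∀ p → 0ℚ ℚ.≤ p ℚ.* p
  0≤p² p = subst (0ℚ ℚ.≤_) (∣p∣²≡p² p) (0≤* (ℚ.0≤∣p∣ p) (ℚ.0≤∣p∣ p))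

  p²≤q²⇒∣p∣≤q : ∀ {p q} → 0ℚ ℚ.≤ q → p ℚ.* p ℚ.≤ q ℚ.* q → ∣ p ∣ ℚ.≤ q
  p²≤q²⇒∣p∣≤q {p} {q} 0≤q p²≤q² with ∣ p ∣ ℚ.≤? q
  ... | yes ∣p∣≤q = ∣p∣≤q
  ... | no  ∣p∣≰q = ⊥-elim (ℚ.<-irrefl refl (begin-strict
      q ℚ.* q          ≤⟨ *-monoˡ-≤ 0≤q (ℚ.<⇒≤ q<∣p∣) ⟩
      q ℚ.* ∣ p ∣      <⟨ ℚ.*-monoˡ-<-pos ∣ p ∣ ⦃ positive (ℚ.≤-<-trans 0≤q q<∣p∣) ⦄ q<∣p∣ ⟩
      ∣ p ∣ ℚ.* ∣ p ∣  ≡⟨ ∣p∣²≡p² p ⟩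
      p ℚ.* p          ≤⟨ p²≤q² ⟩
      q ℚ.* q          ∎))
    where
    q<∣p∣ : q ℚ.< ∣ p ∣
    q<∣p∣ = ℚ.≰⇒> ∣p∣≰q

  ∑-mono : ∀ n {f g} → (∀ k → k ℕ.< n → f k ℚ.≤ g k) → ∑ n f ℚ.≤ ∑ n g
  ∑-mono zero    f≤g = ℚ.≤-refl
  ∑-mono (suc n) f≤g = ℚ.+-mono-≤ (∑-mono n λ k k<n → f≤g k (ℕ.m<n⇒m<1+n k<n)) (f≤g n ℕ.≤-refl)

  ∑-nonNeg : ∀ n {f} → (∀ k → 0ℚ ℚ.≤ f k) → 0ℚ ℚ.≤ ∑ n f
  ∑-nonNeg zero    0≤f = ℚ.≤-refl
  ∑-nonNeg (suc n) 0≤f = 0≤+ (∑-nonNeg n 0≤f) (0≤f n)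

  ∏-nonNeg : ∀ n {f} → (∀ k → 0ℚ ℚ.≤ f k) → 0ℚ ℚ.≤ ∏ n f
  ∏-nonNeg zero    0≤f = ℚ.nonNegative⁻¹ 1ℚ
  ∏-nonNeg (suc n) 0≤f = 0≤* (∏-nonNeg n 0≤f) (0≤f n)

  nat : ℕ → ℚ
  nat n = ι (ℤ.+ n)

  nat-suc : ∀ n → nat (suc n) ≡ 1ℚ ℚ.+ nat n
  nat-suc n = ι-+ 1ℤ (ℤ.+ n)

  ∑-const : ∀ n a → ∑ n (λ _ → a) ≡ nat n ℚ.* a
  ∑-const zero    a = sym (ℚ.*-zeroˡ a)
  ∑-const (suc n) a = begin-equality
    ∑ n (λ _ → a) ℚ.+ a     ≡⟨ cong (ℚ._+ a) (∑-const n a) ⟩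
    nat n ℚ.* a ℚ.+ a       ≡⟨ solve 2 (λ n a → n :* a :+ a := (con 1ℚ :+ n) :* a) refl (nat n) a ⟩
    (1ℚ ℚ.+ nat n) ℚ.* a    ≡⟨ cong (ℚ._* a) (nat-suc n) ⟨
    nat (suc n) ℚ.* a       ∎
    where open +-*-Solver

  -- The absolute value of the numerator is a bound, the denominator being at least 1.
  ≤nat : ∀ p → ∃[ n ] p ℚ.≤ nat n
  ≤nat p@record{} = n , ℚ.toℚᵘ-cancel-≤ (ℚᵘ.≤-respʳ-≃ (ℚᵘ.≃-sym (ℚ.toℚᵘ-fromℚᵘ (ℚᵘ.mkℚᵘ (ℤ.+ n) 0)))
      (ℚᵘ.*≤* (ℤ.≤-trans (ℤ.≤-reflexive (ℤ.*-identityʳ (ℚ.↥ p))) (bound (ℚ.↥ p)))))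
    where
    n : ℕ
    n = ℤ.∣ ℚ.↥ p ∣
    bound : ∀ i → i ℤ.≤ ℤ.+ ℤ.∣ i ∣ ℤ.* ℚ.↧ p
    bound (ℤ.+ k)    = ℤ.≤-trans (ℤ.+≤+ (ℕ.m≤m*n k (ℚ.↧ₙ p))) (ℤ.≤-reflexive (ℤ.pos-* k (ℚ.↧ₙ p)))
    bound ℤ.-[1+ k ] = ℤ.-≤+

  record Ratio : Set where
    field
      ratio    : ℚ
      0≤ratio  : 0ℚ ℚ.≤ ratio
      ratio<1  : ratio ℚ.< 1ℚ

  open Ratio

  module _ (T : Ratio) where
    private
      t : ℚ
      t = ratio T
      0≤t : 0ℚ ℚ.≤ t
      0≤t = 0≤ratio T
      t≤1 : t ℚ.≤ 1ℚ
      t≤1 = ℚ.<⇒≤ (ratio<1 T)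

    0≤pow : ∀ n → 0ℚ ℚ.≤ t ^ n
    0≤pow zero    = ℚ.nonNegative⁻¹ 1ℚ
    0≤pow (suc n) = 0≤* 0≤t (0≤pow n)

    pow≤1 : ∀ n → t ^ n ℚ.≤ 1ℚ
    pow≤1 zero    = ℚ.≤-refl
    pow≤1 (suc n) = *-mono-≤ (0≤pow n) (ℚ.nonNegative⁻¹ 1ℚ) t≤1 (pow≤1 n)

    pow-anti : ∀ {m n} → m ℕ.≤ n → t ^ n ℚ.≤ t ^ m
    pow-anti {m} {n} m≤n = begin
      t ^ n                      ≡⟨ cong (t ^_) (ℕ.m+[n∸m]≡n m≤n) ⟨
      t ^ (m ℕ.+ (n ∸ m))        ≡⟨ ^-homo-* t m (n ∸ m) ⟩
      t ^ m ℚ.* t ^ (n ∸ m)      ≤⟨ *-monoˡ-≤ (0≤pow m) (pow≤1 (n ∸ m)) ⟩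
      t ^ m ℚ.* 1ℚ               ≡⟨ ℚ.*-identityʳ _ ⟩
      t ^ m                      ∎

    0<1-t : 0ℚ ℚ.< 1ℚ ℚ.- t
    0<1-t = subst (ℚ._< 1ℚ ℚ.- t) (ℚ.+-inverseʳ t) (ℚ.+-monoˡ-< (ℚ.- t) (ratio<1 T))

    private
      1-t-pos : ℚ.Positive (1ℚ ℚ.- t)
      1-t-pos = positive 0<1-t
      1-t≢0 : ℚ.NonZero (1ℚ ℚ.- t)
      1-t≢0 = ℚ.pos⇒nonZero (1ℚ ℚ.- t) ⦃ 1-t-pos ⦄

    κ : ℚ
    κ = (ℚ.1/ (1ℚ ℚ.- t)) ⦃ 1-t≢0 ⦄

    0≤κ : 0ℚ ℚ.≤ κ
    0≤κ = ℚ.<⇒≤ (ℚ.positive⁻¹ κ ⦃ ℚ.1/pos⇒pos (1ℚ ℚ.- t) ⦃ 1-t-pos ⦄ ⦄)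

    geometric-sum : ∀ n → (1ℚ ℚ.- t) ℚ.* ∑ n (t ^_) ≡ 1ℚ ℚ.- t ^ n
    geometric-sum zero    = ℚ.*-zeroʳ (1ℚ ℚ.- t)
    geometric-sum (suc n) = begin-equality
      (1ℚ ℚ.- t) ℚ.* (∑ n (t ^_) ℚ.+ t ^ n)
        ≡⟨ ℚ.*-distribˡ-+ (1ℚ ℚ.- t) (∑ n (t ^_)) (t ^ n) ⟩
      (1ℚ ℚ.- t) ℚ.* ∑ n (t ^_) ℚ.+ (1ℚ ℚ.- t) ℚ.* t ^ n
        ≡⟨ cong (ℚ._+ (1ℚ ℚ.- t) ℚ.* t ^ n) (geometric-sum n) ⟩
      1ℚ ℚ.- t ^ n ℚ.+ (1ℚ ℚ.- t) ℚ.* t ^ n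
        ≡⟨ solve 2 (λ t u → con 1ℚ :- u :+ (con 1ℚ :- t) :* u := con 1ℚ :- t :* u) refl t (t ^ n) ⟩
      1ℚ ℚ.- t ^ suc n
        ∎
      where open +-*-Solver

    ∑pow≤κ : ∀ n → ∑ n (t ^_) ℚ.≤ κ
    ∑pow≤κ n = begin
      ∑ n (t ^_)                                   ≡⟨ ℚ.*-identityˡ _ ⟨
      1ℚ ℚ.* ∑ n (t ^_)                            ≡⟨ cong (ℚ._* ∑ n (t ^_)) (ℚ.*-inverseˡ (1ℚ ℚ.- t) ⦃ 1-t≢0 ⦄) ⟨
      κ ℚ.* (1ℚ ℚ.- t) ℚ.* ∑ n (t ^_)              ≡⟨ ℚ.*-assoc κ (1ℚ ℚ.- t) (∑ n (t ^_)) ⟩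
      κ ℚ.* ((1ℚ ℚ.- t) ℚ.* ∑ n (t ^_))            ≡⟨ cong (κ ℚ.*_) (geometric-sum n) ⟩
      κ ℚ.* (1ℚ ℚ.- t ^ n)                         ≤⟨ *-monoˡ-≤ 0≤κ (ℚ.+-monoʳ-≤ 1ℚ (ℚ.neg-antimono-≤ (0≤pow n))) ⟩
      κ ℚ.* 1ℚ                                     ≡⟨ ℚ.*-identityʳ κ ⟩
      κ                                            ∎

    -- n copies of t^n lie below 1 + t + ... + t^(n-1). This yields both the convergence of t^n to 0
    -- and the absorption of a factor n into a slightly larger ratio.
    n*pow≤κ : ∀ n → nat n ℚ.* t ^ n ℚ.≤ κ
    n*pow≤κ n = begin
      nat n ℚ.* t ^ n        ≡⟨ ∑-const n (t ^ n) ⟨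
      ∑ n (λ _ → t ^ n)      ≤⟨ ∑-mono n (λ k k<n → pow-anti (ℕ.<⇒≤ k<n)) ⟩
      ∑ n (t ^_)             ≤⟨ ∑pow≤κ n ⟩
      κ                      ∎

    ∑-tail : ∀ m n → ∑ n (λ k → t ^ (m ℕ.+ k)) ℚ.≤ t ^ m ℚ.* κ
    ∑-tail m n = begin
      ∑ n (λ k → t ^ (m ℕ.+ k))        ≡⟨ ∑-cong n (λ k → ^-homo-* t m k) ⟩
      ∑ n (λ k → t ^ m ℚ.* t ^ k)      ≡⟨ *-∑ (t ^ m) n (t ^_) ⟨
      t ^ m ℚ.* ∑ n (t ^_)             ≤⟨ *-monoˡ-≤ (0≤pow m) (∑pow≤κ n) ⟩
      t ^ m ℚ.* κ                      ∎

    -- A natural K ≥ Cκ/ε works: C = (Cκ/ε)(1 - t)ε is at most K(1 - t)ε, and K t^K ≤ κ cancels 1 -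
    -- t.
    eventually-small : ∀ C {ε} → 0ℚ ℚ.≤ C → 0ℚ ℚ.< ε → ∃[ K ] (∀ m → K ℕ.≤ m → C ℚ.* t ^ m ℚ.≤ ε)
    eventually-small C {ε} 0≤C 0<ε = K , λ m K≤m → begin
        C ℚ.* t ^ m                              ≤⟨ *-monoˡ-≤ 0≤C (pow-anti K≤m) ⟩
        C ℚ.* t ^ K                              ≡⟨ cong (ℚ._* t ^ K) C≡ ⟩
        C ℚ.* κ ℚ.* δ ℚ.* ((1ℚ ℚ.- t) ℚ.* ε) ℚ.* t ^ K    ≤⟨ *-monoʳ-≤ (0≤pow K) (*-monoʳ-≤ (ℚ.<⇒≤ (0<* 0<1-t 0<ε)) (proj₂ (≤nat (C ℚ.* κ ℚ.* δ)))) ⟩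
        nat K ℚ.* ((1ℚ ℚ.- t) ℚ.* ε) ℚ.* t ^ K   ≡⟨ solve 4 (λ n u e p → n :* (u :* e) :* p := (u :* e) :* (n :* p)) refl (nat K) (1ℚ ℚ.- t) ε (t ^ K) ⟩
        (1ℚ ℚ.- t) ℚ.* ε ℚ.* (nat K ℚ.* t ^ K)   ≤⟨ *-monoˡ-≤ (ℚ.<⇒≤ (0<* 0<1-t 0<ε)) (n*pow≤κ K) ⟩
        (1ℚ ℚ.- t) ℚ.* ε ℚ.* κ                   ≡⟨ solve 3 (λ u e k → u :* e :* k := (u :* k) :* e) refl (1ℚ ℚ.- t) ε κ ⟩
        (1ℚ ℚ.- t) ℚ.* κ ℚ.* ε                   ≡⟨ cong (ℚ._* ε) (ℚ.*-inverseʳ (1ℚ ℚ.- t) ⦃ 1-t≢0 ⦄) ⟩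
        1ℚ ℚ.* ε                                 ≡⟨ ℚ.*-identityˡ ε ⟩
        ε                                        ∎
      where
      open +-*-Solver
      ε≢0 : ℚ.NonZero ε
      ε≢0 = ℚ.pos⇒nonZero ε ⦃ positive 0<ε ⦄
      δ : ℚ
      δ = (ℚ.1/ ε) ⦃ ε≢0 ⦄
      K : ℕ
      K = proj₁ (≤nat (C ℚ.* κ ℚ.* δ))
      C≡ : C ≡ C ℚ.* κ ℚ.* δ ℚ.* ((1ℚ ℚ.- t) ℚ.* ε)
      C≡ = begin-equality
        C                                                    ≡⟨ ℚ.*-identityʳ C ⟨
        C ℚ.* 1ℚ                                             ≡⟨ cong₂ (λ u v → C ℚ.* (u ℚ.* v)) (ℚ.*-inverseˡ (1ℚ ℚ.- t) ⦃ 1-t≢0 ⦄) (ℚ.*-inverseˡ ε ⦃ ε≢0 ⦄) ⟨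
        C ℚ.* (κ ℚ.* (1ℚ ℚ.- t) ℚ.* (δ ℚ.* ε))               ≡⟨ solve 5 (λ c k u d e → c :* (k :* u :* (d :* e)) := c :* k :* d :* (u :* e)) refl C κ (1ℚ ℚ.- t) δ ε ⟩
        C ℚ.* κ ℚ.* δ ℚ.* ((1ℚ ℚ.- t) ℚ.* ε)                 ∎

    private
      -- In the induction step (1 + b)(1 - S - b) = (1 - S) - (bS + b²), where the subtracted part
      -- is nonnegative. This replaces the usual comparison with the exponential function.
      ∏-bound-half : ∀ m a → (∀ k → 0ℚ ℚ.≤ a k) → ∏ m (λ k → 1ℚ ℚ.+ a k) ℚ.* (1ℚ ℚ.- ∑ m a) ℚ.≤ 1ℚ
      ∏-bound-half zero    a 0≤a = ℚ.≤-refl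
      ∏-bound-half (suc m) a 0≤a = begin
        p ℚ.* (1ℚ ℚ.+ b) ℚ.* (1ℚ ℚ.- (S ℚ.+ b))
          ≡⟨ solve 3 (λ p b s → p :* (con 1ℚ :+ b) :* (con 1ℚ :- (s :+ b)) := p :* (con 1ℚ :- s) :+ (:- (p :* (b :* s :+ b :* b)))) refl p b S ⟩
        p ℚ.* (1ℚ ℚ.- S) ℚ.- p ℚ.* (b ℚ.* S ℚ.+ b ℚ.* b)
          ≤⟨ ℚ.+-mono-≤ (∏-bound-half m a 0≤a)
               (ℚ.neg-antimono-≤ (0≤* (∏-nonNeg m λ k → 0≤+ (ℚ.nonNegative⁻¹ 1ℚ) (0≤a k)) (0≤+ (0≤* (0≤a m) (∑-nonNeg m 0≤a)) (0≤p² b)))) ⟩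
        1ℚ ∎
        where
        open +-*-Solver
        p b S : ℚ
        p = ∏ m (λ k → 1ℚ ℚ.+ a k)
        b = a m
        S = ∑ m a

    -- (1+a₀)⋯(1+aₘ)(1-Σaₖ) ≤ 1, applied to a tail of the sequence with sum at most ½.
    ∏-bounded : ∀ C → 0ℚ ℚ.≤ C → ∃[ B ] (0ℚ ℚ.≤ B × (∀ m → ∏ m (λ k → 1ℚ ℚ.+ C ℚ.* t ^ k) ℚ.≤ B))
    ∏-bounded C 0≤C = H ℚ.* two , 0≤* 0≤H 0≤2 , bound
      where
      two : ℚ
      two = 1ℚ ℚ.+ 1ℚ
      0≤2 : 0ℚ ℚ.≤ two
      0≤2 = ℚ.nonNegative⁻¹ two
      small : ∃[ K ] (∀ m → K ℕ.≤ m → C ℚ.* κ ℚ.* t ^ m ℚ.≤ ½)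
      small = eventually-small (C ℚ.* κ) (0≤* 0≤C 0≤κ) (ℚ.positive⁻¹ ½)
      K : ℕ
      K = proj₁ small
      0≤a : ∀ k → 0ℚ ℚ.≤ C ℚ.* t ^ k
      0≤a k = 0≤* 0≤C (0≤pow k)
      0≤1+a : ∀ k → 0ℚ ℚ.≤ 1ℚ ℚ.+ C ℚ.* t ^ k
      0≤1+a k = 0≤+ (ℚ.nonNegative⁻¹ 1ℚ) (0≤a k)
      H : ℚ
      H = ∏ K (λ k → 1ℚ ℚ.+ C ℚ.* t ^ k)
      0≤H : 0ℚ ℚ.≤ H
      0≤H = ∏-nonNeg K 0≤1+a
      a : ℕ → ℚ
      a k = C ℚ.* t ^ (K ℕ.+ k)
      ∑a≤½ : ∀ m → ∑ m a ℚ.≤ ½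
      ∑a≤½ m = begin
        ∑ m a                                 ≡⟨ *-∑ C m (λ k → t ^ (K ℕ.+ k)) ⟨
        C ℚ.* ∑ m (λ k → t ^ (K ℕ.+ k))       ≤⟨ *-monoˡ-≤ 0≤C (∑-tail K m) ⟩
        C ℚ.* (t ^ K ℚ.* κ)                   ≡⟨ solve 3 (λ c p k → c :* (p :* k) := c :* k :* p) refl C (t ^ K) κ ⟩
        C ℚ.* κ ℚ.* t ^ K                     ≤⟨ proj₂ small K ℕ.≤-refl ⟩
        ½                                     ∎
        where open +-*-Solver
      tail≤2 : ∀ m → ∏ m (λ k → 1ℚ ℚ.+ a k) ℚ.≤ two
      tail≤2 m = begin
        p                             ≡⟨ solve 1 (λ p → p := p :* con ½ :* (con 1ℚ :+ con 1ℚ)) refl p ⟩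
        p ℚ.* ½ ℚ.* two               ≤⟨ *-monoʳ-≤ 0≤2 (*-monoˡ-≤ (∏-nonNeg m λ k → 0≤1+a (K ℕ.+ k)) (ℚ.+-monoʳ-≤ 1ℚ (ℚ.neg-antimono-≤ (∑a≤½ m)))) ⟩
        p ℚ.* (1ℚ ℚ.- ∑ m a) ℚ.* two  ≤⟨ *-monoʳ-≤ 0≤2 (∏-bound-half m a (λ k → 0≤a (K ℕ.+ k))) ⟩
        1ℚ ℚ.* two                    ≡⟨ ℚ.*-identityˡ two ⟩
        two                           ∎
        where
        open +-*-Solver
        p : ℚ
        p = ∏ m (λ k → 1ℚ ℚ.+ a k)
      1≤ : ∀ m f → (∀ k → 0ℚ ℚ.≤ f k) → 1ℚ ℚ.≤ ∏ m (λ k → 1ℚ ℚ.+ f k)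
      1≤ zero    f 0≤f = ℚ.≤-refl
      1≤ (suc m) f 0≤f = *-mono-≤ (ℚ.nonNegative⁻¹ 1ℚ) (∏-nonNeg m λ k → 0≤+ (ℚ.nonNegative⁻¹ 1ℚ) (0≤f k)) (1≤ m f 0≤f) (p≤p+q (0≤f m))
      bound : ∀ m → ∏ m (λ k → 1ℚ ℚ.+ C ℚ.* t ^ k) ℚ.≤ H ℚ.* two
      -- m may be smaller than K, so the product is first lengthened by K factors, each at least 1;
      -- then the initial segment `H` can be split off.
      bound m = begin
        ∏ m f                                            ≡⟨ ℚ.*-identityʳ _ ⟨
        ∏ m f ℚ.* 1ℚ                                     ≤⟨ *-monoˡ-≤ (∏-nonNeg m 0≤1+a) (1≤ K (λ k → C ℚ.* t ^ (m ℕ.+ k)) (λ k → 0≤a (m ℕ.+ k))) ⟩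
        ∏ m f ℚ.* ∏ K (λ k → f (m ℕ.+ k))                ≡⟨ ∏-++ m K f ⟨
        ∏ (m ℕ.+ K) f                                    ≡⟨ cong (λ l → ∏ l f) (ℕ.+-comm m K) ⟩
        ∏ (K ℕ.+ m) f                                    ≡⟨ ∏-++ K m f ⟩
        H ℚ.* ∏ m (λ k → f (K ℕ.+ k))                    ≤⟨ *-monoˡ-≤ 0≤H (tail≤2 m) ⟩
        H ℚ.* two                                        ∎
        where
        f : ℕ → ℚ
        f k = 1ℚ ℚ.+ C ℚ.* t ^ k

  -- The arithmetic mean of 1 and t, which bounds √t by AM-GM.
  midpoint : ∀ T → ∃[ U ] (ratio T ℚ.≤ ratio U ℚ.* ratio U)
  midpoint T = record
    { ratio   = u
    ; 0≤ratio = 0≤* (ℚ.nonNegative⁻¹ ½) (0≤+ (ℚ.nonNegative⁻¹ 1ℚ) (0≤ratio T))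
    ; ratio<1 = ℚ.*-monoʳ-<-pos ½ (ℚ.+-monoʳ-< 1ℚ (ratio<1 T))
    } , (begin
      t                                          ≤⟨ p≤p+q (0≤p² (½ ℚ.* (1ℚ ℚ.- t))) ⟩
      t ℚ.+ ½ ℚ.* (1ℚ ℚ.- t) ℚ.* (½ ℚ.* (1ℚ ℚ.- t))
        ≡⟨ solve 1 (λ t → t :+ con ½ :* (con 1ℚ :- t) :* (con ½ :* (con 1ℚ :- t)) := con ½ :* (con 1ℚ :+ t) :* (con ½ :* (con 1ℚ :+ t))) refl t ⟩
      u ℚ.* u ∎)
    where
    open +-*-Solver
    t u : ℚ
    t = ratio T
    u = ½ ℚ.* (1ℚ ℚ.+ t)

  pow-mono : ∀ {a b} n → 0ℚ ℚ.≤ a → a ℚ.≤ b → a ^ n ℚ.≤ b ^ n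
  pow-mono {a} {b} n 0≤a a≤b = proj₂ (go n)
    where
    go : ∀ n → 0ℚ ℚ.≤ a ^ n × a ^ n ℚ.≤ b ^ n
    go zero    = ℚ.nonNegative⁻¹ 1ℚ , ℚ.≤-refl
    go (suc n) = 0≤* 0≤a (proj₁ (go n)) , *-mono-≤ (proj₁ (go n)) (ℚ.≤-trans 0≤a a≤b) a≤b (proj₂ (go n))

open Rationals

-- Gaussian rationals and diagonal limits

module GaussianRationals where
  open ≡ using (refl; sym; trans; cong; cong₂; subst)

  open Ratio

  infix 5 _⊹_
  record ℚ[i] : Set where
    no-eta-equality; pattern
    constructor _⊹_
    field
      real imag : ℚ

  open ℚ[i]

  infixl 6 _+ᵍ_ _-ᵍ_
  infixl 7 _*ᵍ_

  _+ᵍ_ _-ᵍ_ _*ᵍ_ : ℚ[i] → ℚ[i] → ℚ[i]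
  z +ᵍ w = (real z ℚ.+ real w) ⊹ (imag z ℚ.+ imag w)
  z -ᵍ w = (real z ℚ.- real w) ⊹ (imag z ℚ.- imag w)
  z *ᵍ w = (real z ℚ.* real w ℚ.- imag z ℚ.* imag w) ⊹ (real z ℚ.* imag w ℚ.+ imag z ℚ.* real w)

  negᵍ : ℚ[i] → ℚ[i]
  negᵍ z = (ℚ.- real z) ⊹ (ℚ.- imag z)

  0ᵍ 1ᵍ : ℚ[i]
  0ᵍ = 0ℚ ⊹ 0ℚ
  1ᵍ = 1ℚ ⊹ 0ℚ

  ℚ[i]-semiring : CommutativeSemiring 0ℓ 0ℓ
  ℚ[i]-semiring = record
    { Carrier = ℚ[i]
    ; _≈_ = _≡_
    ; _+_ = _+ᵍ_
    ; _*_ = _*ᵍ_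
    ; 0#  = 0ᵍ
    ; 1#  = 1ᵍ
    ; isCommutativeSemiring = record
      { isSemiring = record
        { isSemiringWithoutAnnihilatingZero = record
          { +-isCommutativeMonoid = record
            { isMonoid = record
              { isSemigroup = record
                { isMagma = record { isEquivalence = ≡.isEquivalence ; ∙-cong = cong₂ _+ᵍ_ }
                ; assoc = λ u v w → cong₂ _⊹_ (ℚ.+-assoc (real u) (real v) (real w)) (ℚ.+-assoc (imag u) (imag v) (imag w))
                }
              ; identity = (λ { (a ⊹ b) → cong₂ _⊹_ (ℚ.+-identityˡ a) (ℚ.+-identityˡ b) })
                         , (λ { (a ⊹ b) → cong₂ _⊹_ (ℚ.+-identityʳ a) (ℚ.+-identityʳ b) })
              }
            ; comm = λ z w → cong₂ _⊹_ (ℚ.+-comm (real z) (real w)) (ℚ.+-comm (imag z) (imag w))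
            }
          ; *-cong = cong₂ _*ᵍ_
          ; *-assoc = assoc
          ; *-identity = identityˡ , (λ z → trans (comm z 1ᵍ) (identityˡ z))
          ; distrib = (λ u v w → trans (comm u (v +ᵍ w)) (trans (distribʳ u v w) (cong₂ _+ᵍ_ (comm v u) (comm w u)))) , distribʳ
          }
        ; zero = zeroˡ , (λ z → trans (comm z 0ᵍ) (zeroˡ z))
        }
      ; *-comm = comm
      }
    }
    where
    open +-*-Solver
    assoc : ∀ u v w → (u *ᵍ v) *ᵍ w ≡ u *ᵍ (v *ᵍ w)
    assoc (a ⊹ b) (c ⊹ d) (e ⊹ f) = cong₂ _⊹_
      (solve 6 (λ a b c d e f → (a :* c :- b :* d) :* e :- (a :* d :+ b :* c) :* f := a :* (c :* e :- d :* f) :- b :* (c :* f :+ d :* e)) refl a b c d e f)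
      (solve 6 (λ a b c d e f → (a :* c :- b :* d) :* f :+ (a :* d :+ b :* c) :* e := a :* (c :* f :+ d :* e) :+ b :* (c :* e :- d :* f)) refl a b c d e f)
    comm : ∀ u v → u *ᵍ v ≡ v *ᵍ u
    comm (a ⊹ b) (c ⊹ d) = cong₂ _⊹_
      (solve 4 (λ a b c d → a :* c :- b :* d := c :* a :- d :* b) refl a b c d)
      (solve 4 (λ a b c d → a :* d :+ b :* c := c :* b :+ d :* a) refl a b c d)
    identityˡ : ∀ z → 1ᵍ *ᵍ z ≡ z
    identityˡ (a ⊹ b) = cong₂ _⊹_
      (solve 2 (λ a b → con 1ℚ :* a :- con 0ℚ :* b := a) refl a b)
      (solve 2 (λ a b → con 1ℚ :* b :+ con 0ℚ :* a := b) refl a b)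
    zeroˡ : ∀ z → 0ᵍ *ᵍ z ≡ 0ᵍ
    zeroˡ (a ⊹ b) = cong₂ _⊹_
      (solve 2 (λ a b → con 0ℚ :* a :- con 0ℚ :* b := con 0ℚ) refl a b)
      (solve 2 (λ a b → con 0ℚ :* b :+ con 0ℚ :* a := con 0ℚ) refl a b)
    distribʳ : ∀ u v w → (v +ᵍ w) *ᵍ u ≡ v *ᵍ u +ᵍ w *ᵍ u
    distribʳ (a ⊹ b) (c ⊹ d) (e ⊹ f) = cong₂ _⊹_
      (solve 6 (λ a b c d e f → (c :+ e) :* a :- (d :+ f) :* b := (c :* a :- d :* b) :+ (e :* a :- f :* b)) refl a b c d e f)
      (solve 6 (λ a b c d e f → (c :+ e) :* b :+ (d :+ f) :* a := (c :* b :+ d :* a) :+ (e :* b :+ f :* a)) refl a b c d e f)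

  module G = CommutativeSemiring ℚ[i]-semiring
  module G∑ = FiniteSums ℚ[i]-semiring
  module Q∑ = FiniteSums ℚ-semiring
  open import Algebra.Properties.CommutativeSemiring.Exp ℚ[i]-semiring using () renaming (_^_ to _^ᵍ_)
  open import Algebra.Properties.CommutativeSemiring.Exp ℚ-semiring using (_^_)

  open ℚ.≤-Reasoning

  emb : ℚ → ℚ[i]
  emb q = q ⊹ 0ℚ

  -- The ℓ¹ norm is rational-valued and submultiplicative, and comparable with the modulus, which
  -- would need a square root.
  ‖_‖ : ℚ[i] → ℚ
  ‖ z ‖ = ∣ real z ∣ ℚ.+ ∣ imag z ∣

  0≤‖_‖ : ∀ z → 0ℚ ℚ.≤ ‖ z ‖
  0≤‖ z ‖ = 0≤+ (ℚ.0≤∣p∣ (real z)) (ℚ.0≤∣p∣ (imag z))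

  ∣real∣≤ : ∀ z → ∣ real z ∣ ℚ.≤ ‖ z ‖
  ∣real∣≤ z = p≤p+q (ℚ.0≤∣p∣ (imag z))

  ∣imag∣≤ : ∀ z → ∣ imag z ∣ ℚ.≤ ‖ z ‖
  ∣imag∣≤ z = p≤q+p (ℚ.0≤∣p∣ (real z))

  private
    +-exchange : ∀ a b c d → (a ℚ.+ b) ℚ.+ (c ℚ.+ d) ≡ (a ℚ.+ c) ℚ.+ (b ℚ.+ d)
    +-exchange = solve 4 (λ a b c d → (a :+ b) :+ (c :+ d) := (a :+ c) :+ (b :+ d)) refl
      where open +-*-Solver

  ‖+‖ : ∀ z w → ‖ z +ᵍ w ‖ ℚ.≤ ‖ z ‖ ℚ.+ ‖ w ‖
  ‖+‖ z w = ℚ.≤-trans (ℚ.+-mono-≤ (ℚ.∣p+q∣≤∣p∣+∣q∣ (real z) (real w)) (ℚ.∣p+q∣≤∣p∣+∣q∣ (imag z) (imag w)))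
    (ℚ.≤-reflexive (+-exchange (∣ real z ∣) (∣ real w ∣) (∣ imag z ∣) (∣ imag w ∣)))

  ‖-‖ : ∀ z w → ‖ z -ᵍ w ‖ ℚ.≤ ‖ z ‖ ℚ.+ ‖ w ‖
  ‖-‖ z w = ℚ.≤-trans (ℚ.+-mono-≤ (ℚ.∣p-q∣≤∣p∣+∣q∣ (real z) (real w)) (ℚ.∣p-q∣≤∣p∣+∣q∣ (imag z) (imag w)))
    (ℚ.≤-reflexive (+-exchange (∣ real z ∣) (∣ real w ∣) (∣ imag z ∣) (∣ imag w ∣)))

  ‖*‖ : ∀ z w → ‖ z *ᵍ w ‖ ℚ.≤ ‖ z ‖ ℚ.* ‖ w ‖
  ‖*‖ (a ⊹ b) (c ⊹ d) = begin
    ∣ a ℚ.* c ℚ.- b ℚ.* d ∣ ℚ.+ ∣ a ℚ.* d ℚ.+ b ℚ.* c ∣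
      ≤⟨ ℚ.+-mono-≤ (ℚ.∣p-q∣≤∣p∣+∣q∣ (a ℚ.* c) (b ℚ.* d)) (ℚ.∣p+q∣≤∣p∣+∣q∣ (a ℚ.* d) (b ℚ.* c)) ⟩
    (∣ a ℚ.* c ∣ ℚ.+ ∣ b ℚ.* d ∣) ℚ.+ (∣ a ℚ.* d ∣ ℚ.+ ∣ b ℚ.* c ∣)
      ≡⟨ cong₂ ℚ._+_ (cong₂ ℚ._+_ (ℚ.∣p*q∣≡∣p∣*∣q∣ a c) (ℚ.∣p*q∣≡∣p∣*∣q∣ b d)) (cong₂ ℚ._+_ (ℚ.∣p*q∣≡∣p∣*∣q∣ a d) (ℚ.∣p*q∣≡∣p∣*∣q∣ b c)) ⟩
    (∣ a ∣ ℚ.* ∣ c ∣ ℚ.+ ∣ b ∣ ℚ.* ∣ d ∣) ℚ.+ (∣ a ∣ ℚ.* ∣ d ∣ ℚ.+ ∣ b ∣ ℚ.* ∣ c ∣)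
      ≡⟨ solve 4 (λ a b c d → (a :* c :+ b :* d) :+ (a :* d :+ b :* c) := (a :+ b) :* (c :+ d)) refl (∣ a ∣) (∣ b ∣) (∣ c ∣) (∣ d ∣) ⟩
    (∣ a ∣ ℚ.+ ∣ b ∣) ℚ.* (∣ c ∣ ℚ.+ ∣ d ∣) ∎
    where open +-*-Solver

  ‖emb‖ : ∀ q → ‖ emb q ‖ ≡ ∣ q ∣
  ‖emb‖ q = ℚ.+-identityʳ ∣ q ∣

  ‖∑‖ : ∀ n f → ‖ G∑.∑ n f ‖ ℚ.≤ Q∑.∑ n (λ k → ‖ f k ‖)
  ‖∑‖ zero    f = ℚ.≤-refl
  ‖∑‖ (suc n) f = ℚ.≤-trans (‖+‖ (G∑.∑ n f) (f n)) (ℚ.+-monoˡ-≤ ‖ f n ‖ (‖∑‖ n f))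

  -ᵍ-split : ∀ a b c → (a -ᵍ b) +ᵍ (b -ᵍ c) ≡ a -ᵍ c
  -ᵍ-split (a ⊹ a′) (b ⊹ b′) (c ⊹ c′) = cong₂ _⊹_ (telescope a b c) (telescope a′ b′ c′)
    where
    open +-*-Solver
    telescope : ∀ a b c → (a ℚ.- b) ℚ.+ (b ℚ.- c) ≡ a ℚ.- c
    telescope = solve 3 (λ a b c → (a :- b) :+ (b :- c) := a :- c) refl

  ‖triangle‖ : ∀ a b c → ‖ a -ᵍ c ‖ ℚ.≤ ‖ a -ᵍ b ‖ ℚ.+ ‖ b -ᵍ c ‖
  ‖triangle‖ a b c = subst (λ z → ‖ z ‖ ℚ.≤ ‖ a -ᵍ b ‖ ℚ.+ ‖ b -ᵍ c ‖) (-ᵍ-split a b c) (‖+‖ (a -ᵍ b) (b -ᵍ c))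

  ‖-‖-sym : ∀ a b → ‖ a -ᵍ b ‖ ≡ ‖ b -ᵍ a ‖
  ‖-‖-sym (a ⊹ a′) (b ⊹ b′) = cong₂ ℚ._+_ (flip a b) (flip a′ b′)
    where
    open +-*-Solver
    flip : ∀ a b → ∣ a ℚ.- b ∣ ≡ ∣ b ℚ.- a ∣
    flip a b = trans (cong ∣_∣ (solve 2 (λ a b → a :- b := :- (b :- a)) refl a b)) (ℚ.∣-p∣≡∣p∣ (b ℚ.- a))

  ‖self-‖ : ∀ a → ‖ a -ᵍ a ‖ ≡ 0ℚ
  ‖self-‖ (a ⊹ b) = trans (cong₂ ℚ._+_ (∣p-p∣≡0 a) (∣p-p∣≡0 b)) (ℚ.+-identityˡ 0ℚ)
    where
    ∣p-p∣≡0 : ∀ p → ∣ p ℚ.- p ∣ ≡ 0ℚ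
    ∣p-p∣≡0 p = trans (cong ∣_∣ (ℚ.+-inverseʳ p)) refl

  abs² : ℚ[i] → ℚ
  abs² z = real z ℚ.* real z ℚ.+ imag z ℚ.* imag z

  abs²≤‖‖² : ∀ z → abs² z ℚ.≤ ‖ z ‖ ℚ.* ‖ z ‖
  abs²≤‖‖² (a ⊹ b) = begin
    a ℚ.* a ℚ.+ b ℚ.* b
      ≡⟨ cong₂ ℚ._+_ (∣p∣²≡p² a) (∣p∣²≡p² b) ⟨
    ∣ a ∣ ℚ.* ∣ a ∣ ℚ.+ ∣ b ∣ ℚ.* ∣ b ∣
      ≤⟨ p≤p+q (0≤+ (0≤* (ℚ.0≤∣p∣ a) (ℚ.0≤∣p∣ b)) (0≤* (ℚ.0≤∣p∣ a) (ℚ.0≤∣p∣ b))) ⟩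
    ∣ a ∣ ℚ.* ∣ a ∣ ℚ.+ ∣ b ∣ ℚ.* ∣ b ∣ ℚ.+ (∣ a ∣ ℚ.* ∣ b ∣ ℚ.+ ∣ a ∣ ℚ.* ∣ b ∣)
      ≡⟨ solve 2 (λ a b → a :* a :+ b :* b :+ (a :* b :+ a :* b) := (a :+ b) :* (a :+ b)) refl (∣ a ∣) (∣ b ∣) ⟩
    (∣ a ∣ ℚ.+ ∣ b ∣) ℚ.* (∣ a ∣ ℚ.+ ∣ b ∣) ∎
    where open +-*-Solver

  2ℚ : ℚ
  2ℚ = 1ℚ ℚ.+ 1ℚ

  0≤2 : 0ℚ ℚ.≤ 2ℚ
  0≤2 = ℚ.nonNegative⁻¹ 2ℚ

  -- Submultiplicativity alone would give a power of `‖ z ‖`, which can exceed 1 inside the unit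
  -- disk. The multiplicative `abs²` is therefore carried through the power, and the passage to the
  -- ℓ¹ norm at the end costs the factor 2 only once.
  ‖^‖ : ∀ {z r} k → 0ℚ ℚ.≤ r → abs² z ℚ.≤ r ℚ.* r → ‖ z ^ᵍ k ‖ ℚ.≤ 2ℚ ℚ.* r ^ k
  ‖^‖ {z} {r} k 0≤r z≤r = begin
    ∣ real (z ^ᵍ k) ∣ ℚ.+ ∣ imag (z ^ᵍ k) ∣
      ≤⟨ ℚ.+-mono-≤ (p²≤q²⇒∣p∣≤q {real (z ^ᵍ k)} (0≤r^ k) (ℚ.≤-trans (p≤p+q (0≤p² (imag (z ^ᵍ k)))) (abs²-^ k)))
                    (p²≤q²⇒∣p∣≤q {imag (z ^ᵍ k)} (0≤r^ k) (ℚ.≤-trans (p≤q+p (0≤p² (real (z ^ᵍ k)))) (abs²-^ k))) ⟩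
    r ^ k ℚ.+ r ^ k
      ≡⟨ solve 1 (λ r → r :+ r := (con 1ℚ :+ con 1ℚ) :* r) refl (r ^ k) ⟩
    2ℚ ℚ.* r ^ k ∎
    where
    open +-*-Solver
    0≤r^ : ∀ k → 0ℚ ℚ.≤ r ^ k
    0≤r^ zero    = ℚ.nonNegative⁻¹ 1ℚ
    0≤r^ (suc k) = 0≤* 0≤r (0≤r^ k)
    abs²-* : ∀ z w → abs² (z *ᵍ w) ≡ abs² z ℚ.* abs² w
    abs²-* (a ⊹ b) (c ⊹ d) = solve 4 (λ a b c d → (a :* c :- b :* d) :* (a :* c :- b :* d) :+ (a :* d :+ b :* c) :* (a :* d :+ b :* c)
      := (a :* a :+ b :* b) :* (c :* c :+ d :* d)) refl a b c d
    abs²-^ : ∀ k → abs² (z ^ᵍ k) ℚ.≤ r ^ k ℚ.* r ^ k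
    abs²-^ zero    = ℚ.≤-refl
    abs²-^ (suc k) = begin
      abs² (z *ᵍ z ^ᵍ k)                     ≡⟨ abs²-* z (z ^ᵍ k) ⟩
      abs² z ℚ.* abs² (z ^ᵍ k)               ≤⟨ *-mono-≤ (0≤+ (0≤p² (real (z ^ᵍ k))) (0≤p² (imag (z ^ᵍ k)))) (0≤* 0≤r 0≤r) z≤r (abs²-^ k) ⟩
      r ℚ.* r ℚ.* (r ^ k ℚ.* r ^ k)          ≡⟨ solve 2 (λ r p → r :* r :* (p :* p) := r :* p :* (r :* p)) refl r (r ^ k) ⟩
      r ℚ.* r ^ k ℚ.* (r ℚ.* r ^ k)          ∎

  infix 10 _at_
  _at_ : ℂ → ℕ → ℚ[i]
  z at n = seq (re z) n ⊹ seq (im z) n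

  private
    ¼ : ℚ
    ¼ = ½ ℚ.* ½

  -- The limit of z is the diagonal sequence n ↦ z n at n.
  module DiagonalLimit (z : ℕ → ℂ) (N₀ : ℕ) (T : Ratio) (C : ℚ) (0≤C : 0ℚ ℚ.≤ C)
    (increment : ∀ m n → N₀ ℕ.≤ n → ‖ z (suc m) at n -ᵍ z m at n ‖ ℚ.≤ C ℚ.* ratio T ^ m) where

    private
      t : ℚ
      t = ratio T
      D : ℚ
      D = C ℚ.* κ T
      0≤D : 0ℚ ℚ.≤ D
      0≤D = 0≤* 0≤C (0≤κ T)

      partial : ∀ m k n → N₀ ℕ.≤ n → ‖ z (m ℕ.+ k) at n -ᵍ z m at n ‖ ℚ.≤ C ℚ.* Q∑.∑ k (λ i → t ^ (m ℕ.+ i))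
      partial m zero n N₀≤n = ℚ.≤-reflexive (trans (cong (λ l → ‖ z l at n -ᵍ z m at n ‖) (ℕ.+-identityʳ m))
        (trans (‖self-‖ (z m at n)) (sym (ℚ.*-zeroʳ C))))
      partial m (suc k) n N₀≤n = begin
        ‖ z (m ℕ.+ suc k) at n -ᵍ z m at n ‖
          ≡⟨ cong (λ l → ‖ z l at n -ᵍ z m at n ‖) (ℕ.+-suc m k) ⟩
        ‖ z (suc (m ℕ.+ k)) at n -ᵍ z m at n ‖
          ≤⟨ ‖triangle‖ (z (suc (m ℕ.+ k)) at n) (z (m ℕ.+ k) at n) (z m at n) ⟩
        ‖ z (suc (m ℕ.+ k)) at n -ᵍ z (m ℕ.+ k) at n ‖ ℚ.+ ‖ z (m ℕ.+ k) at n -ᵍ z m at n ‖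
          ≤⟨ ℚ.+-mono-≤ (increment (m ℕ.+ k) n N₀≤n) (partial m k n N₀≤n) ⟩
        C ℚ.* t ^ (m ℕ.+ k) ℚ.+ C ℚ.* S
          ≡⟨ solve 3 (λ c a s → c :* a :+ c :* s := c :* (s :+ a)) refl C (t ^ (m ℕ.+ k)) S ⟩
        C ℚ.* (S ℚ.+ t ^ (m ℕ.+ k)) ∎
        where
        open +-*-Solver
        S : ℚ
        S = Q∑.∑ k (λ i → t ^ (m ℕ.+ i))

      near-diagonal : ∀ {m l n} → m ℕ.≤ l → N₀ ℕ.≤ n → ‖ z l at n -ᵍ z m at n ‖ ℚ.≤ D ℚ.* t ^ m
      near-diagonal {m} {l} {n} m≤l N₀≤n = begin
        ‖ z l at n -ᵍ z m at n ‖                        ≡⟨ cong (λ l → ‖ z l at n -ᵍ z m at n ‖) (ℕ.m+[n∸m]≡n m≤l) ⟨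
        ‖ z (m ℕ.+ (l ∸ m)) at n -ᵍ z m at n ‖          ≤⟨ partial m (l ∸ m) n N₀≤n ⟩
        C ℚ.* Q∑.∑ (l ∸ m) (λ i → t ^ (m ℕ.+ i))        ≤⟨ *-monoˡ-≤ 0≤C (∑-tail T m (l ∸ m)) ⟩
        C ℚ.* (t ^ m ℚ.* κ T)                           ≡⟨ solve 3 (λ c a k → c :* (a :* k) := c :* k :* a) refl C (t ^ m) (κ T) ⟩
        D ℚ.* t ^ m                                     ∎
        where open +-*-Solver

      diagonal : ℕ → ℚ[i]
      diagonal n = z n at n

      ¼-pos : ∀ {ε} → 0ℚ ℚ.< ε → 0ℚ ℚ.< ¼ ℚ.* ε
      ¼-pos = 0<* (ℚ.positive⁻¹ ¼)

      -- The comparison passes through one fixed member `z K`. Its distance to `z m` and `z n` is a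
      -- geometric tail, uniform in the approximation; its own entries at m and n are close because
      -- it is a complex number. Real and imaginary parts count separately, whence the quarters of
      -- ε.
      diagonal-cauchy : ∀ ε → 0ℚ ℚ.< ε → ∃[ N ] (∀ m n → N ℕ.≤ m → N ℕ.≤ n → ‖ diagonal m -ᵍ diagonal n ‖ ℚ.< ε)
      diagonal-cauchy ε 0<ε = N , λ m n N≤m N≤n → begin-strict
          ‖ z m at m -ᵍ z n at n ‖
            ≤⟨ ‖triangle‖ (z m at m) (z K at m) (z n at n) ⟩
          ‖ z m at m -ᵍ z K at m ‖ ℚ.+ ‖ z K at m -ᵍ z n at n ‖
            ≤⟨ ℚ.+-monoʳ-≤ ‖ z m at m -ᵍ z K at m ‖ (‖triangle‖ (z K at m) (z K at n) (z n at n)) ⟩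
          ‖ z m at m -ᵍ z K at m ‖ ℚ.+ (‖ z K at m -ᵍ z K at n ‖ ℚ.+ ‖ z K at n -ᵍ z n at n ‖)
            <⟨ ℚ.+-mono-≤-< (near m N≤m) (ℚ.+-mono-<-≤
                 (ℚ.+-mono-< (proj₂ R m n (R≤ N≤m) (R≤ N≤n)) (proj₂ J m n (J≤ N≤m) (J≤ N≤n)))
                 (ℚ.≤-trans (ℚ.≤-reflexive (‖-‖-sym (z K at n) (z n at n))) (near n N≤n))) ⟩
          δ ℚ.+ ((δ ℚ.+ δ) ℚ.+ δ)
            ≡⟨ solve 1 (λ e → let d = con ¼ :* e in d :+ ((d :+ d) :+ d) := e) refl ε ⟩
          ε ∎
        where
        open +-*-Solver
        δ : ℚ
        δ = ¼ ℚ.* ε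
        0<δ : 0ℚ ℚ.< δ
        0<δ = ¼-pos 0<ε
        small : ∃[ K ] (∀ m → K ℕ.≤ m → D ℚ.* t ^ m ℚ.≤ δ)
        small = eventually-small T D 0≤D 0<δ
        K : ℕ
        K = proj₁ small
        R : ∃[ N ] (∀ m n → N ℕ.≤ m → N ℕ.≤ n → ∣ seq (re (z K)) m ℚ.- seq (re (z K)) n ∣ ℚ.< δ)
        R = cauchy (re (z K)) δ 0<δ
        J : ∃[ N ] (∀ m n → N ℕ.≤ m → N ℕ.≤ n → ∣ seq (im (z K)) m ℚ.- seq (im (z K)) n ∣ ℚ.< δ)
        J = cauchy (im (z K)) δ 0<δ
        N : ℕ
        N = (K ℕ.⊔ N₀) ℕ.⊔ (proj₁ R ℕ.⊔ proj₁ J)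
        R≤ : ∀ {n} → N ℕ.≤ n → proj₁ R ℕ.≤ n
        R≤ N≤n = ℕ.m⊔n≤o⇒m≤o (proj₁ R) (proj₁ J) (ℕ.m⊔n≤o⇒n≤o (K ℕ.⊔ N₀) _ N≤n)
        J≤ : ∀ {n} → N ℕ.≤ n → proj₁ J ℕ.≤ n
        J≤ N≤n = ℕ.m⊔n≤o⇒n≤o (proj₁ R) (proj₁ J) (ℕ.m⊔n≤o⇒n≤o (K ℕ.⊔ N₀) _ N≤n)
        near : ∀ n → N ℕ.≤ n → ‖ z n at n -ᵍ z K at n ‖ ℚ.≤ δ
        near n N≤n = ℚ.≤-trans (near-diagonal (ℕ.m⊔n≤o⇒m≤o K N₀ KN₀≤n) (ℕ.m⊔n≤o⇒n≤o K N₀ KN₀≤n)) (proj₂ small K ℕ.≤-refl)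
          where
          KN₀≤n : K ℕ.⊔ N₀ ℕ.≤ n
          KN₀≤n = ℕ.m⊔n≤o⇒m≤o (K ℕ.⊔ N₀) _ N≤n

      re-cauchy : IsCauchy (λ n → real (diagonal n))
      re-cauchy ε 0<ε = proj₁ (diagonal-cauchy ε 0<ε) , λ m n p q →
        ℚ.≤-<-trans (∣real∣≤ (diagonal m -ᵍ diagonal n)) (proj₂ (diagonal-cauchy ε 0<ε) m n p q)

      im-cauchy : IsCauchy (λ n → imag (diagonal n))
      im-cauchy ε 0<ε = proj₁ (diagonal-cauchy ε 0<ε) , λ m n p q →
        ℚ.≤-<-trans (∣imag∣≤ (diagonal m -ᵍ diagonal n)) (proj₂ (diagonal-cauchy ε 0<ε) m n p q)

    limit : ℂ
    limit = mkℝ (λ n → real (z n at n)) re-cauchy +i mkℝ (λ n → imag (z n at n)) im-cauchy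

    converges : z ⟶ limit
    -- The strict inequality of reals asks for a positive gap. With δ = ε/2 the squared distance is
    -- at most δ², the gap is δ², and 2δ² ≤ 4δ² = ε².
    converges ε 0<ε = proj₁ small , λ m K≤m → δ ℚ.* δ , 0<* 0<δ 0<δ , m ℕ.⊔ N₀ , λ k p → begin
        abs² (z m at k -ᵍ z k at k) ℚ.+ δ ℚ.* δ
          ≤⟨ ℚ.+-monoˡ-≤ (δ ℚ.* δ) (ℚ.≤-trans (abs²≤‖‖² (z m at k -ᵍ z k at k))
               (*-mono-≤ (0≤‖ z m at k -ᵍ z k at k ‖) (ℚ.<⇒≤ 0<δ) (close m k K≤m p) (close m k K≤m p))) ⟩
        δ ℚ.* δ ℚ.+ δ ℚ.* δ
          ≤⟨ p≤p+q (0≤+ (0≤p² δ) (0≤p² δ)) ⟩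
        δ ℚ.* δ ℚ.+ δ ℚ.* δ ℚ.+ (δ ℚ.* δ ℚ.+ δ ℚ.* δ)
          ≡⟨ solve 1 (λ e → let d = con ½ :* e in d :* d :+ d :* d :+ (d :* d :+ d :* d) := e :* e) refl ε ⟩
        ε ℚ.* ε ∎
      where
      open +-*-Solver
      δ : ℚ
      δ = ½ ℚ.* ε
      0<δ : 0ℚ ℚ.< δ
      0<δ = 0<* (ℚ.positive⁻¹ ½) 0<ε
      small : ∃[ K ] (∀ m → K ℕ.≤ m → D ℚ.* t ^ m ℚ.≤ δ)
      small = eventually-small T D 0≤D 0<δ
      close : ∀ m k → proj₁ small ℕ.≤ m → m ℕ.⊔ N₀ ℕ.≤ k → ‖ z m at k -ᵍ z k at k ‖ ℚ.≤ δ
      close m k K≤m p = ℚ.≤-trans (ℚ.≤-reflexive (‖-‖-sym (z m at k) (z k at k)))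
        (ℚ.≤-trans (near-diagonal (ℕ.m⊔n≤o⇒m≤o m N₀ p) (ℕ.m⊔n≤o⇒n≤o m N₀ p)) (proj₂ small m K≤m))

  ≃-geometric : ∀ {z w} N₀ T C → 0ℚ ℚ.≤ C → (∀ n → N₀ ℕ.≤ n → ‖ z at n -ᵍ w at n ‖ ℚ.≤ C ℚ.* ratio T ^ n) → z ≃ w
  ≃-geometric {z} {w} N₀ T C 0≤C close =
      (λ ε 0<ε → N ε 0<ε , λ n p → ℚ.≤-<-trans (∣real∣≤ (z at n -ᵍ w at n)) (below ε 0<ε n p))
    , (λ ε 0<ε → N ε 0<ε , λ n p → ℚ.≤-<-trans (∣imag∣≤ (z at n -ᵍ w at n)) (below ε 0<ε n p))
    where
    small : ∀ ε → 0ℚ ℚ.< ε → ∃[ K ] (∀ m → K ℕ.≤ m → C ℚ.* ratio T ^ m ℚ.≤ ½ ℚ.* ε)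
    small ε 0<ε = eventually-small T C 0≤C (0<* (ℚ.positive⁻¹ ½) 0<ε)
    N : ∀ ε → 0ℚ ℚ.< ε → ℕ
    N ε 0<ε = proj₁ (small ε 0<ε) ℕ.⊔ N₀
    below : ∀ ε 0<ε n → N ε 0<ε ℕ.≤ n → ‖ z at n -ᵍ w at n ‖ ℚ.< ε
    below ε 0<ε n p = begin-strict
      ‖ z at n -ᵍ w at n ‖   ≤⟨ close n (ℕ.m⊔n≤o⇒n≤o _ N₀ p) ⟩
      C ℚ.* ratio T ^ n      ≤⟨ proj₂ (small ε 0<ε) n (ℕ.m⊔n≤o⇒m≤o _ N₀ p) ⟩
      ½ ℚ.* ε                <⟨ ℚ.*-monoˡ-<-pos ε ⦃ positive 0<ε ⦄ {½} {1ℚ} (ℚ.*<* (ℤ.+<+ (s≤s (s≤s z≤n)))) ⟩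
      1ℚ ℚ.* ε               ≡⟨ ℚ.*-identityˡ ε ⟩
      ε                      ∎

open GaussianRationals

-- Power series modulo x^N and their components mod 3

module Series where
  open ≡ using (refl; sym; trans; cong; cong₂; subst)

  open FiniteSums ℤ.+-*-commutativeSemiring
  open ≡-Reasoning

  sumℤ≡∑ : ∀ f n → sumℤ f n ≡ ∑ n f
  sumℤ≡∑ f zero    = refl
  sumℤ≡∑ f (suc n) = cong (ℤ._+ f n) (sumℤ≡∑ f n)

  ·-coefficient : ∀ f g j → (f · g) j ≡ ∑ (suc j) (λ i → f i ℤ.* g (j ∸ i))
  ·-coefficient f g j = sumℤ≡∑ (λ i → f i ℤ.* g (j ∸ i)) (suc j)

  infixl 6 _⊕_
  _⊕_ : PowerSeries → PowerSeries → PowerSeries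
  (f ⊕ g) j = f j ℤ.+ g j

  tail : PowerSeries → PowerSeries
  tail f j = f (suc j)

  const : ℤ → PowerSeries
  const a zero    = a
  const a (suc j) = 0ℤ

  X : PowerSeries
  X zero    = 0ℤ
  X (suc j) = one j

  ·-zero : ∀ f g → (f · g) 0 ≡ f 0 ℤ.* g 0
  ·-zero f g = ℤ.+-identityˡ _

  -- From f = f₀ + x · tail f. This recursion and its mirror image `·-suc′` allow commutativity and
  -- associativity to be proved by induction on the degree.
  ·-suc : ∀ f g j → (f · g) (suc j) ≡ f 0 ℤ.* g (suc j) ℤ.+ (tail f · g) j
  ·-suc f g j = begin
    (f · g) (suc j)
      ≡⟨ ·-coefficient f g (suc j) ⟩
    ∑ (suc (suc j)) (λ i → f i ℤ.* g (suc j ∸ i))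
      ≡⟨ ∑-front (suc j) (λ i → f i ℤ.* g (suc j ∸ i)) ⟩
    f 0 ℤ.* g (suc j) ℤ.+ ∑ (suc j) (λ i → f (suc i) ℤ.* g (j ∸ i))
      ≡⟨ cong (ℤ._+_ (f 0 ℤ.* g (suc j))) (·-coefficient (tail f) g j) ⟨
    f 0 ℤ.* g (suc j) ℤ.+ (tail f · g) j
      ∎

  ·-cong< : ∀ {f f′ g g′} j → (∀ i → i ℕ.≤ j → f i ≡ f′ i) → (∀ i → i ℕ.≤ j → g i ≡ g′ i) → (f · g) j ≡ (f′ · g′) j
  ·-cong< {f} {f′} {g} {g′} j f≡ g≡ = begin
    (f · g) j                                ≡⟨ ·-coefficient f g j ⟩
    ∑ (suc j) (λ i → f i ℤ.* g (j ∸ i))      ≡⟨ ∑-cong< (suc j) (λ { i (s≤s i≤j) → cong₂ ℤ._*_ (f≡ i i≤j) (g≡ (j ∸ i) (ℕ.m∸n≤m j i)) }) ⟩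
    ∑ (suc j) (λ i → f′ i ℤ.* g′ (j ∸ i))    ≡⟨ ·-coefficient f′ g′ j ⟨
    (f′ · g′) j                              ∎

  ·-cong : ∀ {f f′ g g′} → (∀ i → f i ≡ f′ i) → (∀ i → g i ≡ g′ i) → ∀ j → (f · g) j ≡ (f′ · g′) j
  ·-cong f≡ g≡ j = ·-cong< j (λ i _ → f≡ i) (λ i _ → g≡ i)

  ·-suc′ : ∀ f g j → (f · g) (suc j) ≡ f (suc j) ℤ.* g 0 ℤ.+ (f · tail g) j
  ·-suc′ f g j = begin
    (f · g) (suc j)
      ≡⟨ ·-coefficient f g (suc j) ⟩
    ∑ (suc j) (λ i → f i ℤ.* g (suc j ∸ i)) ℤ.+ f (suc j) ℤ.* g (j ∸ j)
      ≡⟨ cong₂ ℤ._+_ (∑-cong< (suc j) λ { i (s≤s i≤j) → cong (λ l → f i ℤ.* g l) (ℕ.+-∸-assoc 1 i≤j) })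
                     (cong (λ l → f (suc j) ℤ.* g l) (ℕ.n∸n≡0 j)) ⟩
    ∑ (suc j) (λ i → f i ℤ.* g (suc (j ∸ i))) ℤ.+ f (suc j) ℤ.* g 0
      ≡⟨ cong (ℤ._+ f (suc j) ℤ.* g 0) (·-coefficient f (tail g) j) ⟨
    (f · tail g) j ℤ.+ f (suc j) ℤ.* g 0
      ≡⟨ ℤ.+-comm ((f · tail g) j) _ ⟩
    f (suc j) ℤ.* g 0 ℤ.+ (f · tail g) j
      ∎

  ·-comm : ∀ f g j → (f · g) j ≡ (g · f) j
  ·-comm f g zero    = trans (·-zero f g) (trans (ℤ.*-comm (f 0) (g 0)) (sym (·-zero g f)))
  ·-comm f g (suc j) = begin
    (f · g) (suc j)                         ≡⟨ ·-suc f g j ⟩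
    f 0 ℤ.* g (suc j) ℤ.+ (tail f · g) j    ≡⟨ cong₂ ℤ._+_ (ℤ.*-comm (f 0) (g (suc j))) (·-comm (tail f) g j) ⟩
    g (suc j) ℤ.* f 0 ℤ.+ (g · tail f) j    ≡⟨ ·-suc′ g f j ⟨
    (g · f) (suc j)                         ∎

  ·-distribʳ : ∀ h f g j → ((f ⊕ g) · h) j ≡ (f · h) j ℤ.+ (g · h) j
  ·-distribʳ h f g j = begin
    ((f ⊕ g) · h) j
      ≡⟨ ·-coefficient (f ⊕ g) h j ⟩
    ∑ (suc j) (λ i → (f i ℤ.+ g i) ℤ.* h (j ∸ i))
      ≡⟨ ∑-cong (suc j) (λ i → ℤ.*-distribʳ-+ (h (j ∸ i)) (f i) (g i)) ⟩
    ∑ (suc j) (λ i → f i ℤ.* h (j ∸ i) ℤ.+ g i ℤ.* h (j ∸ i))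
      ≡⟨ ∑-+ (suc j) _ _ ⟩
    ∑ (suc j) (λ i → f i ℤ.* h (j ∸ i)) ℤ.+ ∑ (suc j) (λ i → g i ℤ.* h (j ∸ i))
      ≡⟨ cong₂ ℤ._+_ (·-coefficient f h j) (·-coefficient g h j) ⟨
    (f · h) j ℤ.+ (g · h) j
      ∎

  ·-zeroˡ : ∀ {f} g → (∀ i → f i ≡ 0ℤ) → ∀ j → (f · g) j ≡ 0ℤ
  ·-zeroˡ {f} g f≡0 j = trans (·-coefficient f g j) (∑-zero (suc j) λ i → cong (ℤ._* g (j ∸ i)) (f≡0 i))

  const-· : ∀ a f j → (const a · f) j ≡ a ℤ.* f j
  const-· a f zero    = ·-zero (const a) f
  const-· a f (suc j) = trans (·-suc (const a) f j)
    (trans (cong (ℤ._+_ (a ℤ.* f (suc j))) (·-zeroˡ f (λ _ → refl) j)) (ℤ.+-identityʳ _))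

  *-·-assoc : ∀ a f g j → ((λ i → a ℤ.* f i) · g) j ≡ a ℤ.* (f · g) j
  *-·-assoc a f g j = begin
    ((λ i → a ℤ.* f i) · g) j                        ≡⟨ ·-coefficient (λ i → a ℤ.* f i) g j ⟩
    ∑ (suc j) (λ i → a ℤ.* f i ℤ.* g (j ∸ i))        ≡⟨ ∑-cong (suc j) (λ i → ℤ.*-assoc a (f i) (g (j ∸ i))) ⟩
    ∑ (suc j) (λ i → a ℤ.* (f i ℤ.* g (j ∸ i)))      ≡⟨ *-∑ a (suc j) _ ⟨
    a ℤ.* ∑ (suc j) (λ i → f i ℤ.* g (j ∸ i))        ≡⟨ cong (ℤ._*_ a) (·-coefficient f g j) ⟨
    a ℤ.* (f · g) j                                  ∎

  ·-assoc : ∀ f g h j → ((f · g) · h) j ≡ (f · (g · h)) j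
  ·-assoc f g h zero = begin
    ((f · g) · h) 0              ≡⟨ trans (·-zero (f · g) h) (cong (ℤ._* h 0) (·-zero f g)) ⟩
    f 0 ℤ.* g 0 ℤ.* h 0          ≡⟨ ℤ.*-assoc (f 0) (g 0) (h 0) ⟩
    f 0 ℤ.* (g 0 ℤ.* h 0)        ≡⟨ trans (·-zero f (g · h)) (cong (ℤ._*_ (f 0)) (·-zero g h)) ⟨
    (f · (g · h)) 0              ∎
  ·-assoc f g h (suc j) = begin
    ((f · g) · h) (suc j)
      ≡⟨ ·-suc (f · g) h j ⟩
    (f · g) 0 ℤ.* h (suc j) ℤ.+ (tail (f · g) · h) j
      ≡⟨ cong₂ ℤ._+_ (cong (ℤ._* h (suc j)) (·-zero f g)) (·-cong {tail (f · g)} {(λ i → f 0 ℤ.* tail g i) ⊕ (tail f · g)} {h} (·-suc f g) (λ _ → refl) j) ⟩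
    f 0 ℤ.* g 0 ℤ.* h (suc j) ℤ.+ (((λ i → f 0 ℤ.* tail g i) ⊕ (tail f · g)) · h) j
      ≡⟨ cong (ℤ._+_ (f 0 ℤ.* g 0 ℤ.* h (suc j))) (·-distribʳ h (λ i → f 0 ℤ.* tail g i) (tail f · g) j) ⟩
    f 0 ℤ.* g 0 ℤ.* h (suc j) ℤ.+ (((λ i → f 0 ℤ.* tail g i) · h) j ℤ.+ ((tail f · g) · h) j)
      ≡⟨ cong₂ (λ u v → f 0 ℤ.* g 0 ℤ.* h (suc j) ℤ.+ (u ℤ.+ v)) (*-·-assoc (f 0) (tail g) h j) (·-assoc (tail f) g h j) ⟩
    f 0 ℤ.* g 0 ℤ.* h (suc j) ℤ.+ (f 0 ℤ.* (tail g · h) j ℤ.+ (tail f · (g · h)) j)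
      ≡⟨ factor (f 0) (g 0) (h (suc j)) ((tail g · h) j) ((tail f · (g · h)) j) ⟩
    f 0 ℤ.* (g 0 ℤ.* h (suc j) ℤ.+ (tail g · h) j) ℤ.+ (tail f · (g · h)) j
      ≡⟨ cong (λ u → f 0 ℤ.* u ℤ.+ (tail f · (g · h)) j) (·-suc g h j) ⟨
    f 0 ℤ.* (g · h) (suc j) ℤ.+ (tail f · (g · h)) j
      ≡⟨ ·-suc f (g · h) j ⟨
    (f · (g · h)) (suc j)
      ∎
    where
    factor : ∀ a b c d e → a ℤ.* b ℤ.* c ℤ.+ (a ℤ.* d ℤ.+ e) ≡ a ℤ.* (b ℤ.* c ℤ.+ d) ℤ.+ e
    factor = solve 5 (λ a b c d e → a :* b :* c :+ (a :* d :+ e) := a :* (b :* c :+ d) :+ e) refl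
      where open ℤ-Solver.+-*-Solver

  one-· : ∀ f j → (one · f) j ≡ f j
  one-· f j = trans (·-cong {one} {const 1ℤ} {f} one≡const (λ _ → refl) j) (trans (const-· 1ℤ f j) (ℤ.*-identityˡ (f j)))
    where
    one≡const : ∀ i → one i ≡ const 1ℤ i
    one≡const zero    = refl
    one≡const (suc i) = refl

  X-·-zero : ∀ f → (X · f) 0 ≡ 0ℤ
  X-·-zero f = ·-zero X f

  X-·-suc : ∀ f j → (X · f) (suc j) ≡ f j
  X-·-suc f j = trans (·-suc X f j) (trans (ℤ.+-identityˡ _) (one-· f j))

  abstract

    -- Opaque, so that products of series are compared without unfolding the convolution.
    infixl 7 _⊛_
    _⊛_ : PowerSeries → PowerSeries → PowerSeries
    _⊛_ = _·_

    ⊛≡· : ∀ f g → f ⊛ g ≡ f · g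
    ⊛≡· f g = refl

    ⊛-coefficient : ∀ f g j → (f ⊛ g) j ≡ ∑ (suc j) (λ i → f i ℤ.* g (j ∸ i))
    ⊛-coefficient = ·-coefficient

    ⊛-cong< : ∀ {f f′ g g′} j → (∀ i → i ℕ.≤ j → f i ≡ f′ i) → (∀ i → i ℕ.≤ j → g i ≡ g′ i) → (f ⊛ g) j ≡ (f′ ⊛ g′) j
    ⊛-cong< = ·-cong<

    ⊛-comm : ∀ f g j → (f ⊛ g) j ≡ (g ⊛ f) j
    ⊛-comm = ·-comm

    ⊛-assoc : ∀ f g h j → ((f ⊛ g) ⊛ h) j ≡ (f ⊛ (g ⊛ h)) j
    ⊛-assoc = ·-assoc

    ⊛-distribʳ : ∀ h f g j → ((f ⊕ g) ⊛ h) j ≡ (f ⊛ h) j ℤ.+ (g ⊛ h) j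
    ⊛-distribʳ = ·-distribʳ

    ⊛-zeroˡ : ∀ f j → ((λ _ → 0ℤ) ⊛ f) j ≡ 0ℤ
    ⊛-zeroˡ f = ·-zeroˡ f (λ _ → refl)

    one-⊛ : ∀ f j → (one ⊛ f) j ≡ f j
    one-⊛ = one-·

    const-⊛ : ∀ a f j → (const a ⊛ f) j ≡ a ℤ.* f j
    const-⊛ = const-·

    X-⊛-zero : ∀ f → (X ⊛ f) 0 ≡ 0ℤ
    X-⊛-zero = X-·-zero

    X-⊛-suc : ∀ f j → (X ⊛ f) (suc j) ≡ f j
    X-⊛-suc = X-·-suc

  -- ℤ[[x]]/(x^N), with power series as representatives.
  truncated : ℕ → CommutativeSemiring 0ℓ 0ℓ
  truncated N = record
    { Carrier = PowerSeries
    ; _≈_ = λ f g → ∀ j → j ℕ.< N → f j ≡ g j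
    ; _+_ = _⊕_
    ; _*_ = _⊛_
    ; 0#  = λ _ → 0ℤ
    ; 1#  = one
    ; isCommutativeSemiring = record
      { isSemiring = record
        { isSemiringWithoutAnnihilatingZero = record
          { +-isCommutativeMonoid = record
            { isMonoid = record
              { isSemigroup = record
                { isMagma = record
                  { isEquivalence = record
                    { refl  = λ j _ → refl
                    ; sym   = λ f≈g j j<N → sym (f≈g j j<N)
                    ; trans = λ f≈g g≈h j j<N → trans (f≈g j j<N) (g≈h j j<N)
                    }
                  ; ∙-cong = λ f≈ g≈ j j<N → cong₂ ℤ._+_ (f≈ j j<N) (g≈ j j<N)
                  }
                ; assoc = λ f g h j _ → ℤ.+-assoc (f j) (g j) (h j)
                }
              ; identity = (λ f j _ → ℤ.+-identityˡ (f j)) , (λ f j _ → ℤ.+-identityʳ (f j))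
              }
            ; comm = λ f g j _ → ℤ.+-comm (f j) (g j)
            }
          ; *-cong = λ f≈ g≈ j j<N → ⊛-cong< j (λ i i≤j → f≈ i (ℕ.≤-<-trans i≤j j<N)) (λ i i≤j → g≈ i (ℕ.≤-<-trans i≤j j<N))
          ; *-assoc = λ f g h j _ → ⊛-assoc f g h j
          ; *-identity = (λ f j _ → one-⊛ f j) , (λ f j _ → trans (⊛-comm f one j) (one-⊛ f j))
          ; distrib = (λ f g h j _ → ⊛-distribˡ f g h j) , (λ f g h j _ → ⊛-distribʳ f g h j)
          }
        ; zero = (λ f j _ → ⊛-zeroˡ f j) , (λ f j _ → trans (⊛-comm f (λ _ → 0ℤ) j) (⊛-zeroˡ f j))
        }
      ; *-comm = λ f g j _ → ⊛-comm f g j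
      }
    }
    where
    ⊛-distribˡ : ∀ f g h j → (f ⊛ (g ⊕ h)) j ≡ (f ⊛ g) j ℤ.+ (f ⊛ h) j
    ⊛-distribˡ f g h j = trans (⊛-comm f (g ⊕ h) j) (trans (⊛-distribʳ f g h j) (cong₂ ℤ._+_ (⊛-comm g f j) (⊛-comm h f j)))

  minusOne : PowerSeries
  minusOne = const -1ℤ

  1-1≡0 : ∀ j → one j ℤ.+ minusOne j ≡ 0ℤ
  1-1≡0 zero    = refl
  1-1≡0 (suc j) = refl

  infixr 8 _^_
  _^_ : PowerSeries → ℕ → PowerSeries
  f ^ zero  = one
  f ^ suc n = f ⊛ (f ^ n)

  X^-coefficient : ∀ e j → (X ^ e) j ≡ (if j ≡ᵇ e then 1ℤ else 0ℤ)
  X^-coefficient zero    zero    = refl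
  X^-coefficient zero    (suc j) = refl
  X^-coefficient (suc e) zero    = X-⊛-zero (X ^ e)
  X^-coefficient (suc e) (suc j) = trans (X-⊛-suc (X ^ e) j) (X^-coefficient e j)

  ≡ᵇ-≢ : ∀ i j → i ≢ j → (i ≡ᵇ j) ≡ false
  ≡ᵇ-≢ i j i≢j with i ≡ᵇ j in eq
  ... | false = refl
  ... | true  = ⊥-elim (i≢j (ℕ.≡ᵇ⇒≡ i j (subst Bool.T (sym eq) tt)))

  ≡ᵇ-≡ : ∀ {i j} → i ≡ j → (i ≡ᵇ j) ≡ true
  ≡ᵇ-≡ {zero}  refl = refl
  ≡ᵇ-≡ {suc i} refl = ≡ᵇ-≡ {i} refl

  X^-zero : ∀ {e j} → j ℕ.< e → (X ^ e) j ≡ 0ℤ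
  X^-zero {e} {j} j<e = trans (X^-coefficient e j) (cong (if_then 1ℤ else 0ℤ) (≡ᵇ-≢ j e (ℕ.<⇒≢ j<e)))

  1-X^-coefficient : ∀ e → 1 ℕ.≤ e → ∀ j → (1-X^ e) j ≡ (one ⊕ minusOne ⊛ X ^ e) j
  1-X^-coefficient (suc e) _ j = trans (go j) (cong (ℤ._+_ (one j))
    (trans (cong (ℤ._*_ -1ℤ) (sym (X^-coefficient (suc e) j))) (sym (const-⊛ -1ℤ (X ^ suc e) j))))
    where
    go : ∀ j → (1-X^ suc e) j ≡ one j ℤ.+ -1ℤ ℤ.* (if j ≡ᵇ suc e then 1ℤ else 0ℤ)
    go zero    = refl
    go (suc j) with j ≡ᵇ e
    ... | true  = refl
    ... | false = refl

  -- The partial products of E(x^e)E(x^{2e}).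
  scaledProduct : ℕ → ℕ → PowerSeries
  scaledProduct e zero    = one
  scaledProduct e (suc K) = scaledProduct e K ⊛ ((1-X^ (e ℕ.* suc K)) ⊛ (1-X^ (2 ℕ.* (e ℕ.* suc K))))

  finiteProduct-scaled : ∀ K j → finiteProduct K j ≡ scaledProduct 1 K j
  finiteProduct-scaled zero    j = refl
  finiteProduct-scaled (suc K) j = begin
    (finiteProduct K · (p · q)) j
      ≡⟨ cong (λ f → f j) (trans (⊛≡· (finiteProduct K) (p ⊛ q)) (cong (finiteProduct K ·_) (⊛≡· p q))) ⟨
    (finiteProduct K ⊛ (p ⊛ q)) j
      ≡⟨ ⊛-cong< j (λ i _ → finiteProduct-scaled K i) (λ i _ → refl) ⟩
    (scaledProduct 1 K ⊛ (p ⊛ q)) j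
      ≡⟨ cong (λ l → (scaledProduct 1 K ⊛ ((1-X^ l) ⊛ (1-X^ (2 ℕ.* l)))) j) (ℕ.*-identityˡ (suc K)) ⟨
    scaledProduct 1 (suc K) j
      ∎
    where
    p q : PowerSeries
    p = 1-X^ suc K
    q = 1-X^ (2 ℕ.* suc K)

  1-X^-one : ∀ {e j} → j ℕ.< e → (1-X^ e) j ≡ one j
  1-X^-one {e} {zero}  _   = refl
  1-X^-one {e} {suc j} j<e = cong (if_then -1ℤ else 0ℤ) (≡ᵇ-≢ (suc j) e (ℕ.<⇒≢ j<e))

  finiteProduct-stable : ∀ j d → finiteProduct (d ℕ.+ j) j ≡ c j
  finiteProduct-stable j zero    = refl
  finiteProduct-stable j (suc d) = begin
    (finiteProduct K · ((1-X^ suc K) · (1-X^ (2 ℕ.* suc K)))) j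
      ≡⟨ ·-cong< {finiteProduct K} j (λ _ _ → refl) (λ i i≤j → ·-cong< {1-X^ suc K} {one} {1-X^ (2 ℕ.* suc K)} {one} i
           (λ l l≤i → 1-X^-one (s≤s (ℕ.≤-trans l≤i (ℕ.≤-trans i≤j (ℕ.m≤n+m j d)))))
           (λ l l≤i → 1-X^-one (ℕ.≤-trans (s≤s (ℕ.≤-trans l≤i (ℕ.≤-trans i≤j (ℕ.m≤n+m j d)))) (ℕ.m≤m+n (suc K) _)))) ⟩
    (finiteProduct K · (one · one)) j
      ≡⟨ ·-cong {finiteProduct K} (λ _ → refl) (one-· one) j ⟩
    (finiteProduct K · one) j
      ≡⟨ trans (·-comm (finiteProduct K) one j) (one-· (finiteProduct K) j) ⟩
    finiteProduct K j
      ≡⟨ finiteProduct-stable j d ⟩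
    c j
      ∎
    where
    K : ℕ
    K = d ℕ.+ j

  record Type (k : ℕ) (f : PowerSeries) : Set where
    constructor type
    field vanishes : ∀ j → j % 3 ≢ k → f j ≡ 0ℤ

  open Type

  Type-⊕ : ∀ {k f g} → Type k f → Type k g → Type k (f ⊕ g)
  Type-⊕ tf tg .vanishes j j≢k = cong₂ ℤ._+_ (vanishes tf j j≢k) (vanishes tg j j≢k)

  -- In the convolution only i divisible by 3 contributes, and then j - i has the residue of j.
  Type-⊛ : ∀ {k f g} → Type 0 f → Type k g → Type k (f ⊛ g)
  Type-⊛ {k} {f} {g} tf tg .vanishes j j≢k = trans (⊛-coefficient f g j)
    (trans (∑-cong< (suc j) term) (∑-zero (suc j) λ _ → refl))
    where
    term : ∀ i → i ℕ.< suc j → f i ℤ.* g (j ∸ i) ≡ 0ℤ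
    term i (s≤s i≤j) with i % 3 ℕ.≟ 0 | (j ∸ i) % 3 ℕ.≟ k
    ... | no i≢0 | _      = cong (ℤ._* g (j ∸ i)) (vanishes tf i i≢0)
    ... | yes _  | no ≢k  = trans (cong (ℤ._*_ (f i)) (vanishes tg (j ∸ i) ≢k)) (ℤ.*-zeroʳ (f i))
    ... | yes i≡0 | yes ≡k = ⊥-elim (j≢k (begin
      j % 3                            ≡⟨ cong (_% 3) (ℕ.m+[n∸m]≡n i≤j) ⟨
      (i ℕ.+ (j ∸ i)) % 3              ≡⟨ ℕ.%-distribˡ-+ i (j ∸ i) 3 ⟩
      (i % 3 ℕ.+ (j ∸ i) % 3) % 3      ≡⟨ cong (λ r → (r ℕ.+ (j ∸ i) % 3) % 3) i≡0 ⟩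
      (j ∸ i) % 3 % 3                  ≡⟨ ℕ.m%n%n≡m%n (j ∸ i) 3 ⟩
      (j ∸ i) % 3                      ≡⟨ ≡k ⟩
      k                                ∎))

  Type-X⊛ : ∀ {k f} → Type k f → Type (suc k % 3) (X ⊛ f)
  Type-X⊛ {k} {f} tf .vanishes zero    _   = X-⊛-zero f
  Type-X⊛ {k} {f} tf .vanishes (suc j) j≢k = trans (X-⊛-suc f j) (vanishes tf j λ j≡k → j≢k (begin
    suc j % 3            ≡⟨ ℕ.%-distribˡ-+ 1 j 3 ⟩
    (1 ℕ.+ j % 3) % 3    ≡⟨ cong (λ r → suc r % 3) j≡k ⟩
    suc k % 3            ∎))

  Type-const : ∀ a → Type 0 (const a)
  Type-const a .vanishes zero    0≢0 = ⊥-elim (0≢0 refl)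
  Type-const a .vanishes (suc j) _   = refl

  Type-one : Type 0 one
  Type-one .vanishes zero    0≢0 = ⊥-elim (0≢0 refl)
  Type-one .vanishes (suc j) _   = refl

  Type-^ : ∀ {f} n → Type 0 f → Type 0 (f ^ n)
  Type-^ zero    tf = Type-one
  Type-^ (suc n) tf = Type-⊛ tf (Type-^ n tf)

  Type-X^ : ∀ k → Type 0 (X ^ (k ℕ.* 3))
  Type-X^ zero    = Type-one
  Type-X^ (suc k) = Type-X⊛ (Type-X⊛ (Type-X⊛ (Type-X^ k)))

  component-≡ : ∀ k f {j} → j % 3 ≡ k → component k f j ≡ f j
  component-≡ k f {j} j≡k = cong (if_then f j else 0ℤ) (≡ᵇ-≡ j≡k)

  component-≢ : ∀ k f {j} → j % 3 ≢ k → component k f j ≡ 0ℤ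
  component-≢ k f {j} j≢k = cong (if_then f j else 0ℤ) (≡ᵇ-≢ (j % 3) k j≢k)

  -- D₀, X⊛(-G) and D₂ stand for the three parts of the dissection of c mod x^N.
  module Components (N : ℕ) (D₀ G D₂ : PowerSeries)
    (D₀-type : Type 0 D₀) (G-type : Type 0 G) (D₂-type : Type 2 D₂)
    (c≡ : ∀ j → j ℕ.< N → c j ≡ D₀ j ℤ.+ ((X ⊛ (minusOne ⊛ G)) j ℤ.+ D₂ j))
    (outer : ∀ j → j ℕ.< N → (D₂ ⊛ D₀) j ≡ ((minusOne ⊕ minusOne) ⊛ ((X ⊛ (minusOne ⊛ G)) ⊛ (X ⊛ (minusOne ⊛ G)))) j)
    where

    private
      D₁ : PowerSeries
      D₁ = X ⊛ (minusOne ⊛ G)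

      D₁-type : Type 1 D₁
      D₁-type = Type-X⊛ (Type-⊛ (Type-const -1ℤ) G-type)

      -- Exponents j congruent to k see only f, because g vanishes there; at all others both the
      -- component and f vanish.
      component-sum : ∀ k {f g h : PowerSeries} → Type k f → (∀ j → j % 3 ≡ k → g j ≡ 0ℤ) →
        (∀ j → j ℕ.< N → h j ≡ f j ℤ.+ g j) → ∀ j → j ℕ.< N → component k h j ≡ f j
      component-sum k {f} {g} {h} tf g≡0 h≡ j j<N = cases (j % 3 ℕ.≟ k)
        where
        cases : Dec (j % 3 ≡ k) → component k h j ≡ f j
        cases (no  j≢k) = trans (component-≢ k h j≢k) (sym (vanishes tf j j≢k))
        cases (yes j≡k) = begin
          component k h j    ≡⟨ component-≡ k h j≡k ⟩
          h j                ≡⟨ h≡ j j<N ⟩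
          f j ℤ.+ g j        ≡⟨ cong (ℤ._+_ (f j)) (g≡0 j j≡k) ⟩
          f j ℤ.+ 0ℤ         ≡⟨ ℤ.+-identityʳ (f j) ⟩
          f j                ∎

      ≢-of : ∀ {k l n : ℕ} → k ≢ l → n ≡ k → n ≢ l
      ≢-of k≢l refl = k≢l

      component₀ : ∀ j → j ℕ.< N → component 0 c j ≡ D₀ j
      component₀ = component-sum 0 {D₀} {D₁ ⊕ D₂} D₀-type
        (λ j j≡ → cong₂ ℤ._+_ (vanishes D₁-type j (≢-of (λ ()) j≡)) (vanishes D₂-type j (≢-of (λ ()) j≡))) c≡

      component₂ : ∀ j → j ℕ.< N → component 2 c j ≡ D₂ j
      component₂ = component-sum 2 {D₂} {D₀ ⊕ D₁} D₂-type
        (λ j j≡ → cong₂ ℤ._+_ (vanishes D₀-type j (≢-of (λ ()) j≡)) (vanishes D₁-type j (≢-of (λ ()) j≡)))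
        (λ j j<N → trans (c≡ j j<N) (rotate (D₀ j) (D₁ j) (D₂ j)))
        where
        rotate : ∀ a b c → a ℤ.+ (b ℤ.+ c) ≡ c ℤ.+ (a ℤ.+ b)
        rotate = solve 3 (λ a b c → a :+ (b :+ c) := c :+ (a :+ b)) refl
          where open ℤ-Solver.+-*-Solver

      -two : ∀ f j → ((minusOne ⊕ minusOne) ⊛ f) j ≡ ℤ.- (ℤ.+ 2) ℤ.* f j
      -two f j = trans (⊛-cong< {minusOne ⊕ minusOne} {const (ℤ.- (ℤ.+ 2))} {f} j (λ { zero _ → refl ; (suc i) _ → refl }) (λ _ _ → refl))
        (const-⊛ (ℤ.- (ℤ.+ 2)) f j)

      ≤-cong : ∀ {f f′ g g′} → (∀ j → j ℕ.< N → f j ≡ f′ j) → (∀ j → j ℕ.< N → g j ≡ g′ j) →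
        ∀ j → j ℕ.< N → (f ⊛ g) j ≡ (f′ ⊛ g′) j
      ≤-cong f≡ g≡ j j<N = ⊛-cong< j (λ i i≤j → f≡ i (ℕ.≤-<-trans i≤j j<N)) (λ i i≤j → g≡ i (ℕ.≤-<-trans i≤j j<N))

    component₁ : ∀ j → j ℕ.< N → component 1 c j ≡ D₁ j
    component₁ = component-sum 1 {D₁} {D₀ ⊕ D₂} D₁-type
      (λ j j≡ → cong₂ ℤ._+_ (vanishes D₀-type j (≢-of (λ ()) j≡)) (vanishes D₂-type j (≢-of (λ ()) j≡)))
      (λ j j<N → trans (c≡ j j<N) (exchange (D₀ j) (D₁ j) (D₂ j)))
      where
      exchange : ∀ a b c → a ℤ.+ (b ℤ.+ c) ≡ b ℤ.+ (a ℤ.+ c)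
      exchange = solve 3 (λ a b c → a :+ (b :+ c) := b :+ (a :+ c)) refl
        where open ℤ-Solver.+-*-Solver

    components : ∀ j → j ℕ.< N →
      (component 2 c ⊛ component 0 c) j ≡ ℤ.- (ℤ.+ 2) ℤ.* (component 1 c ⊛ component 1 c) j
    components j j<N = begin
      (component 2 c ⊛ component 0 c) j
        ≡⟨ ≤-cong {component 2 c} {D₂} {component 0 c} {D₀} component₂ component₀ j j<N ⟩
      (D₂ ⊛ D₀) j
        ≡⟨ outer j j<N ⟩
      ((minusOne ⊕ minusOne) ⊛ (D₁ ⊛ D₁)) j
        ≡⟨ -two (D₁ ⊛ D₁) j ⟩
      ℤ.- (ℤ.+ 2) ℤ.* (D₁ ⊛ D₁) j
        ≡⟨ cong (ℤ._*_ (ℤ.- (ℤ.+ 2))) (≤-cong {component 1 c} {D₁} {component 1 c} {D₁} component₁ component₁ j j<N) ⟨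
      ℤ.- (ℤ.+ 2) ℤ.* (component 1 c ⊛ component 1 c) j
        ∎

  module _ (N : ℕ) where

    private
      module R = CommutativeSemiring (truncated N)
      module R∑ = FiniteSums (truncated N)
      open import Algebra.Properties.CommutativeSemiring.Exp (truncated N) using () renaming (_^_ to _^ᴿ_)
      open ThetaProducts (truncated N) minusOne (λ j _ → 1-1≡0 j)

      ^ᴿ≡^ : ∀ f n → f ^ᴿ n ≡ f ^ n
      ^ᴿ≡^ f zero    = refl
      ^ᴿ≡^ f (suc n) = cong (f ⊛_) (^ᴿ≡^ f n)

      X^N≈0 : X ^ᴿ N R.≈ R.0#
      X^N≈0 j j<N = trans (cong (λ f → f j) (^ᴿ≡^ X N)) (X^-zero j<N)

      Type-∑ : ∀ {k} n f → (∀ i → Type k (f i)) → Type k (R∑.∑ n f)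
      Type-∑ zero    f tf = type λ _ _ → refl
      Type-∑ (suc n) f tf = Type-⊕ (Type-∑ n f tf) (tf n)

      Type-term : ∀ {s} n k {e} → Type 0 s → e ≡ k ℕ.* 3 → Type 0 (s ^ᴿ n ⊛ X ^ᴿ e)
      Type-term {s} n k ts refl =
        Type-⊛ (subst (Type 0) (sym (^ᴿ≡^ s n)) (Type-^ n ts)) (subst (Type 0) (sym (^ᴿ≡^ X (k ℕ.* 3))) (Type-X^ k))

      -- All exponents are combinations of α and β, hence divisible by 3 along with them. The
      -- parameters (9, 9), (15, 3), (6, 3) and (27, 9) of the four series are of this kind.
      Type-θ : ∀ {s} a b L → Type 0 s → Type 0 (θ X s (a ℕ.* 3) (b ℕ.* 3) L)
      Type-θ {s} a b L ts = Type-∑ L _ λ n → Type-⊕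
        (Type-term n (a ℕ.* n ℕ.+ (a ℕ.+ b) ℕ.* tri n) ts (exponent a a b n (tri n)))
        (Type-term (suc n) (b ℕ.* suc n ℕ.+ (a ℕ.+ b) ℕ.* tri (suc n)) ts (exponent b a b (suc n) (tri (suc n))))
        where
        exponent : ∀ l a b n t → l ℕ.* 3 ℕ.* n ℕ.+ (a ℕ.* 3 ℕ.+ b ℕ.* 3) ℕ.* t ≡ (l ℕ.* n ℕ.+ (a ℕ.+ b) ℕ.* t) ℕ.* 3
        exponent = solve 5 (λ l a b n t → l :* con 3 :* n :+ (a :* con 3 :+ b :* con 3) :* t := (l :* n :+ (a :+ b) :* t) :* con 3) refl
          where open ℕ-Solver.+-*-Solver

      -- `scaledProduct` interleaves the factors of E(x^e) and E(x^(2e)), which `∏-*` separates.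
      scaledProduct-E₁E₂ : ∀ e → 1 ℕ.≤ e → scaledProduct e N R.≈ E₁E₂ X N X^N≈0 e
      scaledProduct-E₁E₂ e 1≤e = R.trans (go N) (R∑.∏-* N _ _)
        where
        factor : ∀ e k → 1 ℕ.≤ e → (1-X^ (e ℕ.* suc k)) R.≈ (one ⊕ minusOne ⊛ X ^ᴿ (e ℕ.+ k ℕ.* e))
        factor e@(suc _) k _ j _ = trans (1-X^-coefficient (e ℕ.* suc k) (s≤s z≤n) j)
          (cong (λ f → (one ⊕ minusOne ⊛ f) j) (trans (cong (X ^_) (ℕ.*-comm e (suc k))) (sym (^ᴿ≡^ X (e ℕ.+ k ℕ.* e)))))
        go : ∀ K → scaledProduct e K R.≈ R∑.∏ K (λ k → (one ⊕ minusOne ⊛ X ^ᴿ (1 ℕ.* e ℕ.+ k ℕ.* (1 ℕ.* e)))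
                                                     ⊛ (one ⊕ minusOne ⊛ X ^ᴿ (2 ℕ.* e ℕ.+ k ℕ.* (2 ℕ.* e))))
        go zero    = R.refl
        go (suc K) = R.*-cong (go K) (R.*-cong
          (R.trans (R.reflexive (cong (λ l → 1-X^ (l ℕ.* suc K)) (sym (ℕ.*-identityˡ e)))) (factor (1 ℕ.* e) K (ℕ.≤-trans 1≤e (ℕ.m≤n*m e 1))))
          (R.trans (R.reflexive (cong 1-X^_ (sym (ℕ.*-assoc 2 e (suc K))))) (factor (2 ℕ.* e) K (ℕ.≤-trans 1≤e (ℕ.m≤n*m e 2)))))

      -- The coefficient `c j` is taken from the partial product of length j, which varies with j;
      -- by stability the common length N serves for all j < N.
      c≈E₁E₂ : c R.≈ E₁E₂ X N X^N≈0 1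
      c≈E₁E₂ j j<N = begin
        c j                                    ≡⟨ finiteProduct-stable j (N ∸ j) ⟨
        finiteProduct (N ∸ j ℕ.+ j) j          ≡⟨ cong (λ K → finiteProduct K j) (ℕ.m∸n+n≡m (ℕ.<⇒≤ j<N)) ⟩
        finiteProduct N j                      ≡⟨ finiteProduct-scaled N j ⟩
        scaledProduct 1 N j                    ≡⟨ scaledProduct-E₁E₂ 1 ℕ.≤-refl j j<N ⟩
        E₁E₂ X N X^N≈0 1 j                     ∎

      E₁E₂≈ : E₁E₂ X N X^N≈0 9 R.≈ scaledProduct 9 N
      E₁E₂≈ = R.sym (scaledProduct-E₁E₂ 9 (s≤s z≤n))

      Type-∏ : ∀ n f → (∀ i → Type 0 (f i)) → Type 0 (R∑.∏ n f)
      Type-∏ zero    f tf = Type-one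
      Type-∏ (suc n) f tf = Type-⊛ (Type-∏ n f tf) (tf n)

      Type-P : ∀ a → Type 0 (P X N X^N≈0 minusOne (a ℕ.* 3) (a ℕ.* 3))
      Type-P a = Type-∏ N _ λ k → Type-⊕ Type-one (Type-⊛ (Type-const -1ℤ)
        (subst (Type 0) (sym (^ᴿ≡^ X (a ℕ.* 3 ℕ.+ k ℕ.* (a ℕ.* 3))))
          (subst (λ e → Type 0 (X ^ e)) (ℕ.*-assoc (suc k) a 3) (Type-X^ (suc k ℕ.* a)))))

      φ Ω A ψ G : PowerSeries
      φ = φ₉ X N X^N≈0
      Ω = Ω₃ X N X^N≈0
      A = A₃ X N X^N≈0
      ψ = ψ₉ X N X^N≈0
      G = E₁E₂ X N X^N≈0 9

      φ-type : Type 0 φ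
      φ-type = Type-θ 3 3 (suc N) (Type-const -1ℤ)

      Ω-type : Type 0 Ω
      Ω-type = Type-θ 5 1 (suc N) (Type-const -1ℤ)

      A-type : Type 0 A
      A-type = Type-θ 2 1 (suc N ℕ.* 2) Type-one

      ψ-type : Type 0 ψ
      ψ-type = Type-θ 9 3 (suc N) Type-one

      G-type : Type 0 G
      G-type = Type-⊛ {0} {P X N X^N≈0 minusOne 9 9} {P X N X^N≈0 minusOne 18 18} (Type-P 3) (Type-P 6)

      D₀-type : Type 0 (φ ⊛ A)
      D₀-type = Type-⊛ {0} {φ} {A} φ-type A-type

      D₂-type : Type 2 (X ⊛ (X ⊛ ((minusOne ⊕ minusOne) ⊛ (Ω ⊛ ψ))))
      D₂-type = Type-X⊛ {1} {X ⊛ ((minusOne ⊕ minusOne) ⊛ (Ω ⊛ ψ))}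
        (Type-X⊛ {0} {(minusOne ⊕ minusOne) ⊛ (Ω ⊛ ψ)}
          (Type-⊛ {0} {minusOne ⊕ minusOne} {Ω ⊛ ψ} (Type-⊕ (Type-const -1ℤ) (Type-const -1ℤ))
            (Type-⊛ {0} {Ω} {ψ} Ω-type ψ-type)))

      module C = Components N (φ ⊛ A) G (X ⊛ (X ⊛ ((minusOne ⊕ minusOne) ⊛ (Ω ⊛ ψ)))) D₀-type G-type D₂-type
        (λ j j<N → trans (c≈E₁E₂ j j<N) (E₁E₂-dissection X N X^N≈0 j j<N)) (outer-product X N X^N≈0)

    -- The factor G is replaced by `scaledProduct 9 N`, a polynomial whose exact value at a point is
    -- the N-th partial product of E(x⁹)E(x¹⁸).
    component₁-product : ∀ j → j ℕ.< N → component 1 c j ≡ (X ⊛ (minusOne ⊛ scaledProduct 9 N)) j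
    component₁-product j j<N = trans (C.component₁ j j<N)
      (R.*-congˡ {X} {minusOne ⊛ G} {minusOne ⊛ scaledProduct 9 N} (R.*-congˡ {minusOne} {G} {scaledProduct 9 N} E₁E₂≈) j j<N)

    components-product : ∀ j → j ℕ.< N →
      (component 2 c · component 0 c) j ≡ ℤ.- (ℤ.+ 2) ℤ.* (component 1 c · component 1 c) j
    components-product j j<N = begin
      (component 2 c · component 0 c) j                        ≡⟨ cong (λ f → f j) (⊛≡· (component 2 c) (component 0 c)) ⟨
      (component 2 c ⊛ component 0 c) j                        ≡⟨ C.components j j<N ⟩
      ℤ.- (ℤ.+ 2) ℤ.* (component 1 c ⊛ component 1 c) j        ≡⟨ cong (λ f → ℤ.- (ℤ.+ 2) ℤ.* f j) (⊛≡· (component 1 c) (component 1 c)) ⟩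
      ℤ.- (ℤ.+ 2) ℤ.* (component 1 c · component 1 c) j        ∎

open Series

-- Evaluation at Gaussian rational points

module Evaluation where
  open ≡ using (refl; sym; trans; cong; cong₂; subst)

  open import Algebra.Properties.CommutativeSemiring.Exp ℚ[i]-semiring using () renaming (_^_ to _^ᵍ_; ^-homo-* to ^ᵍ-homo-*; ^-assocʳ to ^ᵍ-assocʳ)

  open ℚ[i]

  η : ℤ → ℚ[i]
  η k = emb (ι k)

  η-+ : ∀ a b → η (a ℤ.+ b) ≡ η a +ᵍ η b
  η-+ a b = cong₂ _⊹_ (ι-+ a b) (sym (ℚ.+-identityˡ 0ℚ))

  η-* : ∀ a b → η (a ℤ.* b) ≡ η a *ᵍ η b
  η-* a b = cong₂ _⊹_
    (trans (ι-* a b) (solve 2 (λ a b → a :* b := a :* b :- con 0ℚ :* con 0ℚ) refl (ι a) (ι b)))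
    (solve 2 (λ a b → con 0ℚ := a :* con 0ℚ :+ con 0ℚ :* b) refl (ι a) (ι b))
    where open +-*-Solver

  ‖η‖ : ∀ k → ‖ η k ‖ ≡ ∣ ι k ∣
  ‖η‖ k = ‖emb‖ (ι k)

  η-sum : ∀ h n → η (sumℤ h n) ≡ G∑.∑ n (λ i → η (h i))
  η-sum h zero    = refl
  η-sum h (suc n) = trans (η-+ (sumℤ h n) (h n)) (cong (_+ᵍ η (h n)) (η-sum h n))

  ∣ι-sum∣ : ∀ h n → ∣ ι (sumℤ h n) ∣ ℚ.≤ Q∑.∑ n (λ i → ∣ ι (h i) ∣)
  ∣ι-sum∣ h zero    = ℚ.≤-refl
  ∣ι-sum∣ h (suc n) = begin
    ∣ ι (sumℤ h n ℤ.+ h n) ∣               ≡⟨ cong ∣_∣ (ι-+ (sumℤ h n) (h n)) ⟩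
    ∣ ι (sumℤ h n) ℚ.+ ι (h n) ∣           ≤⟨ ℚ.∣p+q∣≤∣p∣+∣q∣ (ι (sumℤ h n)) (ι (h n)) ⟩
    ∣ ι (sumℤ h n) ∣ ℚ.+ ∣ ι (h n) ∣       ≤⟨ ℚ.+-monoˡ-≤ ∣ ι (h n) ∣ (∣ι-sum∣ h n) ⟩
    Q∑.∑ n (λ i → ∣ ι (h i) ∣) ℚ.+ ∣ ι (h n) ∣  ∎
    where open ℚ.≤-Reasoning

  -ᵍ-cancel : ∀ a b → (a +ᵍ b) -ᵍ a ≡ b
  -ᵍ-cancel (a ⊹ a′) (b ⊹ b′) = cong₂ _⊹_ (cancel a b) (cancel a′ b′)
    where
    open +-*-Solver
    cancel : ∀ a b → (a ℚ.+ b) ℚ.- a ≡ b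
    cancel = solve 2 (λ a b → (a :+ b) :- a := b) refl

  -ᵍ-+ : ∀ a b c d → (a +ᵍ b) -ᵍ (c +ᵍ d) ≡ (a -ᵍ c) +ᵍ (b -ᵍ d)
  -ᵍ-+ (a ⊹ a′) (b ⊹ b′) (c ⊹ c′) (d ⊹ d′) = cong₂ _⊹_ (lemma a b c d) (lemma a′ b′ c′ d′)
    where
    open +-*-Solver
    lemma : ∀ a b c d → (a ℚ.+ b) ℚ.- (c ℚ.+ d) ≡ (a ℚ.- c) ℚ.+ (b ℚ.- d)
    lemma = solve 4 (λ a b c d → (a :+ b) :- (c :+ d) := (a :- c) :+ (b :- d)) refl

  *ᵍ-distribˡ-- : ∀ a b c → a *ᵍ b -ᵍ a *ᵍ c ≡ a *ᵍ (b -ᵍ c)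
  *ᵍ-distribˡ-- (a ⊹ a′) (b ⊹ b′) (c ⊹ c′) = cong₂ _⊹_
    (solve 6 (λ a a′ b b′ c c′ → (a :* b :- a′ :* b′) :- (a :* c :- a′ :* c′) := a :* (b :- c) :- a′ :* (b′ :- c′)) refl a a′ b b′ c c′)
    (solve 6 (λ a a′ b b′ c c′ → (a :* b′ :+ a′ :* b) :- (a :* c′ :+ a′ :* c) := a :* (b′ :- c′) :+ a′ :* (b :- c)) refl a a′ b b′ c c′)
    where open +-*-Solver

  ‖negᵍ‖ : ∀ z → ‖ negᵍ z ‖ ≡ ‖ z ‖
  ‖negᵍ‖ z = cong₂ ℚ._+_ (ℚ.∣-p∣≡∣p∣ (real z)) (ℚ.∣-p∣≡∣p∣ (imag z))

  ‖∑-∑‖ : ∀ n a b → ‖ G∑.∑ n a -ᵍ G∑.∑ n b ‖ ℚ.≤ Q∑.∑ n (λ i → ‖ a i -ᵍ b i ‖)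
  ‖∑-∑‖ zero    a b = ℚ.≤-refl
  ‖∑-∑‖ (suc n) a b = begin
    ‖ (G∑.∑ n a +ᵍ a n) -ᵍ (G∑.∑ n b +ᵍ b n) ‖      ≡⟨ cong ‖_‖ (-ᵍ-+ (G∑.∑ n a) (a n) (G∑.∑ n b) (b n)) ⟩
    ‖ (G∑.∑ n a -ᵍ G∑.∑ n b) +ᵍ (a n -ᵍ b n) ‖      ≤⟨ ‖+‖ (G∑.∑ n a -ᵍ G∑.∑ n b) (a n -ᵍ b n) ⟩
    ‖ G∑.∑ n a -ᵍ G∑.∑ n b ‖ ℚ.+ ‖ a n -ᵍ b n ‖     ≤⟨ ℚ.+-monoˡ-≤ ‖ a n -ᵍ b n ‖ (‖∑-∑‖ n a b) ⟩
    Q∑.∑ n (λ i → ‖ a i -ᵍ b i ‖) ℚ.+ ‖ a n -ᵍ b n ‖  ∎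
    where open ℚ.≤-Reasoning

  term : PowerSeries → ℚ[i] → ℕ → ℚ[i]
  term f ξ j = η (f j) *ᵍ ξ ^ᵍ j

  eval : PowerSeries → ℚ[i] → ℕ → ℚ[i]
  eval f ξ M = G∑.∑ M (term f ξ)

  ^ᶜ-at : ∀ x k n → (x ^ᶜ k) at n ≡ (x at n) ^ᵍ k
  ^ᶜ-at x zero    n = refl
  ^ᶜ-at x (suc k) n = cong (x at n *ᵍ_) (^ᶜ-at x k n)

  partialSum-at : ∀ f x M n → partialSum f x M at n ≡ eval f (x at n) M
  partialSum-at f x zero    n = refl
  partialSum-at f x (suc M) n = cong₂ _+ᵍ_ (partialSum-at f x M n) (cong (η (f M) *ᵍ_) (^ᶜ-at x M n))

  eval-cong : ∀ {f g} ξ M → (∀ j → j ℕ.< M → f j ≡ g j) → eval f ξ M ≡ eval g ξ M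
  eval-cong ξ M f≡g = G∑.∑-cong< M λ j j<M → cong (λ a → η a *ᵍ ξ ^ᵍ j) (f≡g j j<M)

  term-· : ∀ f g ξ j → term (f · g) ξ j ≡ G∑.∑ (suc j) (λ i → term f ξ i *ᵍ term g ξ (j ∸ i))
  term-· f g ξ j = begin
    η ((f · g) j) *ᵍ ξ ^ᵍ j
      ≡⟨ cong (_*ᵍ ξ ^ᵍ j) (η-sum (λ i → f i ℤ.* g (j ∸ i)) (suc j)) ⟩
    G∑.∑ (suc j) (λ i → η (f i ℤ.* g (j ∸ i))) *ᵍ ξ ^ᵍ j
      ≡⟨ G.*-comm (G∑.∑ (suc j) (λ i → η (f i ℤ.* g (j ∸ i)))) (ξ ^ᵍ j) ⟩
    ξ ^ᵍ j *ᵍ G∑.∑ (suc j) (λ i → η (f i ℤ.* g (j ∸ i)))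
      ≡⟨ G∑.*-∑ (ξ ^ᵍ j) (suc j) (λ i → η (f i ℤ.* g (j ∸ i))) ⟩
    G∑.∑ (suc j) (λ i → ξ ^ᵍ j *ᵍ η (f i ℤ.* g (j ∸ i)))
      ≡⟨ G∑.∑-cong< (suc j) (λ { i (s≤s i≤j) → split i i≤j }) ⟩
    G∑.∑ (suc j) (λ i → term f ξ i *ᵍ term g ξ (j ∸ i))
      ∎
    where
    open ≡-Reasoning
    split : ∀ i → i ℕ.≤ j → ξ ^ᵍ j *ᵍ η (f i ℤ.* g (j ∸ i)) ≡ term f ξ i *ᵍ term g ξ (j ∸ i)
    split i i≤j = begin
      ξ ^ᵍ j *ᵍ η (f i ℤ.* g (j ∸ i))
        ≡⟨ cong₂ _*ᵍ_ (trans (cong (ξ ^ᵍ_) (sym (ℕ.m+[n∸m]≡n i≤j))) (^ᵍ-homo-* ξ i (j ∸ i))) (η-* (f i) (g (j ∸ i))) ⟩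
      (ξ ^ᵍ i *ᵍ ξ ^ᵍ (j ∸ i)) *ᵍ (η (f i) *ᵍ η (g (j ∸ i)))
        ≡⟨ G.*-comm (ξ ^ᵍ i *ᵍ ξ ^ᵍ (j ∸ i)) (η (f i) *ᵍ η (g (j ∸ i))) ⟩
      (η (f i) *ᵍ η (g (j ∸ i))) *ᵍ (ξ ^ᵍ i *ᵍ ξ ^ᵍ (j ∸ i))
        ≡⟨ G∑.*-interchange (η (f i)) (η (g (j ∸ i))) (ξ ^ᵍ i) (ξ ^ᵍ (j ∸ i)) ⟩
      term f ξ i *ᵍ term g ξ (j ∸ i)
        ∎

  -- Truncation does not commute with multiplication: the truncated Cauchy product is a sum over the
  -- triangle i + k < M, whereas the product of the truncations is the sum over the square.
  eval-· : ∀ f g ξ M → eval (f · g) ξ M ≡ G∑.∑ M (λ i → term f ξ i *ᵍ eval g ξ (M ∸ i))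
  eval-· f g ξ M = trans (G∑.∑-cong M (term-· f g ξ)) (G∑.∑-triangle M (term f ξ) (term g ξ))

  -- A degree bound and a value are certified together: beyond the bound truncation loses nothing,
  -- so values multiply exactly and infinite sums do not enter.
  record IsPolynomial (ξ : ℚ[i]) (f : PowerSeries) (v : ℚ[i]) : Set where
    constructor polynomial
    field
      degree   : ℕ
      zero-above : ∀ j → degree ℕ.≤ j → f j ≡ 0ℤ
      value    : eval f ξ degree ≡ v

    term-zero-above : ∀ j → degree ℕ.≤ j → term f ξ j ≡ 0ᵍ
    term-zero-above j d≤j = trans (cong (λ a → η a *ᵍ ξ ^ᵍ j) (zero-above j d≤j)) (G.zeroˡ (ξ ^ᵍ j))

    eval-stable : ∀ M → degree ℕ.≤ M → eval f ξ M ≡ v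
    eval-stable M d≤M = trans (G∑.∑-stable (term f ξ) d≤M term-zero-above) value

  open IsPolynomial

  module _ {ξ : ℚ[i]} where

    poly-ext : ∀ {f g v} → (∀ j → f j ≡ g j) → IsPolynomial ξ f v → IsPolynomial ξ g v
    poly-ext f≡g p = polynomial (degree p) (λ j d≤j → trans (sym (f≡g j)) (zero-above p j d≤j))
      (trans (eval-cong ξ (degree p) λ j _ → sym (f≡g j)) (value p))

    poly-value : ∀ {f v w} → v ≡ w → IsPolynomial ξ f v → IsPolynomial ξ f w
    poly-value refl p = p

    poly-const : ∀ a → IsPolynomial ξ (const a) (η a)
    poly-const a = polynomial 1 (λ { (suc j) _ → refl })
      (trans (G.+-identityˡ (η a *ᵍ 1ᵍ)) (G.*-identityʳ (η a)))

    poly-one : IsPolynomial ξ one 1ᵍ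
    poly-one = poly-ext (λ { zero → refl ; (suc j) → refl }) (poly-const 1ℤ)

    poly-X : IsPolynomial ξ X ξ
    poly-X = polynomial 2 (λ { (suc zero) (s≤s ()) ; (suc (suc j)) _ → refl }) (begin
      0ᵍ +ᵍ 0ᵍ *ᵍ 1ᵍ +ᵍ 1ᵍ *ᵍ (ξ *ᵍ 1ᵍ)    ≡⟨ cong₂ (λ u v → 0ᵍ +ᵍ u +ᵍ v) (G.zeroˡ 1ᵍ) (trans (G.*-identityˡ (ξ *ᵍ 1ᵍ)) (G.*-identityʳ ξ)) ⟩
      0ᵍ +ᵍ 0ᵍ +ᵍ ξ                        ≡⟨ cong (_+ᵍ ξ) (G.+-identityˡ 0ᵍ) ⟩
      0ᵍ +ᵍ ξ                              ≡⟨ G.+-identityˡ ξ ⟩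
      ξ                                    ∎)
      where open ≡-Reasoning

    poly-⊕ : ∀ {f g v w} → IsPolynomial ξ f v → IsPolynomial ξ g w → IsPolynomial ξ (f ⊕ g) (v +ᵍ w)
    poly-⊕ {f} {g} {v} {w} p q = polynomial (degree p ℕ.⊔ degree q)
      (λ j d≤j → cong₂ ℤ._+_ (zero-above p j (ℕ.m⊔n≤o⇒m≤o (degree p) (degree q) d≤j)) (zero-above q j (ℕ.m⊔n≤o⇒n≤o (degree p) (degree q) d≤j)))
      (begin
        G∑.∑ D (term (f ⊕ g) ξ)
          ≡⟨ G∑.∑-cong D (λ j → trans (cong (_*ᵍ ξ ^ᵍ j) (η-+ (f j) (g j))) (G.distribʳ (ξ ^ᵍ j) (η (f j)) (η (g j)))) ⟩
        G∑.∑ D (λ j → term f ξ j +ᵍ term g ξ j)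
          ≡⟨ G∑.∑-+ D (term f ξ) (term g ξ) ⟩
        eval f ξ D +ᵍ eval g ξ D
          ≡⟨ cong₂ _+ᵍ_ (eval-stable p D (ℕ.m≤m⊔n (degree p) (degree q))) (eval-stable q D (ℕ.m≤n⊔m (degree p) (degree q))) ⟩
        v +ᵍ w
          ∎)
      where
      open ≡-Reasoning
      D : ℕ
      D = degree p ℕ.⊔ degree q

    poly-· : ∀ {f g v w} → IsPolynomial ξ f v → IsPolynomial ξ g w → IsPolynomial ξ (f · g) (v *ᵍ w)
    poly-· {f} {g} {v} {w} p q = polynomial (d ℕ.+ e) zero-beyond (begin
        eval (f · g) ξ (d ℕ.+ e)
          ≡⟨ eval-· f g ξ (d ℕ.+ e) ⟩
        G∑.∑ (d ℕ.+ e) (λ i → term f ξ i *ᵍ eval g ξ (d ℕ.+ e ∸ i))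
          ≡⟨ G∑.∑-cong (d ℕ.+ e) inner ⟩
        G∑.∑ (d ℕ.+ e) (λ i → w *ᵍ term f ξ i)
          ≡⟨ G∑.*-∑ w (d ℕ.+ e) (term f ξ) ⟨
        w *ᵍ eval f ξ (d ℕ.+ e)
          ≡⟨ cong (w *ᵍ_) (eval-stable p (d ℕ.+ e) (ℕ.m≤m+n d e)) ⟩
        w *ᵍ v
          ≡⟨ G.*-comm w v ⟩
        v *ᵍ w
          ∎)
      where
      open ≡-Reasoning
      d e : ℕ
      d = degree p
      e = degree q
      e≤∸ : ∀ {i j} → i ℕ.≤ d → d ℕ.+ e ℕ.≤ j → e ℕ.≤ j ∸ i
      e≤∸ {i} i≤d d+e≤j = ℕ.m+n≤o⇒m≤o∸n e (ℕ.≤-trans (ℕ.≤-reflexive (ℕ.+-comm e i)) (ℕ.≤-trans (ℕ.+-monoˡ-≤ e i≤d) d+e≤j))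
      zero-beyond : ∀ j → d ℕ.+ e ℕ.≤ j → (f · g) j ≡ 0ℤ
      zero-beyond j d+e≤j = trans (·-coefficient f g j) (ℤ∑.∑-zero (suc j) summand)
        where
        module ℤ∑ = FiniteSums ℤ.+-*-commutativeSemiring
        summand : ∀ i → f i ℤ.* g (j ∸ i) ≡ 0ℤ
        summand i with ℕ.≤-total d i
        ... | inj₁ d≤i = cong (ℤ._* g (j ∸ i)) (zero-above p i d≤i)
        ... | inj₂ i≤d = trans (cong (f i ℤ.*_) (zero-above q (j ∸ i) (e≤∸ i≤d d+e≤j))) (ℤ.*-zeroʳ (f i))
      -- Either i ≥ d and the term of f vanishes, or at least e terms of the inner sum remain and
      -- its value is already w.
      inner : ∀ i → term f ξ i *ᵍ eval g ξ (d ℕ.+ e ∸ i) ≡ w *ᵍ term f ξ i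
      inner i with ℕ.≤-total d i
      ... | inj₁ d≤i = trans (trans (cong (_*ᵍ eval g ξ (d ℕ.+ e ∸ i)) (term-zero-above p i d≤i)) (G.zeroˡ (eval g ξ (d ℕ.+ e ∸ i))))
                             (sym (trans (cong (w *ᵍ_) (term-zero-above p i d≤i)) (G.zeroʳ w)))
      ... | inj₂ i≤d = trans (cong (term f ξ i *ᵍ_) (eval-stable q (d ℕ.+ e ∸ i) (e≤∸ i≤d ℕ.≤-refl))) (G.*-comm (term f ξ i) w)

    poly-⊛ : ∀ {f g v w} → IsPolynomial ξ f v → IsPolynomial ξ g w → IsPolynomial ξ (f ⊛ g) (v *ᵍ w)
    poly-⊛ {f} {g} p q = subst (λ h → IsPolynomial ξ h _) (sym (⊛≡· f g)) (poly-· {f} {g} p q)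

    poly-X^ : ∀ e → IsPolynomial ξ (X ^ e) (ξ ^ᵍ e)
    poly-X^ zero    = poly-one
    poly-X^ (suc e) = poly-⊛ poly-X (poly-X^ e)

    1+η-1* : ∀ z → 1ᵍ +ᵍ η -1ℤ *ᵍ z ≡ 1ᵍ -ᵍ z
    1+η-1* (a ⊹ b) = cong₂ _⊹_
      (solve 2 (λ a b → con 1ℚ :+ (con (ι -1ℤ) :* a :- con 0ℚ :* b) := con 1ℚ :- a) refl a b)
      (solve 2 (λ a b → con 0ℚ :+ (con (ι -1ℤ) :* b :+ con 0ℚ :* a) := con 0ℚ :- b) refl a b)
      where open +-*-Solver

    poly-1-X^ : ∀ e → 1 ℕ.≤ e → IsPolynomial ξ (1-X^ e) (1ᵍ -ᵍ ξ ^ᵍ e)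
    poly-1-X^ e 1≤e = poly-ext (λ j → sym (1-X^-coefficient e 1≤e j))
      (poly-value (1+η-1* (ξ ^ᵍ e)) (poly-⊕ poly-one (poly-⊛ (poly-const -1ℤ) (poly-X^ e))))

  pE : ℚ[i] → ℕ → ℚ[i]
  pE y K = G∑.∏ K (λ k → 1ᵍ -ᵍ y ^ᵍ suc k)

  partialE-at : ∀ x K n → partialE x K at n ≡ pE (x at n) K
  partialE-at x zero    n = refl
  partialE-at x (suc K) n = cong₂ (λ u v → u *ᵍ (1ᵍ -ᵍ v)) (partialE-at x K n) (^ᶜ-at x (suc K) n)

  poly-factor : ∀ {ξ} e K → 1 ℕ.≤ e → IsPolynomial ξ (1-X^ (e ℕ.* suc K)) (1ᵍ -ᵍ (ξ ^ᵍ e) ^ᵍ suc K)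
  poly-factor {ξ} e K 1≤e = subst (λ w → IsPolynomial ξ (1-X^ (e ℕ.* suc K)) (1ᵍ -ᵍ w)) (sym (^ᵍ-assocʳ ξ e (suc K)))
    (poly-1-X^ (e ℕ.* suc K) (ℕ.≤-trans 1≤e (ℕ.m≤m*n e (suc K))))

  pE-interchange : ∀ y z K → (pE y K *ᵍ pE z K) *ᵍ ((1ᵍ -ᵍ y ^ᵍ suc K) *ᵍ (1ᵍ -ᵍ z ^ᵍ suc K)) ≡ pE y (suc K) *ᵍ pE z (suc K)
  pE-interchange y z K = G∑.*-interchange (pE y K) (pE z K) (1ᵍ -ᵍ y ^ᵍ suc K) (1ᵍ -ᵍ z ^ᵍ suc K)

  poly-scaledProduct : ∀ ξ e K → 1 ℕ.≤ e → IsPolynomial ξ (scaledProduct e K) (pE (ξ ^ᵍ e) K *ᵍ pE (ξ ^ᵍ (2 ℕ.* e)) K)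
  poly-scaledProduct ξ e zero    1≤e =
    subst (IsPolynomial ξ one) (sym (G.*-identityʳ (pE (ξ ^ᵍ e) zero))) poly-one
  poly-scaledProduct ξ e (suc K) 1≤e =
    poly-value {f = scaledProduct e (suc K)} (pE-interchange (ξ ^ᵍ e) (ξ ^ᵍ (2 ℕ.* e)) K) (step (poly-scaledProduct ξ e K 1≤e))
    where
    step : IsPolynomial ξ (scaledProduct e K) (pE (ξ ^ᵍ e) K *ᵍ pE (ξ ^ᵍ (2 ℕ.* e)) K) →
      IsPolynomial ξ (scaledProduct e K ⊛ ((1-X^ (e ℕ.* suc K)) ⊛ (1-X^ (2 ℕ.* (e ℕ.* suc K)))))
        ((pE (ξ ^ᵍ e) K *ᵍ pE (ξ ^ᵍ (2 ℕ.* e)) K) *ᵍ ((1ᵍ -ᵍ (ξ ^ᵍ e) ^ᵍ suc K) *ᵍ (1ᵍ -ᵍ (ξ ^ᵍ (2 ℕ.* e)) ^ᵍ suc K)))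
    step p = poly-⊛ p (poly-⊛ (poly-factor e K 1≤e)
      (subst (λ l → IsPolynomial ξ (1-X^ l) (1ᵍ -ᵍ (ξ ^ᵍ (2 ℕ.* e)) ^ᵍ suc K)) (ℕ.*-assoc 2 e (suc K))
        (poly-factor (2 ℕ.* e) K (ℕ.≤-trans 1≤e (ℕ.m≤n*m e 2)))))

open Evaluation

-- Truncation errors and the two identities in the limit

module Estimates where
  open ≡ using (refl; sym; trans; cong; cong₂; subst)

  open import Algebra.Properties.CommutativeSemiring.Exp ℚ[i]-semiring using () renaming (_^_ to _^ᵍ_; ^-assocʳ to ^ᵍ-assocʳ)
  open import Algebra.Properties.CommutativeSemiring.Exp ℚ-semiring using (^-homo-*; ^-distrib-*) renaming (_^_ to _^ℚ_)

  open Ratio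
  open ℚ[i]
  open IsPolynomial
  open ℚ.≤-Reasoning

  module Disk (S : Ratio) where

    private
      s : ℚ
      s = ratio S

    weighted : PowerSeries → ℕ → ℚ
    weighted f j = ∣ ι (f j) ∣ ℚ.* s ^ℚ j

    0≤weighted : ∀ f j → 0ℚ ℚ.≤ weighted f j
    0≤weighted f j = 0≤* (ℚ.0≤∣p∣ (ι (f j))) (0≤pow S j)

    -- The norm Σ |f_j| s^j is bounded through its partial sums, so no infinite sum of rationals is
    -- needed. Being submultiplicative, it bounds products factor by factor, and every single
    -- coefficient with them.
    record Norm≤ (f : PowerSeries) (b : ℚ) : Set where
      constructor norm≤
      field bound : ∀ M → Q∑.∑ M (weighted f) ℚ.≤ b

      0≤bound : 0ℚ ℚ.≤ b
      0≤bound = bound 0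

      coefficient≤ : ∀ j → weighted f j ℚ.≤ b
      coefficient≤ j = ℚ.≤-trans (p≤q+p (∑-nonNeg j (0≤weighted f))) (bound (suc j))

    open Norm≤

    Norm≤-ext : ∀ {f g b} → (∀ j → f j ≡ g j) → Norm≤ f b → Norm≤ g b
    Norm≤-ext {f} {g} {b} f≡g p .bound M =
      subst (ℚ._≤ b) (Q∑.∑-cong M λ j → cong (λ a → ∣ ι a ∣ ℚ.* s ^ℚ j) (f≡g j)) (bound p M)

    Norm≤-weaken : ∀ {f a b} → a ℚ.≤ b → Norm≤ f a → Norm≤ f b
    Norm≤-weaken a≤b p .bound M = ℚ.≤-trans (bound p M) a≤b

    weighted-· : ∀ f g j → weighted (f · g) j ℚ.≤ Q∑.∑ (suc j) (λ i → weighted f i ℚ.* weighted g (j ∸ i))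
    weighted-· f g j = begin
      ∣ ι ((f · g) j) ∣ ℚ.* s ^ℚ j
        ≤⟨ *-monoʳ-≤ (0≤pow S j) (∣ι-sum∣ (λ i → f i ℤ.* g (j ∸ i)) (suc j)) ⟩
      Q∑.∑ (suc j) (λ i → ∣ ι (f i ℤ.* g (j ∸ i)) ∣) ℚ.* s ^ℚ j
        ≡⟨ ℚ.*-comm (Q∑.∑ (suc j) (λ i → ∣ ι (f i ℤ.* g (j ∸ i)) ∣)) (s ^ℚ j) ⟩
      s ^ℚ j ℚ.* Q∑.∑ (suc j) (λ i → ∣ ι (f i ℤ.* g (j ∸ i)) ∣)
        ≡⟨ Q∑.*-∑ (s ^ℚ j) (suc j) (λ i → ∣ ι (f i ℤ.* g (j ∸ i)) ∣) ⟩
      Q∑.∑ (suc j) (λ i → s ^ℚ j ℚ.* ∣ ι (f i ℤ.* g (j ∸ i)) ∣)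
        ≡⟨ Q∑.∑-cong< (suc j) (λ { i (s≤s i≤j) → split i i≤j }) ⟩
      Q∑.∑ (suc j) (λ i → weighted f i ℚ.* weighted g (j ∸ i))
        ∎
      where
      split : ∀ i → i ℕ.≤ j → s ^ℚ j ℚ.* ∣ ι (f i ℤ.* g (j ∸ i)) ∣ ≡ weighted f i ℚ.* weighted g (j ∸ i)
      split i i≤j = begin-equality
        s ^ℚ j ℚ.* ∣ ι (f i ℤ.* g (j ∸ i)) ∣
          ≡⟨ cong₂ ℚ._*_ (trans (cong (s ^ℚ_) (sym (ℕ.m+[n∸m]≡n i≤j))) (^-homo-* s i (j ∸ i)))
                         (trans (cong ∣_∣ (ι-* (f i) (g (j ∸ i)))) (ℚ.∣p*q∣≡∣p∣*∣q∣ (ι (f i)) (ι (g (j ∸ i))))) ⟩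
        s ^ℚ i ℚ.* s ^ℚ (j ∸ i) ℚ.* (∣ ι (f i) ∣ ℚ.* ∣ ι (g (j ∸ i)) ∣)
          ≡⟨ solve 4 (λ a b c d → a :* b :* (c :* d) := c :* a :* (d :* b)) refl (s ^ℚ i) (s ^ℚ (j ∸ i)) (∣ ι (f i) ∣) (∣ ι (g (j ∸ i)) ∣) ⟩
        ∣ ι (f i) ∣ ℚ.* s ^ℚ i ℚ.* (∣ ι (g (j ∸ i)) ∣ ℚ.* s ^ℚ (j ∸ i))
          ∎
        where open +-*-Solver

    -- The Cauchy product runs over a triangle, each row of which is at most the full norm of g.
    Norm≤-⊛ : ∀ {f g a b} → Norm≤ f a → Norm≤ g b → Norm≤ (f ⊛ g) (a ℚ.* b)
    Norm≤-⊛ {f} {g} {a} {b} p q .bound M = begin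
      Q∑.∑ M (weighted (f ⊛ g))
        ≡⟨ cong (λ h → Q∑.∑ M (weighted h)) (⊛≡· f g) ⟩
      Q∑.∑ M (weighted (f · g))
        ≤⟨ ∑-mono M (λ j _ → weighted-· f g j) ⟩
      Q∑.∑ M (λ j → Q∑.∑ (suc j) (λ i → weighted f i ℚ.* weighted g (j ∸ i)))
        ≡⟨ Q∑.∑-triangle M (weighted f) (weighted g) ⟩
      Q∑.∑ M (λ i → weighted f i ℚ.* Q∑.∑ (M ∸ i) (weighted g))
        ≤⟨ ∑-mono M (λ i _ → *-monoˡ-≤ (0≤weighted f i) (bound q (M ∸ i))) ⟩
      Q∑.∑ M (λ i → weighted f i ℚ.* b)
        ≡⟨ Q∑.∑-cong M (λ i → ℚ.*-comm (weighted f i) b) ⟩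
      Q∑.∑ M (λ i → b ℚ.* weighted f i)
        ≡⟨ Q∑.*-∑ b M (weighted f) ⟨
      b ℚ.* Q∑.∑ M (weighted f)
        ≤⟨ *-monoˡ-≤ (0≤bound q) (bound p M) ⟩
      b ℚ.* a
        ≡⟨ ℚ.*-comm b a ⟩
      a ℚ.* b
        ∎

    Norm≤-⊕ : ∀ {f g a b} → Norm≤ f a → Norm≤ g b → Norm≤ (f ⊕ g) (a ℚ.+ b)
    Norm≤-⊕ {f} {g} {a} {b} p q .bound M = begin
      Q∑.∑ M (weighted (f ⊕ g))
        ≤⟨ ∑-mono M (λ j _ → split j) ⟩
      Q∑.∑ M (λ j → weighted f j ℚ.+ weighted g j)
        ≡⟨ Q∑.∑-+ M (weighted f) (weighted g) ⟩
      Q∑.∑ M (weighted f) ℚ.+ Q∑.∑ M (weighted g)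
        ≤⟨ ℚ.+-mono-≤ (bound p M) (bound q M) ⟩
      a ℚ.+ b
        ∎
      where
      split : ∀ j → weighted (f ⊕ g) j ℚ.≤ weighted f j ℚ.+ weighted g j
      split j = begin
        ∣ ι (f j ℤ.+ g j) ∣ ℚ.* s ^ℚ j
          ≡⟨ cong (λ u → ∣ u ∣ ℚ.* s ^ℚ j) (ι-+ (f j) (g j)) ⟩
        ∣ ι (f j) ℚ.+ ι (g j) ∣ ℚ.* s ^ℚ j
          ≤⟨ *-monoʳ-≤ (0≤pow S j) (ℚ.∣p+q∣≤∣p∣+∣q∣ (ι (f j)) (ι (g j))) ⟩
        (∣ ι (f j) ∣ ℚ.+ ∣ ι (g j) ∣) ℚ.* s ^ℚ j
          ≡⟨ ℚ.*-distribʳ-+ (s ^ℚ j) ∣ ι (f j) ∣ ∣ ι (g j) ∣ ⟩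
        weighted f j ℚ.+ weighted g j
          ∎

    Norm≤-const : ∀ a → Norm≤ (const a) ∣ ι a ∣
    Norm≤-const a .bound zero    = ℚ.0≤∣p∣ (ι a)
    Norm≤-const a .bound (suc M) = begin
      Q∑.∑ (suc M) (weighted (const a))
        ≡⟨ Q∑.∑-front M (weighted (const a)) ⟩
      ∣ ι a ∣ ℚ.* 1ℚ ℚ.+ Q∑.∑ M (λ j → 0ℚ ℚ.* s ^ℚ suc j)
        ≡⟨ cong₂ ℚ._+_ (ℚ.*-identityʳ ∣ ι a ∣) (Q∑.∑-zero M λ j → ℚ.*-zeroˡ (s ^ℚ suc j)) ⟩
      ∣ ι a ∣ ℚ.+ 0ℚ
        ≡⟨ ℚ.+-identityʳ ∣ ι a ∣ ⟩
      ∣ ι a ∣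
        ∎

    Norm≤-one : Norm≤ one 1ℚ
    Norm≤-one = Norm≤-ext (λ { zero → refl ; (suc j) → refl }) (Norm≤-const 1ℤ)

    Norm≤-X⊛ : ∀ {f b} → Norm≤ f b → Norm≤ (X ⊛ f) (s ℚ.* b)
    Norm≤-X⊛ {f} {b} p .bound zero    = 0≤* (0≤ratio S) (0≤bound p)
    Norm≤-X⊛ {f} {b} p .bound (suc M) = begin
      Q∑.∑ (suc M) (weighted (X ⊛ f))
        ≡⟨ Q∑.∑-front M (weighted (X ⊛ f)) ⟩
      ∣ ι ((X ⊛ f) 0) ∣ ℚ.* 1ℚ ℚ.+ Q∑.∑ M (λ j → ∣ ι ((X ⊛ f) (suc j)) ∣ ℚ.* (s ℚ.* s ^ℚ j))
        ≡⟨ cong₂ ℚ._+_ (trans (ℚ.*-identityʳ _) (cong (λ a → ∣ ι a ∣) (X-⊛-zero f)))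
                       (Q∑.∑-cong M λ j → trans (cong (λ a → ∣ ι a ∣ ℚ.* (s ℚ.* s ^ℚ j)) (X-⊛-suc f j))
                         (solve 3 (λ a s p → a :* (s :* p) := s :* (a :* p)) refl (∣ ι (f j) ∣) s (s ^ℚ j))) ⟩
      0ℚ ℚ.+ Q∑.∑ M (λ j → s ℚ.* weighted f j)
        ≡⟨ trans (ℚ.+-identityˡ _) (sym (Q∑.*-∑ s M (weighted f))) ⟩
      s ℚ.* Q∑.∑ M (weighted f)
        ≤⟨ *-monoˡ-≤ (0≤ratio S) (bound p M) ⟩
      s ℚ.* b
        ∎
      where open +-*-Solver

    Norm≤-minus : ∀ {f b} → Norm≤ f b → Norm≤ (minusOne ⊛ f) b
    Norm≤-minus {f} {b} p = Norm≤-weaken (ℚ.≤-reflexive (ℚ.*-identityˡ b)) (Norm≤-⊛ (Norm≤-const -1ℤ) p)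

    Norm≤-X^ : ∀ e → Norm≤ (X ^ e) (s ^ℚ e)
    Norm≤-X^ zero    = Norm≤-one
    Norm≤-X^ (suc e) = Norm≤-X⊛ (Norm≤-X^ e)

    -- The true norm is 1 + s^e. It is relaxed to the K-th factor of a product in `∏-bounded`, with
    -- constant 1, so that one bound serves all scales.
    Norm≤-1-X^ : ∀ e K → K ℕ.< e → Norm≤ (1-X^ e) (1ℚ ℚ.+ 1ℚ ℚ.* s ^ℚ K)
    Norm≤-1-X^ e K K<e = Norm≤-ext (λ j → sym (1-X^-coefficient e (ℕ.≤-trans (s≤s z≤n) K<e) j))
      (Norm≤-weaken (ℚ.+-monoʳ-≤ 1ℚ (ℚ.≤-trans (pow-anti S (ℕ.<⇒≤ K<e)) (ℚ.≤-reflexive (sym (ℚ.*-identityˡ (s ^ℚ K))))))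
        (Norm≤-⊕ Norm≤-one (Norm≤-minus (Norm≤-X^ e))))

    Norm≤-scaledProduct : ∀ e K → 1 ℕ.≤ e →
      Norm≤ (scaledProduct e K) (Q∑.∏ K (λ k → 1ℚ ℚ.+ 1ℚ ℚ.* s ^ℚ k) ℚ.* Q∑.∏ K (λ k → 1ℚ ℚ.+ 1ℚ ℚ.* s ^ℚ k))
    Norm≤-scaledProduct e zero    1≤e = Norm≤-weaken (ℚ.≤-reflexive (sym (ℚ.*-identityˡ 1ℚ))) Norm≤-one
    Norm≤-scaledProduct e (suc K) 1≤e = Norm≤-weaken
      (ℚ.≤-reflexive (Q∑.*-interchange (Q∑.∏ K (λ k → 1ℚ ℚ.+ 1ℚ ℚ.* s ^ℚ k)) (Q∑.∏ K (λ k → 1ℚ ℚ.+ 1ℚ ℚ.* s ^ℚ k))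
        (1ℚ ℚ.+ 1ℚ ℚ.* s ^ℚ K) (1ℚ ℚ.+ 1ℚ ℚ.* s ^ℚ K)))
      (Norm≤-⊛ (Norm≤-scaledProduct e K 1≤e) (Norm≤-⊛ (Norm≤-1-X^ (e ℕ.* suc K) K K<) (Norm≤-1-X^ (2 ℕ.* (e ℕ.* suc K)) K
        (ℕ.≤-trans K< (ℕ.m≤n*m (e ℕ.* suc K) 2)))))
      where
      K< : K ℕ.< e ℕ.* suc K
      K< = ℕ.m≤n*m (suc K) e ⦃ ℕ.>-nonZero 1≤e ⦄

    private
      ∏≤ : ∃[ B ] (0ℚ ℚ.≤ B × (∀ m → Q∑.∏ m (λ k → 1ℚ ℚ.+ 1ℚ ℚ.* s ^ℚ k) ℚ.≤ B))
      ∏≤ = ∏-bounded S 1ℚ (ℚ.nonNegative⁻¹ 1ℚ)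

    -- The square of a bound on all partial products of Π(1 + s^k), one factor each for E(x^e) and
    -- E(x^(2e)). It depends neither on e nor on the number of factors.
    B : ℚ
    B = proj₁ ∏≤ ℚ.* proj₁ ∏≤

    0≤B : 0ℚ ℚ.≤ B
    0≤B = 0≤* (proj₁ (proj₂ ∏≤)) (proj₁ (proj₂ ∏≤))

    scaledProduct-bounded : ∀ e K → 1 ℕ.≤ e → Norm≤ (scaledProduct e K) B
    scaledProduct-bounded e K 1≤e = Norm≤-weaken
      (*-mono-≤ (∏-nonNeg K λ k → 0≤+ (ℚ.nonNegative⁻¹ 1ℚ) (0≤* (ℚ.nonNegative⁻¹ 1ℚ) (0≤pow S k))) (proj₁ (proj₂ ∏≤))
        (proj₂ (proj₂ ∏≤) K) (proj₂ (proj₂ ∏≤) K))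
      (Norm≤-scaledProduct e K 1≤e)

    Bounded : PowerSeries → Set
    Bounded f = ∀ j → weighted f j ℚ.≤ B

    -- Each coefficient of c stems from a different partial product, so the uniformity of `B` in the
    -- number of factors is essential.
    c-bounded : Bounded c
    c-bounded j = subst (λ a → ∣ ι a ∣ ℚ.* s ^ℚ j ℚ.≤ B) (sym (finiteProduct-scaled j j))
      (coefficient≤ (scaledProduct-bounded 1 j ℕ.≤-refl) j)

    component-bounded : ∀ k → Bounded (component k c)
    component-bounded k j with j % 3 ≡ᵇ k
    ... | true  = c-bounded j
    ... | false = ℚ.≤-trans (ℚ.≤-reflexive (ℚ.*-zeroˡ (s ^ℚ j))) 0≤B

    I₁-polynomial : ℕ → PowerSeries
    I₁-polynomial n = X ⊛ (minusOne ⊛ scaledProduct 9 n)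

    I₁-polynomial-bounded : ∀ n → Bounded (I₁-polynomial n)
    I₁-polynomial-bounded n = coefficient≤ (Norm≤-weaken
      (ℚ.≤-trans (*-monoʳ-≤ 0≤B (ℚ.<⇒≤ (ratio<1 S))) (ℚ.≤-reflexive (ℚ.*-identityˡ B)))
      (Norm≤-X⊛ (Norm≤-minus (scaledProduct-bounded 9 n (s≤s z≤n)))))

    C : ℚ
    C = 2ℚ ℚ.* B

    0≤C : 0ℚ ℚ.≤ C
    0≤C = 0≤* 0≤2 0≤B

    -- The constant of a term, `C`, times the constant of a tail, `C ℚ.* κ S`.
    Cₘ : ℚ
    Cₘ = C ℚ.* (C ℚ.* κ S)

    0≤Cₘ : 0ℚ ℚ.≤ Cₘ
    0≤Cₘ = 0≤* 0≤C (0≤* 0≤C (0≤κ S))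

    private
      ∏≤₂ : ∃[ B ] (0ℚ ℚ.≤ B × (∀ m → Q∑.∏ m (λ k → 1ℚ ℚ.+ 2ℚ ℚ.* s ^ℚ k) ℚ.≤ B))
      ∏≤₂ = ∏-bounded S 2ℚ 0≤2

    Cₑ : ℚ
    Cₑ = proj₁ ∏≤₂ ℚ.* 2ℚ

    0≤Cₑ : 0ℚ ℚ.≤ Cₑ
    0≤Cₑ = 0≤* (proj₁ (proj₂ ∏≤₂)) 0≤2

    -- The factor 2 comes from comparing the ℓ¹ norm with the modulus.
    module Point (ξ : ℚ[i]) (ξ^≤ : ∀ k → ‖ ξ ^ᵍ k ‖ ℚ.≤ 2ℚ ℚ.* (s ^ℚ k ℚ.* s ^ℚ k)) where

      ‖term‖ : ∀ {f} → Bounded f → ∀ j → ‖ term f ξ j ‖ ℚ.≤ C ℚ.* s ^ℚ j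
      ‖term‖ {f} fb j = begin
        ‖ η (f j) *ᵍ ξ ^ᵍ j ‖                                  ≤⟨ ‖*‖ (η (f j)) (ξ ^ᵍ j) ⟩
        ‖ η (f j) ‖ ℚ.* ‖ ξ ^ᵍ j ‖                             ≡⟨ cong (ℚ._* ‖ ξ ^ᵍ j ‖) (‖η‖ (f j)) ⟩
        ∣ ι (f j) ∣ ℚ.* ‖ ξ ^ᵍ j ‖                             ≤⟨ *-monoˡ-≤ (ℚ.0≤∣p∣ (ι (f j))) (ξ^≤ j) ⟩
        ∣ ι (f j) ∣ ℚ.* (2ℚ ℚ.* (s ^ℚ j ℚ.* s ^ℚ j))           ≡⟨ solve 3 (λ a t p → a :* (t :* (p :* p)) := t :* (a :* p) :* p) refl (∣ ι (f j) ∣) 2ℚ (s ^ℚ j) ⟩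
        2ℚ ℚ.* weighted f j ℚ.* s ^ℚ j                         ≤⟨ *-monoʳ-≤ (0≤pow S j) (*-monoˡ-≤ 0≤2 (fb j)) ⟩
        C ℚ.* s ^ℚ j                                           ∎
        where open +-*-Solver

      eval-tail : ∀ {f n M} → Bounded f → n ℕ.≤ M → ‖ eval f ξ M -ᵍ eval f ξ n ‖ ℚ.≤ C ℚ.* κ S ℚ.* s ^ℚ n
      eval-tail {f} {n} {M} fb n≤M = begin
        ‖ eval f ξ M -ᵍ eval f ξ n ‖
          ≡⟨ cong (λ z → ‖ z -ᵍ eval f ξ n ‖) (trans (cong (eval f ξ) (sym (ℕ.m+[n∸m]≡n n≤M))) (G∑.∑-++ n (M ∸ n) (term f ξ))) ⟩
        ‖ (eval f ξ n +ᵍ rest) -ᵍ eval f ξ n ‖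
          ≡⟨ cong ‖_‖ (-ᵍ-cancel (eval f ξ n) rest) ⟩
        ‖ rest ‖
          ≤⟨ ‖∑‖ (M ∸ n) (λ k → term f ξ (n ℕ.+ k)) ⟩
        Q∑.∑ (M ∸ n) (λ k → ‖ term f ξ (n ℕ.+ k) ‖)
          ≤⟨ ∑-mono (M ∸ n) (λ k _ → ‖term‖ {f} fb (n ℕ.+ k)) ⟩
        Q∑.∑ (M ∸ n) (λ k → C ℚ.* s ^ℚ (n ℕ.+ k))
          ≡⟨ Q∑.*-∑ C (M ∸ n) (λ k → s ^ℚ (n ℕ.+ k)) ⟨
        C ℚ.* Q∑.∑ (M ∸ n) (λ k → s ^ℚ (n ℕ.+ k))
          ≤⟨ *-monoˡ-≤ 0≤C (∑-tail S n (M ∸ n)) ⟩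
        C ℚ.* (s ^ℚ n ℚ.* κ S)
          ≡⟨ solve 3 (λ c p k → c :* (p :* k) := c :* k :* p) refl C (s ^ℚ n) (κ S) ⟩
        C ℚ.* κ S ℚ.* s ^ℚ n
          ∎
        where
        open +-*-Solver
        rest : ℚ[i]
        rest = G∑.∑ (M ∸ n) (λ k → term f ξ (n ℕ.+ k))

      -- This is the square minus the triangle. Row i, with a term of f of size s^i, misses the tail
      -- of g from n - i on, of size s^(n-i); each of the n rows therefore costs a multiple of s^n.
      product-error : ∀ {f g} n → Bounded f → Bounded g →
        ‖ eval f ξ n *ᵍ eval g ξ n -ᵍ eval (f · g) ξ n ‖ ℚ.≤ nat n ℚ.* (Cₘ ℚ.* s ^ℚ n)
      product-error {f} {g} n fb gb = begin
        ‖ eval f ξ n *ᵍ eval g ξ n -ᵍ eval (f · g) ξ n ‖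
          ≡⟨ cong₂ (λ y z → ‖ y -ᵍ z ‖) spread (eval-· f g ξ n) ⟩
        ‖ G∑.∑ n (λ i → term f ξ i *ᵍ eval g ξ n) -ᵍ G∑.∑ n (λ i → term f ξ i *ᵍ eval g ξ (n ∸ i)) ‖
          ≤⟨ ‖∑-∑‖ n (λ i → term f ξ i *ᵍ eval g ξ n) (λ i → term f ξ i *ᵍ eval g ξ (n ∸ i)) ⟩
        Q∑.∑ n (λ i → ‖ term f ξ i *ᵍ eval g ξ n -ᵍ term f ξ i *ᵍ eval g ξ (n ∸ i) ‖)
          ≤⟨ ∑-mono n (λ i i<n → summand i (ℕ.<⇒≤ i<n)) ⟩
        Q∑.∑ n (λ _ → Cₘ ℚ.* s ^ℚ n)
          ≡⟨ ∑-const n (Cₘ ℚ.* s ^ℚ n) ⟩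
        nat n ℚ.* (Cₘ ℚ.* s ^ℚ n)
          ∎
        where
        spread : eval f ξ n *ᵍ eval g ξ n ≡ G∑.∑ n (λ i → term f ξ i *ᵍ eval g ξ n)
        spread = trans (G.*-comm (eval f ξ n) (eval g ξ n))
          (trans (G∑.*-∑ (eval g ξ n) n (term f ξ)) (G∑.∑-cong n λ i → G.*-comm (eval g ξ n) (term f ξ i)))
        summand : ∀ i → i ℕ.≤ n → ‖ term f ξ i *ᵍ eval g ξ n -ᵍ term f ξ i *ᵍ eval g ξ (n ∸ i) ‖ ℚ.≤ Cₘ ℚ.* s ^ℚ n
        summand i i≤n = begin
          ‖ term f ξ i *ᵍ eval g ξ n -ᵍ term f ξ i *ᵍ eval g ξ (n ∸ i) ‖
            ≡⟨ cong ‖_‖ (*ᵍ-distribˡ-- (term f ξ i) (eval g ξ n) (eval g ξ (n ∸ i))) ⟩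
          ‖ term f ξ i *ᵍ (eval g ξ n -ᵍ eval g ξ (n ∸ i)) ‖
            ≤⟨ ‖*‖ (term f ξ i) (eval g ξ n -ᵍ eval g ξ (n ∸ i)) ⟩
          ‖ term f ξ i ‖ ℚ.* ‖ eval g ξ n -ᵍ eval g ξ (n ∸ i) ‖
            ≤⟨ *-mono-≤ (0≤‖ eval g ξ n -ᵍ eval g ξ (n ∸ i) ‖) (0≤* 0≤C (0≤pow S i)) (‖term‖ {f} fb i) (eval-tail {g} gb (ℕ.m∸n≤m n i)) ⟩
          C ℚ.* s ^ℚ i ℚ.* (C ℚ.* κ S ℚ.* s ^ℚ (n ∸ i))
            ≡⟨ solve 4 (λ c p k r → c :* p :* (c :* k :* r) := c :* (c :* k) :* (p :* r)) refl C (s ^ℚ i) (κ S) (s ^ℚ (n ∸ i)) ⟩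
          Cₘ ℚ.* (s ^ℚ i ℚ.* s ^ℚ (n ∸ i))
            ≡⟨ cong (Cₘ ℚ.*_) (trans (sym (^-homo-* s i (n ∸ i))) (cong (s ^ℚ_) (ℕ.m+[n∸m]≡n i≤n))) ⟩
          Cₘ ℚ.* s ^ℚ n
            ∎
          where open +-*-Solver

      ‖power‖ : ∀ e k → 1 ℕ.≤ e → ‖ (ξ ^ᵍ e) ^ᵍ suc k ‖ ℚ.≤ 2ℚ ℚ.* s ^ℚ k
      ‖power‖ e k 1≤e = begin
        ‖ (ξ ^ᵍ e) ^ᵍ suc k ‖                     ≡⟨ cong ‖_‖ (^ᵍ-assocʳ ξ e (suc k)) ⟩
        ‖ ξ ^ᵍ m ‖                                ≤⟨ ξ^≤ m ⟩
        2ℚ ℚ.* (s ^ℚ m ℚ.* s ^ℚ m)                ≤⟨ *-monoˡ-≤ 0≤2 (*-mono-≤ (0≤pow S m) (0≤pow S k) (pow-anti S k≤m) (pow≤1 S m)) ⟩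
        2ℚ ℚ.* (s ^ℚ k ℚ.* 1ℚ)                    ≡⟨ cong (2ℚ ℚ.*_) (ℚ.*-identityʳ (s ^ℚ k)) ⟩
        2ℚ ℚ.* s ^ℚ k                             ∎
        where
        m : ℕ
        m = e ℕ.* suc k
        k≤m : k ℕ.≤ m
        k≤m = ℕ.≤-trans (ℕ.n≤1+n k) (ℕ.m≤n*m (suc k) e ⦃ ℕ.>-nonZero 1≤e ⦄)

      ‖pE‖ : ∀ e K → 1 ℕ.≤ e → ‖ pE (ξ ^ᵍ e) K ‖ ℚ.≤ Q∑.∏ K (λ k → 1ℚ ℚ.+ 2ℚ ℚ.* s ^ℚ k)
      ‖pE‖ e zero    1≤e = ℚ.≤-refl
      ‖pE‖ e (suc K) 1≤e = ℚ.≤-trans (‖*‖ (pE (ξ ^ᵍ e) K) (1ᵍ -ᵍ (ξ ^ᵍ e) ^ᵍ suc K))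
        (*-mono-≤ (0≤‖ 1ᵍ -ᵍ (ξ ^ᵍ e) ^ᵍ suc K ‖)
          (∏-nonNeg K λ k → 0≤+ (ℚ.nonNegative⁻¹ 1ℚ) (0≤* 0≤2 (0≤pow S k))) (‖pE‖ e K 1≤e)
          (ℚ.≤-trans (‖-‖ 1ᵍ ((ξ ^ᵍ e) ^ᵍ suc K)) (ℚ.+-monoʳ-≤ 1ℚ (‖power‖ e K 1≤e))))

      pE-increment : ∀ e K → 1 ℕ.≤ e → ‖ pE (ξ ^ᵍ e) (suc K) -ᵍ pE (ξ ^ᵍ e) K ‖ ℚ.≤ Cₑ ℚ.* s ^ℚ K
      pE-increment e K 1≤e = begin
        ‖ a *ᵍ (1ᵍ -ᵍ b) -ᵍ a ‖                ≡⟨ cong ‖_‖ (expand a b) ⟩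
        ‖ negᵍ (a *ᵍ b) ‖                      ≡⟨ ‖negᵍ‖ (a *ᵍ b) ⟩
        ‖ a *ᵍ b ‖                             ≤⟨ ‖*‖ a b ⟩
        ‖ a ‖ ℚ.* ‖ b ‖                        ≤⟨ *-mono-≤ (0≤‖ b ‖) (proj₁ (proj₂ ∏≤₂)) (ℚ.≤-trans (‖pE‖ e K 1≤e) (proj₂ (proj₂ ∏≤₂) K)) (‖power‖ e K 1≤e) ⟩
        proj₁ ∏≤₂ ℚ.* (2ℚ ℚ.* s ^ℚ K)          ≡⟨ ℚ.*-assoc (proj₁ ∏≤₂) 2ℚ (s ^ℚ K) ⟨
        Cₑ ℚ.* s ^ℚ K                          ∎
        where
        a b : ℚ[i]
        a = pE (ξ ^ᵍ e) K
        b = (ξ ^ᵍ e) ^ᵍ suc K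
        expand : ∀ a b → a *ᵍ (1ᵍ -ᵍ b) -ᵍ a ≡ negᵍ (a *ᵍ b)
        expand (a ⊹ a′) (b ⊹ b′) = cong₂ _⊹_
          (solve 4 (λ a a′ b b′ → a :* (con 1ℚ :- b) :- a′ :* (con 0ℚ :- b′) :- a := :- (a :* b :- a′ :* b′)) refl a a′ b b′)
          (solve 4 (λ a a′ b b′ → a :* (con 0ℚ :- b′) :+ a′ :* (con 1ℚ :- b) :- a′ := :- (a :* b′ :+ a′ :* b)) refl a a′ b b′)
          where open +-*-Solver

      -- Below degree n the component agrees with a polynomial whose full value at ξ is exactly the
      -- right-hand side. The error is the part of that polynomial from degree n on, and its
      -- coefficients are bounded independently of n. `M` exceeds both n and the degree.
      middle-identity : ∀ n → ‖ eval (component 1 c) ξ n -ᵍ negᵍ (ξ *ᵍ (pE (ξ ^ᵍ 9) n *ᵍ pE (ξ ^ᵍ 18) n)) ‖ ℚ.≤ C ℚ.* κ S ℚ.* s ^ℚ n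
      middle-identity n = begin
        ‖ eval (component 1 c) ξ n -ᵍ negᵍ w ‖                   ≡⟨ cong₂ (λ y z → ‖ y -ᵍ z ‖) (eval-cong ξ n (component₁-product n)) (sym w≡) ⟩
        ‖ eval (I₁-polynomial n) ξ n -ᵍ eval (I₁-polynomial n) ξ M ‖    ≡⟨ ‖-‖-sym (eval (I₁-polynomial n) ξ n) (eval (I₁-polynomial n) ξ M) ⟩
        ‖ eval (I₁-polynomial n) ξ M -ᵍ eval (I₁-polynomial n) ξ n ‖    ≤⟨ eval-tail {I₁-polynomial n} (I₁-polynomial-bounded n) (ℕ.m≤n⊔m (degree p) n) ⟩
        C ℚ.* κ S ℚ.* s ^ℚ n                                     ∎
        where
        v w : ℚ[i]
        v = pE (ξ ^ᵍ 9) n *ᵍ pE (ξ ^ᵍ 18) n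
        w = ξ *ᵍ v
        p : IsPolynomial ξ (I₁-polynomial n) (ξ *ᵍ (η -1ℤ *ᵍ v))
        p = poly-⊛ poly-X (poly-⊛ (poly-const -1ℤ) (poly-scaledProduct ξ 9 n (s≤s z≤n)))
        M : ℕ
        M = degree p ℕ.⊔ n
        pull : ∀ z v → z *ᵍ (η -1ℤ *ᵍ v) ≡ negᵍ (z *ᵍ v)
        pull (a ⊹ a′) (b ⊹ b′) = cong₂ _⊹_
          (solve 4 (λ a a′ b b′ → a :* (con (ι -1ℤ) :* b :- con 0ℚ :* b′) :- a′ :* (con (ι -1ℤ) :* b′ :+ con 0ℚ :* b) := :- (a :* b :- a′ :* b′)) refl a a′ b b′)
          (solve 4 (λ a a′ b b′ → a :* (con (ι -1ℤ) :* b′ :+ con 0ℚ :* b) :+ a′ :* (con (ι -1ℤ) :* b :- con 0ℚ :* b′) := :- (a :* b′ :+ a′ :* b)) refl a a′ b b′)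
          where open +-*-Solver
        w≡ : eval (I₁-polynomial n) ξ M ≡ negᵍ w
        w≡ = trans (eval-stable p M (ℕ.m≤m⊔n (degree p) n)) (pull ξ v)

      -- Below degree n the Cauchy products satisfy the identity exactly. Replacing them by products
      -- of truncations costs one `product-error` on the left and two on the right because of the
      -- coefficient 2, whence 1 + 2.
      outer-identity : ∀ n →
        ‖ eval (component 2 c) ξ n *ᵍ eval (component 0 c) ξ n
            -ᵍ negᵍ (η (ℤ.+ 2) *ᵍ (eval (component 1 c) ξ n *ᵍ (eval (component 1 c) ξ n *ᵍ 1ᵍ))) ‖
          ℚ.≤ (1ℚ ℚ.+ 2ℚ) ℚ.* (nat n ℚ.* (Cₘ ℚ.* s ^ℚ n))
      outer-identity n = begin
        ‖ e₂ *ᵍ e₀ -ᵍ negᵍ (η (ℤ.+ 2) *ᵍ (e₁ *ᵍ (e₁ *ᵍ 1ᵍ))) ‖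
          ≡⟨ cong (λ y → ‖ e₂ *ᵍ e₀ -ᵍ negᵍ (η (ℤ.+ 2) *ᵍ (e₁ *ᵍ y)) ‖) (G.*-identityʳ e₁) ⟩
        ‖ e₂ *ᵍ e₀ -ᵍ negᵍ (η (ℤ.+ 2) *ᵍ (e₁ *ᵍ e₁)) ‖
          ≡⟨ cong ‖_‖ (split (e₂ *ᵍ e₀) (e₁ *ᵍ e₁) q) ⟩
        ‖ (e₂ *ᵍ e₀ -ᵍ η (ℤ.- (ℤ.+ 2)) *ᵍ q) +ᵍ η (ℤ.+ 2) *ᵍ (e₁ *ᵍ e₁ -ᵍ q) ‖
          ≤⟨ ‖+‖ (e₂ *ᵍ e₀ -ᵍ η (ℤ.- (ℤ.+ 2)) *ᵍ q) (η (ℤ.+ 2) *ᵍ (e₁ *ᵍ e₁ -ᵍ q)) ⟩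
        ‖ e₂ *ᵍ e₀ -ᵍ η (ℤ.- (ℤ.+ 2)) *ᵍ q ‖ ℚ.+ ‖ η (ℤ.+ 2) *ᵍ (e₁ *ᵍ e₁ -ᵍ q) ‖
          ≤⟨ ℚ.+-mono-≤ first second ⟩
        δ ℚ.+ 2ℚ ℚ.* δ
          ≡⟨ solve 2 (λ t d → d :+ t :* d := (con 1ℚ :+ t) :* d) refl 2ℚ δ ⟩
        (1ℚ ℚ.+ 2ℚ) ℚ.* δ
          ∎
        where
        open +-*-Solver
        e₀ e₁ e₂ q : ℚ[i]
        e₀ = eval (component 0 c) ξ n
        e₁ = eval (component 1 c) ξ n
        e₂ = eval (component 2 c) ξ n
        q = eval (component 1 c · component 1 c) ξ n
        δ : ℚ
        δ = nat n ℚ.* (Cₘ ℚ.* s ^ℚ n)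
        p≡ : eval (component 2 c · component 0 c) ξ n ≡ η (ℤ.- (ℤ.+ 2)) *ᵍ q
        p≡ = trans (G∑.∑-cong< n λ j j<n → trans (cong (λ a → η a *ᵍ ξ ^ᵍ j) (components-product n j j<n))
            (trans (cong (_*ᵍ ξ ^ᵍ j) (η-* (ℤ.- (ℤ.+ 2)) ((component 1 c · component 1 c) j)))
                   (G.*-assoc (η (ℤ.- (ℤ.+ 2))) (η ((component 1 c · component 1 c) j)) (ξ ^ᵍ j))))
          (sym (G∑.*-∑ (η (ℤ.- (ℤ.+ 2))) n (term (component 1 c · component 1 c) ξ)))
        first : ‖ e₂ *ᵍ e₀ -ᵍ η (ℤ.- (ℤ.+ 2)) *ᵍ q ‖ ℚ.≤ δ
        first = subst (λ z → ‖ e₂ *ᵍ e₀ -ᵍ z ‖ ℚ.≤ δ) p≡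
          (product-error {component 2 c} {component 0 c} n (component-bounded 2) (component-bounded 0))
        second : ‖ η (ℤ.+ 2) *ᵍ (e₁ *ᵍ e₁ -ᵍ q) ‖ ℚ.≤ 2ℚ ℚ.* δ
        second = ℚ.≤-trans (‖*‖ (η (ℤ.+ 2)) (e₁ *ᵍ e₁ -ᵍ q))
          (*-monoˡ-≤ 0≤2 (product-error {component 1 c} {component 1 c} n (component-bounded 1) (component-bounded 1)))
        split : ∀ a b q → a -ᵍ negᵍ (η (ℤ.+ 2) *ᵍ b) ≡ (a -ᵍ η (ℤ.- (ℤ.+ 2)) *ᵍ q) +ᵍ η (ℤ.+ 2) *ᵍ (b -ᵍ q)
        split (a ⊹ a′) (b ⊹ b′) (q ⊹ q′) = cong₂ _⊹_
          (solve 5 (λ a b b′ q q′ → a :- (:- (con (ι (ℤ.+ 2)) :* b :- con 0ℚ :* b′))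
            := (a :- (con (ι (ℤ.- (ℤ.+ 2))) :* q :- con 0ℚ :* q′)) :+ (con (ι (ℤ.+ 2)) :* (b :- q) :- con 0ℚ :* (b′ :- q′))) refl a b b′ q q′)
          (solve 5 (λ a b b′ q q′ → a :- (:- (con (ι (ℤ.+ 2)) :* b′ :+ con 0ℚ :* b))
            := (a :- (con (ι (ℤ.- (ℤ.+ 2))) :* q′ :+ con 0ℚ :* q)) :+ (con (ι (ℤ.+ 2)) :* (b′ :- q′) :+ con 0ℚ :* (b :- q))) refl a′ b b′ q q′)

  -- Absorbs the number of rows in `product-error`: n s^n ≤ (n t^n) t^n ≤ κ t^n.
  n*pow≤pow : ∀ S T → ratio S ℚ.≤ ratio T ℚ.* ratio T → ∀ n → nat n ℚ.* ratio S ^ℚ n ℚ.≤ κ T ℚ.* ratio T ^ℚ n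
  n*pow≤pow S T s≤t² n = begin
    nat n ℚ.* s ^ℚ n                     ≤⟨ *-monoˡ-≤ (0≤nat n) (pow-mono n (0≤ratio S) s≤t²) ⟩
    nat n ℚ.* (t ℚ.* t) ^ℚ n             ≡⟨ cong (nat n ℚ.*_) (^-distrib-* t t n) ⟩
    nat n ℚ.* (t ^ℚ n ℚ.* t ^ℚ n)        ≡⟨ ℚ.*-assoc (nat n) (t ^ℚ n) (t ^ℚ n) ⟨
    nat n ℚ.* t ^ℚ n ℚ.* t ^ℚ n          ≤⟨ *-monoʳ-≤ (0≤pow T n) (n*pow≤κ T n) ⟩
    κ T ℚ.* t ^ℚ n                       ∎
    where
    s t : ℚ
    s = ratio S
    t = ratio T
    0≤nat : ∀ n → 0ℚ ℚ.≤ nat n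
    0≤nat zero    = ℚ.≤-refl
    0≤nat (suc n) = subst (0ℚ ℚ.≤_) (sym (nat-suc n)) (0≤+ (ℚ.nonNegative⁻¹ 1ℚ) (0≤nat n))

  module UnitDisk (x : ℂ) (∣x∣<1 : ∣ x ∣< 1ℚ) where

    private
      ε : ℚ
      ε = proj₁ ∣x∣<1

      N₀ : ℕ
      N₀ = proj₁ (proj₂ (proj₂ ∣x∣<1))

      abs²≤ : ∀ n → N₀ ℕ.≤ n → abs² (x at n) ℚ.≤ 1ℚ ℚ.- ε
      abs²≤ n N₀≤n = begin
        a                         ≡⟨ solve 2 (λ a e → a := (a :+ e) :- e) refl a ε ⟩
        a ℚ.+ ε ℚ.- ε             ≤⟨ ℚ.+-monoˡ-≤ (ℚ.- ε) (proj₂ (proj₂ (proj₂ ∣x∣<1)) n N₀≤n) ⟩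
        1ℚ ℚ.* 1ℚ ℚ.- ε           ≡⟨ cong (ℚ._- ε) (ℚ.*-identityˡ 1ℚ) ⟩
        1ℚ ℚ.- ε                  ∎
        where
        open +-*-Solver
        a : ℚ
        a = abs² (x at n)

      ρ : Ratio
      ρ = record
        { ratio   = 1ℚ ℚ.- ε
        -- 1 - ε is nonnegative because the squared modulus of the N₀-th approximation lies below
        -- it.
        ; 0≤ratio = ℚ.≤-trans (0≤+ (0≤p² (seq (re x) N₀)) (0≤p² (seq (im x) N₀))) (abs²≤ N₀ ℕ.≤-refl)
        ; ratio<1 = subst (1ℚ ℚ.- ε ℚ.<_) (ℚ.+-identityʳ 1ℚ) (ℚ.+-monoʳ-< 1ℚ (ℚ.neg-antimono-< (proj₁ (proj₂ ∣x∣<1))))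
        }

      -- `ρ` bounds |x|² and `R` bounds |x| along the approximations. From R ≤ S² comes the double
      -- power of s required by `Point`, and from S ≤ T² the ratio of the final estimate for `I₂I₀`.
      R S T : Ratio
      R = proj₁ (midpoint ρ)
      S = proj₁ (midpoint R)
      T = proj₁ (midpoint S)

      open Disk S

      ξ^≤ : ∀ n → N₀ ℕ.≤ n → ∀ k → ‖ (x at n) ^ᵍ k ‖ ℚ.≤ 2ℚ ℚ.* (ratio S ^ℚ k ℚ.* ratio S ^ℚ k)
      ξ^≤ n N₀≤n k = begin
        ‖ (x at n) ^ᵍ k ‖                              ≤⟨ ‖^‖ {x at n} {ratio R} k (0≤ratio R) (ℚ.≤-trans (abs²≤ n N₀≤n) (proj₂ (midpoint ρ))) ⟩
        2ℚ ℚ.* ratio R ^ℚ k                            ≤⟨ *-monoˡ-≤ 0≤2 (pow-mono k (0≤ratio R) (proj₂ (midpoint R))) ⟩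
        2ℚ ℚ.* (ratio S ℚ.* ratio S) ^ℚ k              ≡⟨ cong (2ℚ ℚ.*_) (^-distrib-* (ratio S) (ratio S) k) ⟩
        2ℚ ℚ.* (ratio S ^ℚ k ℚ.* ratio S ^ℚ k)         ∎

      module At (n : ℕ) (N₀≤n : N₀ ℕ.≤ n) = Point (x at n) (ξ^≤ n N₀≤n)

      I-increment : ∀ k m n → N₀ ℕ.≤ n →
        ‖ partialSum (component k c) x (suc m) at n -ᵍ partialSum (component k c) x m at n ‖ ℚ.≤ C ℚ.* ratio S ^ℚ m
      I-increment k m n N₀≤n = begin
        ‖ partialSum f x (suc m) at n -ᵍ partialSum f x m at n ‖
          ≡⟨ cong₂ (λ y z → ‖ y -ᵍ z ‖) (partialSum-at f x (suc m) n) (partialSum-at f x m n) ⟩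
        ‖ (eval f ξ m +ᵍ term f ξ m) -ᵍ eval f ξ m ‖
          ≡⟨ cong ‖_‖ (-ᵍ-cancel (eval f ξ m) (term f ξ m)) ⟩
        ‖ term f ξ m ‖
          ≤⟨ At.‖term‖ n N₀≤n {f} (component-bounded k) m ⟩
        C ℚ.* ratio S ^ℚ m
          ∎
        where
        f : PowerSeries
        f = component k c
        ξ : ℚ[i]
        ξ = x at n

      E-at : ∀ e m n → partialE (x ^ᶜ e) m at n ≡ pE ((x at n) ^ᵍ e) m
      E-at e m n = trans (partialE-at (x ^ᶜ e) m n) (cong (λ y → pE y m) (^ᶜ-at x e n))

      E-increment : ∀ e → 1 ℕ.≤ e → ∀ m n → N₀ ℕ.≤ n →
        ‖ partialE (x ^ᶜ e) (suc m) at n -ᵍ partialE (x ^ᶜ e) m at n ‖ ℚ.≤ Cₑ ℚ.* ratio S ^ℚ m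
      E-increment e 1≤e m n N₀≤n = ℚ.≤-trans
        (ℚ.≤-reflexive (cong₂ (λ y z → ‖ y -ᵍ z ‖) (E-at e (suc m) n) (E-at e m n))) (At.pE-increment n N₀≤n e m 1≤e)

      module Iᴸ (k : ℕ) = DiagonalLimit (partialSum (component k c) x) N₀ S C 0≤C (I-increment k)
      module E₉ᴸ = DiagonalLimit (partialE (x ^ᶜ 9)) N₀ S Cₑ 0≤Cₑ (E-increment 9 (s≤s z≤n))
      module E₁₈ᴸ = DiagonalLimit (partialE (x ^ᶜ 18)) N₀ S Cₑ 0≤Cₑ (E-increment 18 (s≤s z≤n))

      I-at : ∀ k n → Iᴸ.limit k at n ≡ eval (component k c) (x at n) n
      I-at k n = partialSum-at (component k c) x n n

    I₀ I₁ I₂ E₉ E₁₈ : ℂ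
    I₀ = Iᴸ.limit 0
    I₁ = Iᴸ.limit 1
    I₂ = Iᴸ.limit 2
    E₉ = E₉ᴸ.limit
    E₁₈ = E₁₈ᴸ.limit

    I₀-sum : I 0 x I₀
    I₀-sum = Iᴸ.converges 0

    I₁-sum : I 1 x I₁
    I₁-sum = Iᴸ.converges 1

    I₂-sum : I 2 x I₂
    I₂-sum = Iᴸ.converges 2

    E₉-product : E (x ^ᶜ 9) E₉
    E₉-product = E₉ᴸ.converges

    E₁₈-product : E (x ^ᶜ 18) E₁₈
    E₁₈-product = E₁₈ᴸ.converges

    I₂I₀ : I₂ *ᶜ I₀ ≃ -ᶜ (2ᶜ *ᶜ (I₁ ^ᶜ 2))
    I₂I₀ = ≃-geometric {I₂ *ᶜ I₀} { -ᶜ (2ᶜ *ᶜ (I₁ ^ᶜ 2))} N₀ T D 0≤D λ n N₀≤n → begin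
        -- The n-th entries of both sides reduce to this expression; the factor `1ᵍ` is the empty
        -- power inside `I₁ ^ᶜ 2`.
        ‖ (I₂ at n) *ᵍ (I₀ at n) -ᵍ negᵍ (η (ℤ.+ 2) *ᵍ ((I₁ at n) *ᵍ ((I₁ at n) *ᵍ 1ᵍ))) ‖
          ≡⟨ cong₂ (λ y z → ‖ y -ᵍ negᵍ (η (ℤ.+ 2) *ᵍ z) ‖) (cong₂ _*ᵍ_ (I-at 2 n) (I-at 0 n)) (cong (λ y → y *ᵍ (y *ᵍ 1ᵍ)) (I-at 1 n)) ⟩
        ‖ e 2 n *ᵍ e 0 n -ᵍ negᵍ (η (ℤ.+ 2) *ᵍ (e 1 n *ᵍ (e 1 n *ᵍ 1ᵍ))) ‖
          ≤⟨ At.outer-identity n N₀≤n n ⟩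
        (1ℚ ℚ.+ 2ℚ) ℚ.* (nat n ℚ.* (Cₘ ℚ.* ratio S ^ℚ n))
          ≡⟨ solve 4 (λ t n c p → t :* (n :* (c :* p)) := t :* c :* (n :* p)) refl (1ℚ ℚ.+ 2ℚ) (nat n) Cₘ (ratio S ^ℚ n) ⟩
        (1ℚ ℚ.+ 2ℚ) ℚ.* Cₘ ℚ.* (nat n ℚ.* ratio S ^ℚ n)
          ≤⟨ *-monoˡ-≤ 0≤3Cₘ (n*pow≤pow S T (proj₂ (midpoint S)) n) ⟩
        (1ℚ ℚ.+ 2ℚ) ℚ.* Cₘ ℚ.* (κ T ℚ.* ratio T ^ℚ n)
          ≡⟨ ℚ.*-assoc ((1ℚ ℚ.+ 2ℚ) ℚ.* Cₘ) (κ T) (ratio T ^ℚ n) ⟨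
        D ℚ.* ratio T ^ℚ n
          ∎
      where
      open +-*-Solver
      e : ℕ → ℕ → ℚ[i]
      e k n = eval (component k c) (x at n) n
      D : ℚ
      D = (1ℚ ℚ.+ 2ℚ) ℚ.* Cₘ ℚ.* κ T
      0≤3Cₘ : 0ℚ ℚ.≤ (1ℚ ℚ.+ 2ℚ) ℚ.* Cₘ
      0≤3Cₘ = 0≤* (ℚ.nonNegative⁻¹ (1ℚ ℚ.+ 2ℚ)) 0≤Cₘ
      0≤D : 0ℚ ℚ.≤ D
      0≤D = 0≤* 0≤3Cₘ (0≤κ T)

    I₁-value : I₁ ≃ -ᶜ (x *ᶜ (E₉ *ᶜ E₁₈))
    I₁-value = ≃-geometric {I₁} { -ᶜ (x *ᶜ (E₉ *ᶜ E₁₈))} N₀ S (C ℚ.* κ S) (0≤* 0≤C (0≤κ S)) λ n N₀≤n → begin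
        ‖ I₁ at n -ᵍ negᵍ ((x at n) *ᵍ ((E₉ at n) *ᵍ (E₁₈ at n))) ‖
          ≡⟨ cong₂ (λ y z → ‖ y -ᵍ negᵍ ((x at n) *ᵍ z) ‖) (I-at 1 n) (cong₂ _*ᵍ_ (E-at 9 n n) (E-at 18 n n)) ⟩
        ‖ eval (component 1 c) (x at n) n -ᵍ negᵍ ((x at n) *ᵍ (pE ((x at n) ^ᵍ 9) n *ᵍ pE ((x at n) ^ᵍ 18) n)) ‖
          ≤⟨ At.middle-identity n N₀≤n n ⟩
        C ℚ.* κ S ℚ.* ratio S ^ℚ n
          ∎

open Estimates

mainTheorem9 : (x : ℂ) → ∣ x ∣< 1ℚ →
    ∃[ I₀ ] ∃[ I₁ ] ∃[ I₂ ] ∃[ E₉ ] ∃[ E₁₈ ]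
    ( I 0 x I₀ × I 1 x I₁ × I 2 x I₂ × E (x ^ᶜ 9) E₉ × E (x ^ᶜ 18) E₁₈
    × I₂ *ᶜ I₀ ≃ -ᶜ (2ᶜ *ᶜ (I₁ ^ᶜ 2))
    × I₁ ≃ -ᶜ (x *ᶜ (E₉ *ᶜ E₁₈)) )
mainTheorem9 x ∣x∣<1 =
  I₀ , I₁ , I₂ , E₉ , E₁₈ , I₀-sum , I₁-sum , I₂-sum , E₉-product , E₁₈-product , I₂I₀ , I₁-value
  where open UnitDisk x ∣x∣<1
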